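{- Every $1$-bend apRAC graph with $n$ vertices has at most $5n-8$ edges. Moreover, there is an infinite family of graphs, each of which (having $n$ vertices) has $5n-16$ edges and admits a $1$-bend apRAC drawing.
   Context: Graphs are finite and simple. A $k$-bend drawing of a graph maps vertices to distinct points of the plane and each edge to a polyline (a sequence of straight-line edge-segments) with at most $k$ bends connecting its endpoints and not passing through other vertices. A $k$-bend RAC drawing is a $k$-bend drawing in which any two crossing edge-segments cross at a right angle. A $k$-bend apRAC drawing is a $k$-bend RAC drawing in which every edge-segment involved in a crossing is axis-parallel (every crossing is between a horizontal and a vertical edge-segment). A graph is $k$-bend apRAC if it admits a $k$-bend apRAC drawing.
   Formalization: Points of the plane have rational coordinates, so the bound 5n-8 is stated for graphs with a 1-bend apRAC drawing whose vertices and bends are rational points; for n ≤ 1 the bound 5n-8 is read as 0. -}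

module Defs where

open import Data.Nat using (ℕ)
open import Data.Fin using (Fin) renaming (_<_ to _<ᶠ_)
open import Data.Rational using (ℚ; _≤_; _*_; _-_; _⊓_; _⊔_)
open import Data.Product using (_×_; _,_; proj₁; proj₂; ∃)
open import Data.Sum using (_⊎_)
open import Data.Maybe using (Maybe; just; nothing)
open import Data.List using (List; []; _∷_)
open import Data.List.Membership.Propositional using (_∈_)
open import Data.List.Relation.Unary.All using (All)
open import Data.List.Relation.Unary.Unique.Propositional using (Unique)
open import Relation.Binary.PropositionalEquality using (_≡_; _≢_)
open import Relation.Nullary using (¬_)
open import Function.Definitions using (Injective)

-- A finite simple graph on vertex set Fin n: a duplicate-free list of
-- edges {u,v}, each stored once as (u , v) with u < v (so no loops,
-- no multi-edges).  The number of edges is the length of the list.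
record Graph (n : ℕ) : Set where
  field
    edges   : List (Fin n × Fin n)
    ordered : All (λ e → proj₁ e <ᶠ proj₂ e) edges
    unique  : Unique edges
open Graph public

Point : Set
Point = ℚ × ℚ

Segment : Set
Segment = Point × Point

OnSeg : Point → Segment → Set
OnSeg (qx , qy) ((ax , ay) , (bx , by)) =
  ((bx - ax) * (qy - ay) ≡ (by - ay) * (qx - ax))
  × (ax ⊓ bx ≤ qx) × (qx ≤ ax ⊔ bx)
  × (ay ⊓ by ≤ qy) × (qy ≤ ay ⊔ by)

Horizontal : Segment → Set
Horizontal ((_ , ay) , (_ , by)) = ay ≡ by

Vertical : Segment → Set
Vertical ((ax , _) , (bx , _)) = ax ≡ bx

IsEnd : ∀ {n} → Fin n → Fin n × Fin n → Set
IsEnd u e = (u ≡ proj₁ e) ⊎ (u ≡ proj₂ e)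

segments : Point → Point → Maybe Point → List Segment
segments p q nothing  = (p , q) ∷ []
segments p q (just b) = (p , b) ∷ (b , q) ∷ []

record OneBendApRAC {n : ℕ} (G : Graph n) : Set where
  field
    pos     : Fin n → Point
    pos-inj : Injective _≡_ _≡_ pos
    bend    : Fin n × Fin n → Maybe Point
  segs : Fin n × Fin n → List Segment
  segs e = segments (pos (proj₁ e)) (pos (proj₂ e)) (bend e)
  field
    bend-ok : ∀ e → e ∈ edges G → ∀ b → bend e ≡ just b →
              (b ≢ pos (proj₁ e)) × (b ≢ pos (proj₂ e))
    avoid   : ∀ e → e ∈ edges G → ∀ w → ¬ IsEnd w e →
              ∀ s → s ∈ segs e → ¬ OnSeg (pos w) s
    -- every common point of segments of two distinct edges, other than a
    -- shared end-vertex, is a crossing between a horizontal and a vertical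
    -- edge-segment (hence right-angled and axis-parallel)
    apRAC   : ∀ e f → e ∈ edges G → f ∈ edges G → e ≢ f →
              ∀ s t → s ∈ segs e → t ∈ segs f →
              ∀ q → OnSeg q s → OnSeg q t →
              (∀ u → IsEnd u e → IsEnd u f → q ≢ pos u) →
              (Horizontal s × Vertical t) ⊎ (Vertical s × Horizontal t)

Is1BendApRAC : ∀ {n} → Graph n → Set
Is1BendApRAC G = OneBendApRAC G

{-# OPTIONS --safe #-}
module Submission where

-- Upper bound.  Every segment of a 1-bend drawing ends in a vertex, so at each
-- vertex at most one vertical segment leaves upwards and one downwards.  Remove
-- every edge using such a port, except the upper port of a topmost vertex and the
-- lower port of a bottommost one: at most 2n - 2 edges.  Vertical segments at the
-- two excepted ports are not crossed, so independent remaining edges are disjoint.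
--
-- It remains to bound the remaining edges by 3n - 6.  For disjoint segments a b
-- and c d, the number of endpoints of either segment lying above the other one is
-- determined mod 2 by the left-to-right order of the endpoints.  This condition on
-- independent edges survives the contraction of an edge, and adding it up over the
-- 15 pairs of independent edges of a K₅ yields 0 = 1.  Mader's argument for
-- graphs without a K₅ minor then gives the bound, without any use of faces.
--
-- Lower bound.  Put points (x , x) with x = 1, 1/2, 1/4, ... on the diagonal, join
-- consecutive ones, and join each of them to four apices N, W, S, E by an edge that
-- leaves it upwards, leftwards, downwards and rightwards, respectively, bending just
-- before its apex.  All crossings are between these axis-parallel stems, and five
-- further edges between the apices can be drawn outside.

-- Every crossing involves a vertical segment, so it suffices to deal with the vertical ones, and 5n
-- - 8 = (2n - 2) + (3n - 6). Nothing is claimed about kept edges with a common end, nor about the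
-- two segments of one edge; therefore the notion carried through the induction constrains
-- independent edges only. The obstacle to an induction on drawings is contraction, which would
-- require redrawing. Ties between x-coordinates, unavoidable with vertical segments, disappear by
-- comparing points lexicographically. For the lower bound the obstacle is the unbounded number of
-- pairs of segments. All inner coordinates lie in (0, 1], so the segments fall into sixteen kinds
-- with bounding boxes that do not depend on the index. A computed table settles most pairs of
-- kinds, and only a short list of touching kinds needs an argument.

-- Parity drawings: exclusion of K₅ and closure under contraction.

module ParityDrawings where

  open import Data.Bool using (Bool; true; false; _xor_; _∧_; _∨_; not; if_then_else_)
  open import Data.Bool.Properties using (∨-comm; ∧-zeroʳ; ∨-identityʳ)
  open import Data.Bool.Solver using (module xor-∧-Solver)
  open import Data.Empty using (⊥)
  open import Data.Fin using (Fin; suc; punchIn; _≟_)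
  open import Data.Fin.Properties using (punchInᵢ≢i; punchIn-injective)
  open import Data.Nat using (ℕ; suc)
  open import Data.Sum using (_⊎_; inj₁; inj₂)
  open import Function using (_∘_)
  open import Relation.Binary.PropositionalEquality
  open import Relation.Nullary using (contradiction; does; yes; no)
  open import Relation.Nullary.Decidable using (dec-true; dec-false)
  open xor-∧-Solver using (Polynomial; solve; _:=_; con; _:+_)


  -- left i j: vertex i lies to the left of vertex j.  below p u v: the parity of
  -- the number of times the edge u v passes below vertex p.  By the segment
  -- computation parity-disjoint, even says that independent edges cross evenly.
  record ParityDrawing {n : ℕ} (A : Fin n → Fin n → Bool) : Set where
    field
      symm    : ∀ i j → A i j ≡ A j i
      irrefl  : ∀ i → A i i ≡ false
      left    : Fin n → Fin n → Bool
      left-tournament : ∀ {i j} → i ≢ j → left i j ≡ not (left j i)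
      below   : Fin n → Fin n → Fin n → Bool
      even    : ∀ {u v w x} → A u v ≡ true → A w x ≡ true →
                u ≢ w → u ≢ x → v ≢ w → v ≢ x →
                (below u w x xor below v w x) xor (below w u v xor below x u v)
                ≡ (left w u xor left w v) xor (left x u xor left x v)

  module _ {V : Set} (d : V → V → V → Bool) where

    crossings : V → V → V → V → Bool
    crossings u v w x = (d u w x xor d v w x) xor (d w u v xor d x u v)

    -- The three perfect matchings of a quadruple; over the five quadruples of a K₅ they give the 15
    -- pairs of independent edges. Every edge is written earlier letter first, so that terms which
    -- are to cancel agree literally.
    pairings : V → V → V → V → Bool
    pairings a b c e = crossings a b c e xor (crossings a c b e xor crossings a e b c)

    -- Every edge lies in three of the five quadruples, and each of the
    -- three remaining vertices lies with it in exactly two of them.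
    pairings-cancel : ∀ a b c e f →
      pairings a b c e xor (pairings a b c f xor (pairings a b e f xor (pairings a c e f xor pairings b c e f)))
      ≡ false
    pairings-cancel a b c e f = solve 30
      (λ acd bcd cab dab abd cbd bac dac abc dbc bad cad ace bce eab abe cbe eac ebc bae cae
         ade bde dbe ead ebd dae cde dce ecd →
        q acd bcd cab dab abd cbd bac dac abc dbc bad cad :+
        (q ace bce cab eab abe cbe bac eac abc ebc bae cae :+
        (q ade bde dab eab abe dbe bad ead abd ebd bae dae :+
        (q ade cde dac eac ace dce cad ead acd ecd cae dae :+
         q bde cde dbc ebc bce dce cbd ebd bcd ecd cbe dbe))) := con false) refl
      (d a c e) (d b c e) (d c a b) (d e a b) (d a b e) (d c b e) (d b a c) (d e a c) (d a b c) (d e b c)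
      (d b a e) (d c a e) (d a c f) (d b c f) (d f a b) (d a b f) (d c b f) (d f a c) (d f b c) (d b a f)
      (d c a f) (d a e f) (d b e f) (d e b f) (d f a e) (d f b e) (d e a f) (d c e f) (d e c f) (d f c e)
      where
      q : ∀ {k} (a b c d e f g h i j l m : Polynomial k) → Polynomial k
      q a b c d e f g h i j l m =
        ((a :+ b) :+ (c :+ d)) :+ (((e :+ f) :+ (g :+ h)) :+ ((i :+ j) :+ (l :+ m)))

  module _ {n : ℕ} {A : Fin n → Fin n → Bool} (D : ParityDrawing A) where
    open ParityDrawing D

    private
      _~_ : Fin n → Fin n → Set
      u ~ v = A u v ≡ true

    adjacent⇒≢ : ∀ {u v} → u ~ v → u ≢ v
    adjacent⇒≢ {u} uv refl with trans (sym uv) (irrefl u)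
    ... | ()

    -- By `even` only the order terms remain. Every pair of vertices occurs in two of the three
    -- matchings: the pairs containing `a` occur twice in the same direction and cancel, the other
    -- three occur once in each direction and contribute 1 each.
    K4-odd : ∀ {a b c d} → a ~ b → a ~ c → a ~ d → b ~ c → b ~ d → c ~ d →
             pairings below a b c d ≡ true
    K4-odd {a} {b} {c} {d} ab ac ad bc bd cd = trans
      (cong₂ _xor_
        (even ab cd (adjacent⇒≢ ac) (adjacent⇒≢ ad) (adjacent⇒≢ bc) (adjacent⇒≢ bd))
        (cong₂ _xor_
          (even ac bd (adjacent⇒≢ ab) (adjacent⇒≢ ad) (≢-sym (adjacent⇒≢ bc)) (adjacent⇒≢ cd))
          (even ad bc (adjacent⇒≢ ab) (adjacent⇒≢ ac) (≢-sym (adjacent⇒≢ bd)) (≢-sym (adjacent⇒≢ cd)))))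
      (links (left c a) (left d a) (left b a) (left-tournament (adjacent⇒≢ bc))
             (left-tournament (adjacent⇒≢ bd)) (left-tournament (adjacent⇒≢ cd)))
      where
      links : ∀ ca da ba {cb db bc bd cd dc} → bc ≡ not cb → bd ≡ not db → cd ≡ not dc →
        ((ca xor cb) xor (da xor db)) xor (((ba xor bc) xor (da xor dc)) xor
          ((ba xor bd) xor (ca xor cd))) ≡ true
      links ca da ba {cb} {db} {dc = dc} refl refl refl = solve 6 (λ ca cb da db ba dc →
        ((ca :+ cb) :+ (da :+ db)) :+ (((ba :+ (con true :+ cb)) :+ (da :+ dc)) :+
        ((ba :+ (con true :+ db)) :+ (ca :+ (con true :+ dc)))) := con true) refl ca cb da db ba dc

    -- Five odd contributions, one for each K₄, have an odd sum, against `pairings-cancel`.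
    no-K5 : ∀ {a b c d e} → a ~ b → a ~ c → a ~ d → a ~ e → b ~ c → b ~ d → b ~ e →
            c ~ d → c ~ e → d ~ e → ⊥
    no-K5 {a} {b} {c} {d} {e} ab ac ad ae bc bd be cd ce de =
      contradiction (trans (sym odd) (pairings-cancel below a b c d e)) λ ()
      where
      odd : pairings below a b c d xor (pairings below a b c e xor (pairings below a b d e xor
              (pairings below a c d e xor pairings below b c d e))) ≡ true
      odd = cong₂ _xor_ (K4-odd ab ac ad bc bd cd) (cong₂ _xor_ (K4-odd ab ac ae bc be ce)
              (cong₂ _xor_ (K4-odd ab ad ae bd be de) (cong₂ _xor_ (K4-odd ac ad ae cd ce de)
                (K4-odd bc bd be cd ce de))))


  ⟦_⟧ : Bool → ℕ
  ⟦ true ⟧ = 1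
  ⟦ false ⟧ = 0

  ∧-left : ∀ a {b} → a ∧ b ≡ true → a ≡ true
  ∧-left true _ = refl

  ∧-right : ∀ a {b} → a ∧ b ≡ true → b ≡ true
  ∧-right true e = e

  not-true : ∀ {a} → not a ≡ true → a ≡ false
  not-true {false} _ = refl

  ∨-split : ∀ a {b} → a ∨ b ≡ true → a ≡ true ⊎ b ≡ true
  ∨-split true  _ = inj₁ refl
  ∨-split false e = inj₂ e

  if-true : ∀ {X : Set} {a} {s t : X} → a ≡ true → (if a then s else t) ≡ s
  if-true refl = refl

  if-false : ∀ {X : Set} {a} {s t : X} → a ≡ false → (if a then s else t) ≡ t
  if-false refl = refl

  ≟-sound : ∀ {n} {i j : Fin n} → does (i ≟ j) ≡ true → i ≡ j
  ≟-sound {i = i} {j} e with i ≟ j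
  ... | yes p = p
  ≟-sound () | no _

  -- Concatenation: if the second edge is a path from `w` through `y` to `z`, the identities for its
  -- two halves add up, and whatever belongs to `y` alone cancels mod 2. This serves contractions,
  -- where `y` is a vertex, as well as polylines, where it is a bend.
  detour-right : ∀ u₁ u₂ v₁ v₂ w y z lw ly lz →
    (u₁ xor v₁) xor (w xor y) ≡ lw xor ly → (u₂ xor v₂) xor (y xor z) ≡ ly xor lz →
    ((u₁ xor u₂) xor (v₁ xor v₂)) xor (w xor z) ≡ lw xor lz
  detour-right u₁ u₂ v₁ v₂ w y z lw ly lz e f = begin
    ((u₁ xor u₂) xor (v₁ xor v₂)) xor (w xor z)
      ≡⟨ solve 7 (λ u₁ u₂ v₁ v₂ w y z → ((u₁ :+ u₂) :+ (v₁ :+ v₂)) :+ (w :+ z) :=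
           ((u₁ :+ v₁) :+ (w :+ y)) :+ ((u₂ :+ v₂) :+ (y :+ z))) refl u₁ u₂ v₁ v₂ w y z ⟩
    ((u₁ xor v₁) xor (w xor y)) xor ((u₂ xor v₂) xor (y xor z))  ≡⟨ cong₂ _xor_ e f ⟩
    (lw xor ly) xor (ly xor lz)
      ≡⟨ solve 3 (λ lw ly lz → (lw :+ ly) :+ (ly :+ lz) := lw :+ lz) refl lw ly lz ⟩
    lw xor lz ∎
    where open ≡-Reasoning

  detour-left : ∀ u v y w₁ w₂ z₁ z₂ wu wv wy zu zv zy →
    (u xor y) xor (w₁ xor z₁) ≡ (wu xor wy) xor (zu xor zy) →
    (y xor v) xor (w₂ xor z₂) ≡ (wy xor wv) xor (zy xor zv) →
    (u xor v) xor ((w₁ xor w₂) xor (z₁ xor z₂)) ≡ (wu xor wv) xor (zu xor zv)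
  detour-left u v y w₁ w₂ z₁ z₂ wu wv wy zu zv zy e f = begin
    (u xor v) xor ((w₁ xor w₂) xor (z₁ xor z₂))
      ≡⟨ solve 7 (λ u v y w₁ w₂ z₁ z₂ → (u :+ v) :+ ((w₁ :+ w₂) :+ (z₁ :+ z₂)) :=
           ((u :+ y) :+ (w₁ :+ z₁)) :+ ((y :+ v) :+ (w₂ :+ z₂))) refl u v y w₁ w₂ z₁ z₂ ⟩
    ((u xor y) xor (w₁ xor z₁)) xor ((y xor v) xor (w₂ xor z₂))  ≡⟨ cong₂ _xor_ e f ⟩
    ((wu xor wy) xor (zu xor zy)) xor ((wy xor wv) xor (zy xor zv))
      ≡⟨ solve 6 (λ wu wv wy zu zv zy → ((wu :+ wy) :+ (zu :+ zy)) :+ ((wy :+ wv) :+ (zy :+ zv)) :=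
           (wu :+ wv) :+ (zu :+ zv)) refl wu wv wy zu zv zy ⟩
    (wu xor wv) xor (zu xor zv) ∎
    where open ≡-Reasoning

  deleteVertex : ∀ {n} {A : Fin (suc n) → Fin (suc n) → Bool} → ParityDrawing A → (y : Fin (suc n)) →
                 ParityDrawing (λ i j → A (punchIn y i) (punchIn y j))
  deleteVertex D y = record
    { symm    = λ i j → symm (p i) (p j)
    ; irrefl  = λ i → irrefl (p i)
    ; left    = λ i j → left (p i) (p j)
    ; left-tournament = λ i≢j → left-tournament (i≢j ∘ inj)
    ; below   = λ i j k → below (p i) (p j) (p k)
    ; even    = λ uv wx a b c d → even uv wx (a ∘ inj) (b ∘ inj) (c ∘ inj) (d ∘ inj)
    }
    where
    open ParityDrawing D
    p = punchIn y
    inj : ∀ {i j} → p i ≡ p j → i ≡ j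
    inj = punchIn-injective y _ _

  module Contraction {n : ℕ} {A : Fin (suc n) → Fin (suc n) → Bool} (D : ParityDrawing A)
                     (y : Fin (suc n)) (x : Fin n) (yx : A y (punchIn y x) ≡ true) where
    open ParityDrawing D

    p : Fin n → Fin (suc n)
    p = punchIn y

    p-inj : ∀ {i j} → p i ≡ p j → i ≡ j
    p-inj = punchIn-injective y _ _

    -- For a common neighbour of `x` and `y` the old edge at `x` survives together with its `below`
    -- values; only the other neighbours of `y` acquire an edge.
    new : Fin n → Bool
    new j = (A y (p j) ∧ not (A (p x) (p j))) ∧ not (does (j ≟ x))

    Contracted : Fin n → Fin n → Bool
    Contracted i j = A (p i) (p j) ∨ ((does (i ≟ x) ∧ new j) ∨ (does (j ≟ x) ∧ new i))

    -- A new edge is drawn along the contracted edge x y and then along an edge at y.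
    contractedBelow : Fin n → Fin n → Fin n → Bool
    contractedBelow q i j =
      if A (p i) (p j) then below (p q) (p i) (p j)
      else if does (i ≟ x) then below (p q) (p x) y xor below (p q) y (p j)
      else below (p q) (p i) y xor below (p q) y (p x)

    -- In `through` the edge runs from `i` to `y` to `j`, whichever end is `x`, so both orientations
    -- are treated at once. The field telling which end is `x` shows that two such edges are never
    -- independent.
    data EdgeOrigin (i j : Fin n) : Set where
      old     : A (p i) (p j) ≡ true →
                (∀ q → contractedBelow q i j ≡ below (p q) (p i) (p j)) → EdgeOrigin i j
      through : i ≡ x ⊎ j ≡ x → A (p i) y ≡ true → A y (p j) ≡ true →
                (∀ q → contractedBelow q i j ≡ below (p q) (p i) y xor below (p q) y (p j)) →
                EdgeOrigin i j

    new-adjacent : ∀ j → new j ≡ true → A y (p j) ≡ true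
    new-adjacent j e = ∧-left (A y (p j)) (∧-left (A y (p j) ∧ not (A (p x) (p j))) e)

    new-other : ∀ j → new j ≡ true → does (j ≟ x) ≡ false
    new-other j e = not-true (∧-right (A y (p j) ∧ not (A (p x) (p j))) e)

    origin : ∀ i j → Contracted i j ≡ true → EdgeOrigin i j
    origin i j e with A (p i) (p j) in ij
    ... | true = old ij λ q → if-true ij
    ... | false with ∨-split (does (i ≟ x) ∧ new j) e
    ...   | inj₁ m = through (inj₁ i≡x) (subst (λ k → A (p k) y ≡ true) (sym i≡x) (trans (symm _ _) yx))
                       (new-adjacent j (∧-right (does (i ≟ x)) m)) λ q →
                       trans (if-false ij) (trans (if-true (∧-left (does (i ≟ x)) m))
                         (cong (λ k → below (p q) (p k) y xor below (p q) y (p j)) (sym i≡x)))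
      where i≡x = ≟-sound (∧-left (does (i ≟ x)) m)
    ...   | inj₂ m = through (inj₂ j≡x) (trans (symm _ _) (new-adjacent i new-i))
                       (subst (λ k → A y (p k) ≡ true) (sym j≡x) yx) λ q →
                       trans (if-false ij) (trans (if-false (new-other i new-i))
                         (cong (λ k → below (p q) (p i) y xor below (p q) y (p k)) (sym j≡x)))
      where
      j≡x   = ≟-sound (∧-left (does (j ≟ x)) m)
      new-i = ∧-right (does (j ≟ x)) m

    contracted : ParityDrawing Contracted
    contracted = record
      { symm    = λ i j → cong₂ _∨_ (symm (p i) (p j)) (∨-comm (does (i ≟ x) ∧ new j) _)
      ; irrefl  = Contracted-irrefl
      ; left    = λ i j → left (p i) (p j)
      ; left-tournament = λ i≢j → left-tournament (i≢j ∘ p-inj)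
      ; below   = contractedBelow
      ; even    = contracted-even
      }
      where
      Contracted-irrefl : ∀ i → Contracted i i ≡ false
      Contracted-irrefl i with i ≟ x
      ... | no  _ = trans (∨-identityʳ _) (irrefl (p i))
      ... | yes _ rewrite irrefl (p i) | ∧-zeroʳ (A y (p i) ∧ not (A (p x) (p i))) = refl

      p≢y : ∀ {i} → p i ≢ y
      p≢y = punchInᵢ≢i y _

      contracted-even : ∀ {u v w z} → Contracted u v ≡ true → Contracted w z ≡ true →
        u ≢ w → u ≢ z → v ≢ w → v ≢ z →
        (contractedBelow u w z xor contractedBelow v w z) xor (contractedBelow w u v xor contractedBelow z u v)
        ≡ (left (p w) (p u) xor left (p w) (p v)) xor (left (p z) (p u) xor left (p z) (p v))
      contracted-even {u} {v} {w} {z} uv wz uw uz vw vz with origin u v uv | origin w z wz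
      ... | old e r | old f s = trans
        (cong₂ _xor_ (cong₂ _xor_ (s u) (s v)) (cong₂ _xor_ (r w) (r z)))
        (even e f (uw ∘ p-inj) (uz ∘ p-inj) (vw ∘ p-inj) (vz ∘ p-inj))
      -- Both halves of the detour are independent of the old edge, because `y` is outside the image
      -- of `p`.
      ... | old e r | through _ f g s = trans
        (cong₂ _xor_ (cong₂ _xor_ (s u) (s v)) (cong₂ _xor_ (r w) (r z)))
        (detour-right (below (p u) (p w) y) _ (below (p v) (p w) y) _ (below (p w) (p u) (p v)) (below y (p u) (p v)) _
          (left (p w) (p u) xor left (p w) (p v)) (left y (p u) xor left y (p v)) _
          (even e f (uw ∘ p-inj) p≢y (vw ∘ p-inj) p≢y)
          (even e g p≢y (uz ∘ p-inj) p≢y (vz ∘ p-inj)))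
      ... | through _ f g s | old e r = trans
        (cong₂ _xor_ (cong₂ _xor_ (r u) (r v)) (cong₂ _xor_ (s w) (s z)))
        (detour-left (below (p u) (p w) (p z)) _ (below y (p w) (p z))
          (below (p w) (p u) y) _ (below (p z) (p u) y) _
          (left (p w) (p u)) _ (left (p w) y) (left (p z) (p u)) _ (left (p z) y)
          (even f e (uw ∘ p-inj) (uz ∘ p-inj) (≢-sym p≢y) (≢-sym p≢y))
          (even g e (≢-sym p≢y) (≢-sym p≢y) (vw ∘ p-inj) (vz ∘ p-inj)))
      ... | through (inj₁ refl) _ _ _ | through (inj₁ refl) _ _ _ = contradiction refl uw
      ... | through (inj₁ refl) _ _ _ | through (inj₂ refl) _ _ _ = contradiction refl uz
      ... | through (inj₂ refl) _ _ _ | through (inj₁ refl) _ _ _ = contradiction refl vw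
      ... | through (inj₂ refl) _ _ _ | through (inj₂ refl) _ _ _ = contradiction refl vz

    Contracted-old : ∀ {i j} → A (p i) (p j) ≡ true → Contracted i j ≡ true
    Contracted-old e rewrite e = refl

    Contracted-through : ∀ {j} → j ≢ x → A y (p j) ≡ true → Contracted x j ≡ true
    Contracted-through {j} j≢x yj with A (p x) (p j)
    ... | true = refl
    ... | false rewrite yj | dec-true (x ≟ x) refl | dec-false (j ≟ x) j≢x = refl

-- Mader's edge bound for parity drawings.

module Mader where

  open import Data.Bool using (Bool; true; false; _∧_; _∨_; not; if_then_else_; T; T?)
  open import Data.Empty using (⊥; ⊥-elim)
  open import Data.Fin using (Fin; zero; suc; punchIn; punchOut; _≟_)
  open import Data.Fin.Properties using (punchInᵢ≢i; punchIn-punchOut; punchOut-injective)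
  open import Data.List using (List; []; _∷_; filterᵇ; allFin; length; tabulate; map)
  open import Data.List.Membership.Propositional using (find)
  open import Data.List.Properties using (map-tabulate)
  open import Data.List.Relation.Unary.All as All using (All; []; _∷_)
  open import Data.List.Relation.Unary.All.Properties using (all-filter; ¬All⇒Any¬)
  open import Data.List.Relation.Unary.AllPairs using ([]; _∷_)
  open import Data.List.Relation.Unary.Unique.Propositional using (Unique)
  open import Data.List.Relation.Unary.Unique.Propositional.Properties using (allFin⁺; filter⁺)
  open import Data.Nat using (ℕ; zero; suc; _+_; _*_; _≤_; z≤n; s≤s; _≤?_; _≤ᵇ_)
  open import Data.Nat.ListAction using () renaming (sum to listSum)
  open import Data.Nat.Properties using (+-0-commutativeMonoid; +-identityʳ; +-mono-≤; *-suc; ≤-trans; ≤-refl; ≤-reflexive; ≤-total; module ≤-Reasoning; ≤⇒≤ᵇ; *-monoʳ-≤; +-assoc; ≮⇒≥; m+1+n≰m; +-cancelʳ-≤; +-cancelˡ-≤; +-monoˡ-≤; ≰⇒>)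
  open import Data.Nat.Solver using (module +-*-Solver)
  open import Data.Product using (∃; _×_; _,_)
  open import Data.Sum using (_⊎_; inj₁; inj₂)
  open import Data.Vec using (Vec; []; _∷_)
  open import Function using (_∘_; id)
  open import Relation.Binary.PropositionalEquality
  open import Relation.Nullary using (contradiction; does; yes; no)
  open import Relation.Nullary.Decidable using (dec-true; dec-false)
  open import Algebra.Properties.CommutativeMonoid.Sum +-0-commutativeMonoid using (sum; sum-remove; ∑-distrib-+; sum-cong-≗; sum-replicate-zero)
  open ParityDrawings
  open +-*-Solver using (solve; _:=_; con; _:+_; _:*_)


  degree : ∀ {n} → (Fin n → Fin n → Bool) → Fin n → ℕ
  degree A i = sum (λ j → ⟦ A i j ⟧)

  -- Twice the number of edges for a symmetric irreflexive `A`; hence 3n - 6 appears in the doubled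
  -- form `total A + 12 ≤ 6 * n`.
  total : ∀ {n} → (Fin n → Fin n → Bool) → ℕ
  total A = sum (degree A)

  common : ∀ {n} → (Fin n → Fin n → Bool) → Fin n → Fin n → ℕ
  common A i k = sum (λ j → ⟦ A i j ∧ A k j ⟧)

  sum-zero : ∀ {n} (f : Fin n → ℕ) → (∀ i → f i ≡ 0) → sum f ≡ 0
  sum-zero {n} f f≡0 = trans (sum-cong-≗ f≡0) (sum-replicate-zero n)

  sum-indicator : ∀ {n} (x : Fin n) (c : ℕ) → sum (λ i → if does (i ≟ x) then c else 0) ≡ c
  sum-indicator {suc n} x c = begin
    sum f                            ≡⟨ sum-remove {i = x} f ⟩
    f x + sum (f ∘ punchIn x)        ≡⟨ cong₂ _+_ (if-true (dec-true (x ≟ x) refl))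
                                          (sum-zero _ λ i → if-false (dec-false (punchIn x i ≟ x) (punchInᵢ≢i x i))) ⟩
    c + 0                            ≡⟨ +-identityʳ c ⟩
    c                                ∎
    where
    open ≡-Reasoning
    f : Fin (suc n) → ℕ
    f i = if does (i ≟ x) then c else 0

  sum-lower : ∀ {n} (f : Fin n → ℕ) k → (∀ i → k ≤ f i) → n * k ≤ sum f
  sum-lower {zero}  f k k≤f = z≤n
  sum-lower {suc n} f k k≤f = +-mono-≤ (k≤f zero) (sum-lower (f ∘ suc) k (k≤f ∘ suc))

  module _ {X : Set} {_⊑_ : X → X → Set} (refl⊑ : ∀ {x} → x ⊑ x) (trans⊑ : ∀ {x y z} → x ⊑ y → y ⊑ z → x ⊑ z)
           (total⊑ : ∀ x y → x ⊑ y ⊎ y ⊑ x) where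

    -- Stated for any total preorder, as it selects a vertex of minimum degree here and a topmost
    -- and a bottommost vertex over ℚ later.
    least : ∀ {n} (f : Fin (suc n) → X) → ∃ λ i → ∀ j → f i ⊑ f j
    least {zero}  f = zero , λ where zero → refl⊑
    least {suc n} f with least (f ∘ suc)
    ... | i , min with total⊑ (f zero) (f (suc i))
    ...   | inj₁ le = zero , λ where zero → refl⊑
                                     (suc j) → trans⊑ le (min j)
    ...   | inj₂ ge = suc i , λ where zero → ge
                                      (suc j) → min j

  module _ {n : ℕ} {A : Fin (suc n) → Fin (suc n) → Bool} (D : ParityDrawing A) (y : Fin (suc n)) where
    open ParityDrawing D
    private p = punchIn y

    degree-remove : degree A y ≡ sum (λ j → ⟦ A y (p j) ⟧)
    degree-remove = trans (sum-remove {i = y} (λ j → ⟦ A y j ⟧))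
                          (cong (λ b → ⟦ b ⟧ + sum (λ j → ⟦ A y (p j) ⟧)) (irrefl y))

    total-delete : total A ≡ 2 * degree A y + total (λ i j → A (p i) (p j))
    total-delete = begin
      total A
        ≡⟨ sum-remove {i = y} (degree A) ⟩
      degree A y + sum (λ i → degree A (p i))
        ≡⟨ cong (degree A y +_) (sum-cong-≗ λ i → sum-remove {i = y} (λ j → ⟦ A (p i) j ⟧)) ⟩
      degree A y + sum (λ i → ⟦ A (p i) y ⟧ + sum (λ j → ⟦ A (p i) (p j) ⟧))
        ≡⟨ cong (degree A y +_) (∑-distrib-+ (λ i → ⟦ A (p i) y ⟧) _) ⟩
      degree A y + (sum (λ i → ⟦ A (p i) y ⟧) + t)
        ≡⟨ cong (λ s → degree A y + (s + t)) (trans (sum-cong-≗ λ i → cong ⟦_⟧ (symm (p i) y)) (sym degree-remove)) ⟩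
      degree A y + (degree A y + t)
        ≡⟨ solve 2 (λ d t → d :+ (d :+ t) := con 2 :* d :+ t) refl (degree A y) t ⟩
      2 * degree A y + t ∎
      where
      open ≡-Reasoning
      t = total (λ i j → A (p i) (p j))

  module _ {n : ℕ} {A : Fin (suc n) → Fin (suc n) → Bool} (D : ParityDrawing A)
           (y : Fin (suc n)) (x : Fin n) (yx : A y (punchIn y x) ≡ true) where
    open ParityDrawing D
    open Contraction D y x yx

    private
      ind : Fin n → ℕ → ℕ
      ind i c = if does (i ≟ x) then c else 0

      ind-∧ : ∀ b c → ⟦ b ∧ c ⟧ ≡ (if b then ⟦ c ⟧ else 0)
      ind-∧ true  c = refl
      ind-∧ false c = refl

      total-new : total Contracted ≡ total (λ i j → A (p i) (p j)) + 2 * sum (λ j → ⟦ new j ⟧)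
      total-new = begin
        total Contracted
          ≡⟨ sum-cong-≗ (λ i → trans (sum-cong-≗ (entry i)) (trans (∑-distrib-+ (λ j → ⟦ A (p i) (p j) ⟧ + ind i ⟦ new j ⟧) _)
               (cong₂ _+_ (∑-distrib-+ (λ j → ⟦ A (p i) (p j) ⟧) _) (sum-indicator x ⟦ new i ⟧)))) ⟩
        sum (λ i → (degree (λ i j → A (p i) (p j)) i + sum (λ j → ind i ⟦ new j ⟧)) + ⟦ new i ⟧)
          ≡⟨ trans (∑-distrib-+ (λ i → degree (λ i j → A (p i) (p j)) i + sum (λ j → ind i ⟦ new j ⟧)) _)
              (cong (_+ s) (trans (∑-distrib-+ (degree (λ i j → A (p i) (p j))) _)
                (cong (t +_) (trans (sum-cong-≗ pull) (sum-indicator x s))))) ⟩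
        t + s + s
          ≡⟨ solve 2 (λ t s → t :+ s :+ s := t :+ con 2 :* s) refl t s ⟩
        t + 2 * s ∎
        where
        open ≡-Reasoning
        s = sum (λ j → ⟦ new j ⟧)
        t = total (λ i j → A (p i) (p j))
        pull : ∀ i → sum (λ j → ind i ⟦ new j ⟧) ≡ ind i s
        pull i with i ≟ x
        ... | yes _ = refl
        ... | no  _ = sum-zero {n} _ λ _ → refl
        disjoint : ∀ a b c → (b ≡ true → a ≡ false) → (c ≡ true → a ≡ false) → (b ≡ true → c ≡ false) →
                   ⟦ a ∨ (b ∨ c) ⟧ ≡ ⟦ a ⟧ + ⟦ b ⟧ + ⟦ c ⟧
        disjoint true  true  _     f _ _ = contradiction (f refl) λ ()
        disjoint true  false true  _ g _ = contradiction (g refl) λ ()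
        disjoint true  false false _ _ _ = refl
        disjoint false true  true  _ _ h = contradiction (h refl) λ ()
        disjoint false true  false _ _ _ = refl
        disjoint false false c     _ _ _ = refl
        new-nonadjacent : ∀ j → new j ≡ true → A (p x) (p j) ≡ false
        new-nonadjacent j e = not-true (∧-right (A y (p j)) (∧-left (A y (p j) ∧ not (A (p x) (p j))) e))
        entry : ∀ i j → ⟦ Contracted i j ⟧ ≡ ⟦ A (p i) (p j) ⟧ + ind i ⟦ new j ⟧ + ind j ⟦ new i ⟧
        entry i j = trans
          (disjoint (A (p i) (p j)) (does (i ≟ x) ∧ new j) (does (j ≟ x) ∧ new i)
            (λ e → subst (λ k → A (p k) (p j) ≡ false) (sym (≟-sound (∧-left (does (i ≟ x)) e)))
                     (new-nonadjacent j (∧-right (does (i ≟ x)) e)))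
            (λ e → trans (symm _ _) (subst (λ k → A (p k) (p i) ≡ false) (sym (≟-sound (∧-left (does (j ≟ x)) e)))
                     (new-nonadjacent i (∧-right (does (j ≟ x)) e))))
            (λ e → cong (_∧ new i) (new-other j (∧-right (does (i ≟ x)) e))))
          (cong₂ (λ b c → ⟦ A (p i) (p j) ⟧ + b + c) (ind-∧ (does (i ≟ x)) (new j)) (ind-∧ (does (j ≟ x)) (new i)))

      -- A neighbour of `y` is `x` itself, a common neighbour of the two, or `new`.
      degree-split : degree A y ≡ 1 + common A y (p x) + sum (λ j → ⟦ new j ⟧)
      degree-split = begin
        degree A y
          ≡⟨ degree-remove D y ⟩
        sum (λ j → ⟦ A y (p j) ⟧)
          ≡⟨ sum-cong-≗ entry ⟩
        sum (λ j → ind j 1 + ⟦ A y (p j) ∧ A (p x) (p j) ⟧ + ⟦ new j ⟧)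
          ≡⟨ ∑-distrib-+ (λ j → ind j 1 + ⟦ A y (p j) ∧ A (p x) (p j) ⟧) _ ⟩
        sum (λ j → ind j 1 + ⟦ A y (p j) ∧ A (p x) (p j) ⟧) + s
          ≡⟨ cong (_+ s) (∑-distrib-+ (λ j → ind j 1) _) ⟩
        sum (λ j → ind j 1) + sum (λ j → ⟦ A y (p j) ∧ A (p x) (p j) ⟧) + s
          ≡⟨ cong₂ (λ a b → a + b + s) (sum-indicator x 1) common-remove ⟩
        1 + common A y (p x) + s ∎
        where
        open ≡-Reasoning
        s = sum (λ j → ⟦ new j ⟧)
        common-remove : sum (λ j → ⟦ A y (p j) ∧ A (p x) (p j) ⟧) ≡ common A y (p x)
        common-remove = sym (trans (sum-remove {i = y} (λ j → ⟦ A y j ∧ A (p x) j ⟧))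
          (cong (λ b → ⟦ b ∧ A (p x) y ⟧ + sum (λ j → ⟦ A y (p j) ∧ A (p x) (p j) ⟧)) (irrefl y)))
        entry : ∀ j → ⟦ A y (p j) ⟧ ≡ ind j 1 + ⟦ A y (p j) ∧ A (p x) (p j) ⟧ + ⟦ new j ⟧
        entry j with j ≟ x
        ... | yes refl rewrite yx | irrefl (p j) = refl
        ... | no _ with A y (p j) | A (p x) (p j)
        ...   | true  | true  = refl
        ...   | true  | false = refl
        ...   | false | _     = refl

    -- What is lost is the contracted edge and, for every common neighbour, one of two edges that
    -- become parallel.
    total-contract : total A ≡ 2 * (1 + common A y (p x)) + total Contracted
    total-contract = begin
      total A                    ≡⟨ total-delete D y ⟩
      2 * degree A y + t         ≡⟨ cong (λ d → 2 * d + t) degree-split ⟩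
      2 * (c + s) + t            ≡⟨ solve 3 (λ c s t → con 2 :* (c :+ s) :+ t := con 2 :* c :+ (t :+ con 2 :* s)) refl c s t ⟩
      2 * c + (t + 2 * s)        ≡⟨ cong (2 * c +_) (sym total-new) ⟩
      2 * c + total Contracted   ∎
      where
      open ≡-Reasoning
      c = 1 + common A y (p x)
      s = sum (λ j → ⟦ new j ⟧)
      t = total (λ i j → A (p i) (p j))

  count : ∀ {X : Set} → (X → Bool) → List X → ℕ
  count f l = listSum (map (⟦_⟧ ∘ f) l)

  sum-tabulate : ∀ {n} (f : Fin n → ℕ) → sum f ≡ listSum (tabulate f)
  sum-tabulate {zero}  f = refl
  sum-tabulate {suc n} f = cong (f zero +_) (sum-tabulate (f ∘ suc))

  sum-count : ∀ {n} (f : Fin n → Bool) → sum (⟦_⟧ ∘ f) ≡ count f (allFin n)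
  sum-count f = trans (sum-tabulate (⟦_⟧ ∘ f)) (cong listSum (sym (map-tabulate id (⟦_⟧ ∘ f))))




  count-length : ∀ {X : Set} (f : X → Bool) l → length (filterᵇ f l) ≡ count f l
  count-length f [] = refl
  count-length f (x ∷ l) with f x
  ... | true  = cong suc (count-length f l)
  ... | false = count-length f l

  count-filter : ∀ {X : Set} (f g : X → Bool) l → count (λ x → f x ∧ g x) l ≡ count g (filterᵇ f l)
  count-filter f g [] = refl
  count-filter f g (x ∷ l) with f x
  ... | true  = cong (⟦ g x ⟧ +_) (count-filter f g l)
  ... | false = count-filter f g l

  T⇒≡ : ∀ {b} → T b → b ≡ true
  T⇒≡ {true} _ = refl

  -- A truth table; it turns the statement about graphs on five vertices into an evaluation over 2¹⁰
  -- adjacency vectors.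
  everywhere : ∀ n → (Vec Bool n → Bool) → Bool
  everywhere zero    f = f []
  everywhere (suc n) f = everywhere n (f ∘ (true ∷_)) ∧ everywhere n (f ∘ (false ∷_))

  everywhere-sound : ∀ n f → everywhere n f ≡ true → ∀ v → f v ≡ true
  everywhere-sound zero    f e []          = e
  everywhere-sound (suc n) f e (true  ∷ v) = everywhere-sound n _ (∧-left (everywhere n (f ∘ (true ∷_))) e) v
  everywhere-sound (suc n) f e (false ∷ v) = everywhere-sound n _ (∧-right (everywhere n (f ∘ (true ∷_))) e) v

  -- Contracting p q makes the five vertices p, q, r, s, t a K₄.
  good : (pq rs rt st pr ps pt qr qs qt : Bool) → Bool
  good pq rs rt st pr ps pt qr qs qt = pq ∧ (rs ∧ (rt ∧ (st ∧ ((pr ∨ qr) ∧ ((ps ∨ qs) ∧ (pt ∨ qt))))))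

  -- The bracketing and the final 0 are those left by `count` on a list of five vertices once the
  -- diagonal entry is `false`, so that the degree hypotheses fit `rows` directly.
  row : (b c d e : Bool) → Bool
  row b c d e = 3 ≤ᵇ ⟦ b ⟧ + (⟦ c ⟧ + (⟦ d ⟧ + (⟦ e ⟧ + 0)))

  rows : Vec Bool 10 → Bool
  rows (ab ∷ ac ∷ ad ∷ ae ∷ bc ∷ bd ∷ be ∷ cd ∷ ce ∷ de ∷ []) =
    row ab ac ad ae ∧ (row ab bc bd be ∧ (row ac bc cd ce ∧ (row ad bd cd de ∧ row ae be ce de)))

  contractions : Vec Bool 10 → Bool
  contractions (ab ∷ ac ∷ ad ∷ ae ∷ bc ∷ bd ∷ be ∷ cd ∷ ce ∷ de ∷ []) =
    good ac bd be de ab ad ae bc cd ce ∨ (good ad bc be ce ab ac ae bd cd de ∨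
    (good bc ad ae de ab bd be ac cd ce ∨ good bd ac ae ce ab bc be ad cd de))

  -- The non-edges form a matching, and every pair of disjoint non-edges spans
  -- a 4-cycle of pairs containing one of a c, a d, b c, b d.
  rows⇒contractions : ∀ v → rows v ≡ true → contractions v ≡ true
  rows⇒contractions v e = implication (everywhere-sound 10 (λ v → not (rows v) ∨ contractions v) refl v) e
    where
    implication : ∀ {a b} → not a ∨ b ≡ true → a ≡ true → b ≡ true
    implication {true} e _ = e

  three-true : ∀ b c d → 3 ≤ ⟦ b ⟧ + (⟦ c ⟧ + (⟦ d ⟧ + 0)) → b ≡ true × c ≡ true × d ≡ true
  three-true true  true  true  _                   = refl , refl , refl
  three-true true  true  false (s≤s (s≤s ()))
  three-true true  false true  (s≤s (s≤s ()))
  three-true true  false false (s≤s ())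
  three-true false true  true  (s≤s (s≤s ()))
  three-true false true  false (s≤s ())
  three-true false false true  (s≤s ())

  module _ {n : ℕ} {A : Fin (suc n) → Fin (suc n) → Bool} (D : ParityDrawing A) where
    open ParityDrawing D
    private
      _~_ : Fin (suc n) → Fin (suc n) → Set
      u ~ v = A u v ≡ true

    -- Contracting `q` into `p` leaves a K₅ on `v`, `p`, `r`, `s`, `t`, as each of `r`, `s`, `t` is
    -- joined to `p` or `q`; `no-K5` applies to the contracted parity drawing.
    no-contractible-K6 : ∀ {v p q r s t} → v ~ p → v ~ q → v ~ r → v ~ s → v ~ t →
      p ≢ r → p ≢ s → p ≢ t → q ≢ r → q ≢ s → q ≢ t →
      p ~ q → r ~ s → r ~ t → s ~ t →
      p ~ r ⊎ q ~ r → p ~ s ⊎ q ~ s → p ~ t ⊎ q ~ t → ⊥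
    no-contractible-K6 {v} {p} {q} {r} {s} {t} vp vq vr vs vt pr ps pt qr qs qt pq rs rt st r~ s~ t~ =
      no-K5 contracted (lift q≢v q≢p vp) (lift q≢v qr vr) (lift q≢v qs vs) (lift q≢v qt vt)
        (via qr pr r~) (via qs ps s~) (via qt pt t~)
        (lift qr qs rs) (lift qr qt rt) (lift qs qt st)
      where
      q≢v = ≢-sym (adjacent⇒≢ D vq)
      q≢p = ≢-sym (adjacent⇒≢ D pq)
      x   = punchOut q≢p
      open Contraction D q x (trans (cong (A q) (punchIn-punchOut q≢p)) (trans (symm q p) pq))
        using (Contracted; contracted; Contracted-old; Contracted-through)
      lift : ∀ {i j} (qi : q ≢ i) (qj : q ≢ j) → i ~ j → Contracted (punchOut qi) (punchOut qj) ≡ true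
      lift qi qj ij = Contracted-old (trans (cong₂ A (punchIn-punchOut qi) (punchIn-punchOut qj)) ij)
      via : ∀ {j} (qj : q ≢ j) → p ≢ j → p ~ j ⊎ q ~ j → Contracted x (punchOut qj) ≡ true
      via qj pj (inj₁ p~j) = lift q≢p qj p~j
      via qj pj (inj₂ q~j) = Contracted-through (λ e → pj (sym (punchOut-injective qj q≢p e)))
                               (trans (cong (A q) (punchIn-punchOut qj)) q~j)

    -- Four neighbours with three neighbours each among themselves form a K₄, and with `v` a K₅. For
    -- five, the truth table supplies an edge whose contraction leaves a K₄ in the neighbourhood.
    no-dense-neighbourhood : ∀ v (N : List (Fin (suc n))) → 4 ≤ length N → length N ≤ 5 →
      Unique N → All (v ~_) N → All (λ u → 3 ≤ count (A u) N) N → ⊥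
    no-dense-neighbourhood v (a ∷ b ∷ c ∷ d ∷ []) _ _ _ (va ∷ vb ∷ vc ∷ vd ∷ []) (ra ∷ rb ∷ rc ∷ rd ∷ [])
      rewrite irrefl a | irrefl b | irrefl c
      with three-true _ _ _ ra | three-true (A b a) (A b c) _ rb | three-true (A c a) (A c b) _ rc
    ... | ab , ac , ad | _ , bc , bd | _ , _ , cd = no-K5 D va vb vc vd ab ac ad bc bd cd
    no-dense-neighbourhood v (a ∷ b ∷ c ∷ d ∷ e ∷ []) _ _
      ((ab ∷ ac ∷ ad ∷ ae ∷ []) ∷ (bc ∷ bd ∷ be ∷ []) ∷ (cd ∷ ce ∷ []) ∷ (de ∷ []) ∷ [] ∷ [])
      (va ∷ vb ∷ vc ∷ vd ∷ ve ∷ []) (ra ∷ rb ∷ rc ∷ rd ∷ re ∷ [])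
      rewrite irrefl a | irrefl b | irrefl c | irrefl d | irrefl e
            | symm b a | symm c a | symm d a | symm e a | symm c b | symm d b | symm e b
            | symm d c | symm e c | symm e d = choose options
      where
      ok : ∀ {m} → 3 ≤ m → (3 ≤ᵇ m) ≡ true
      ok = T⇒≡ ∘ ≤⇒≤ᵇ
      adjacencies : Vec Bool 10
      adjacencies = A a b ∷ A a c ∷ A a d ∷ A a e ∷ A b c ∷ A b d ∷ A b e ∷ A c d ∷ A c e ∷ A d e ∷ []

      options : contractions adjacencies ≡ true
      options = rows⇒contractions adjacencies
        (cong₂ _∧_ (ok ra) (cong₂ _∧_ (ok rb) (cong₂ _∧_ (ok rc) (cong₂ _∧_ (ok rd) (ok re)))))

      -- The six mixed adjacencies are taken up to equality because the table names every pair
      -- alphabetically, whereas `r`, `s` or `t` may precede `p` or `q`.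
      good⇒ : ∀ {p q r s t} → v ~ p → v ~ q → v ~ r → v ~ s → v ~ t →
        p ≢ r → p ≢ s → p ≢ t → q ≢ r → q ≢ s → q ≢ t →
        ∀ {pr ps pt qr qs qt} →
        pr ≡ A p r → ps ≡ A p s → pt ≡ A p t → qr ≡ A q r → qs ≡ A q s → qt ≡ A q t →
        good (A p q) (A r s) (A r t) (A s t) pr ps pt qr qs qt ≡ true → ⊥
      good⇒ {p} {q} {r} {s} {t} vp vq vr vs vt pr ps pt qr qs qt refl refl refl refl refl refl g₁ =
        no-contractible-K6 vp vq vr vs vt pr ps pt qr qs qt
          (∧-left (A p q) g₁) (∧-left (A r s) g₂) (∧-left (A r t) g₃) (∧-left (A s t) g₄)
          (∨-split (A p r) (∧-left (A p r ∨ A q r) g₅)) (∨-split (A p s) (∧-left (A p s ∨ A q s) g₆))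
          (∨-split (A p t) (∧-right (A p s ∨ A q s) g₆))
        where
        g₂ = ∧-right (A p q) g₁
        g₃ = ∧-right (A r s) g₂
        g₄ = ∧-right (A r t) g₃
        g₅ = ∧-right (A s t) g₄
        g₆ = ∧-right (A p r ∨ A q r) g₅

      choose : contractions adjacencies ≡ true → ⊥
      choose o with ∨-split (good (A a c) (A b d) (A b e) (A d e) (A a b) (A a d) (A a e) (A b c) (A c d) (A c e)) o
      ... | inj₁ g = good⇒ va vc vb vd ve ab ad ae (≢-sym bc) cd ce refl refl refl (symm _ _) refl refl g
      ... | inj₂ o with ∨-split (good (A a d) (A b c) (A b e) (A c e) (A a b) (A a c) (A a e) (A b d) (A c d) (A d e)) o
      ...   | inj₁ g = good⇒ va vd vb vc ve ab ac ae (≢-sym bd) (≢-sym cd) de refl refl refl (symm _ _) (symm _ _) refl g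
      ...   | inj₂ o with ∨-split (good (A b c) (A a d) (A a e) (A d e) (A a b) (A b d) (A b e) (A a c) (A c d) (A c e)) o
      ...     | inj₁ g = good⇒ vb vc va vd ve (≢-sym ab) bd be (≢-sym ac) cd ce (symm _ _) refl refl (symm _ _) refl refl g
      ...     | inj₂ g = good⇒ vb vd va vc ve (≢-sym ab) bc be (≢-sym ad) (≢-sym cd) de (symm _ _) refl refl (symm _ _) (symm _ _) refl g
    no-dense-neighbourhood v (_ ∷ _ ∷ _ ∷ _ ∷ _ ∷ _ ∷ _) _ (s≤s (s≤s (s≤s (s≤s (s≤s ()))))) 
    no-dense-neighbourhood v []                  ()
    no-dense-neighbourhood v (_ ∷ [])            (s≤s ())
    no-dense-neighbourhood v (_ ∷ _ ∷ [])        (s≤s (s≤s ()))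
    no-dense-neighbourhood v (_ ∷ _ ∷ _ ∷ [])    (s≤s (s≤s (s≤s ())))


  sum-upper : ∀ {n} (f : Fin n → ℕ) k → (∀ i → f i ≤ k) → sum f ≤ n * k
  sum-upper {zero}  f k f≤k = z≤n
  sum-upper {suc n} f k f≤k = +-mono-≤ (f≤k zero) (sum-upper (f ∘ suc) k (f≤k ∘ suc))

  ⟦⟧≤1 : ∀ b → ⟦ b ⟧ ≤ 1
  ⟦⟧≤1 true  = ≤-refl
  ⟦⟧≤1 false = z≤n

  neighbours : ∀ {n} → (Fin n → Fin n → Bool) → Fin n → List (Fin n)
  neighbours A y = filterᵇ (A y) (allFin _)

  length-neighbours : ∀ {n} (A : Fin n → Fin n → Bool) y → length (neighbours A y) ≡ degree A y
  length-neighbours A y = trans (count-length (A y) (allFin _)) (sym (sum-count (A y)))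

  common-neighbours : ∀ {n} (A : Fin n → Fin n → Bool) y u → common A y u ≡ count (A u) (neighbours A y)
  common-neighbours A y u = trans (sum-count (λ j → A y j ∧ A u j)) (count-filter (A y) (A u) (allFin _))

  drop : ∀ n {k c t} → k ≡ 2 * c + t → c ≤ 3 → t + 12 ≤ 6 * n → k + 12 ≤ 6 * suc n
  drop n {k} {c} {t} eq c≤3 t≤ = begin
    k + 12              ≡⟨ cong (_+ 12) eq ⟩
    2 * c + t + 12      ≡⟨ +-assoc (2 * c) t 12 ⟩
    2 * c + (t + 12)    ≤⟨ +-mono-≤ (*-monoʳ-≤ 2 c≤3) t≤ ⟩
    6 + 6 * n           ≡⟨ *-suc 6 n ⟨
    6 * suc n           ∎
    where open ≤-Reasoning

  -- The bound for the whole graph is still to be proved, so the minimum degree δ is controlled by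
  -- the bound for the graph without a vertex of degree δ. If δ ≥ 6, the rest would have total at
  -- least (4 + m)δ - 2δ ≥ 6(2 + m), more than the permitted 6(3 + m) - 12 = 6(1 + m).
  low-degree : ∀ m {δ rest k} → (4 + m) * δ ≤ k → k ≡ 2 * δ + rest → rest + 12 ≤ 6 * (3 + m) → δ ≤ 5
  low-degree m {δ} {rest} {k} lower eq upper = ≮⇒≥ λ 6≤δ → m+1+n≰m (6 + m * 6) {5} (+-cancelʳ-≤ 12 _ _ (begin
    6 + m * 6 + 6 + 12   ≡⟨ solve 1 (λ m → con 6 :+ m :* con 6 :+ con 6 :+ con 12 := (con 2 :+ m) :* con 6 :+ con 12) refl m ⟩
    (2 + m) * 6 + 12     ≤⟨ +-monoˡ-≤ 12 (≤-trans (*-monoʳ-≤ (2 + m) 6≤δ) (+-cancelˡ-≤ (2 * δ) _ _ (begin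
       2 * δ + (2 + m) * δ   ≡⟨ solve 2 (λ m d → con 2 :* d :+ (con 2 :+ m) :* d := (con 4 :+ m) :* d) refl m δ ⟩
       (4 + m) * δ           ≤⟨ lower ⟩
       k                     ≡⟨ eq ⟩
       2 * δ + rest          ∎))) ⟩
    rest + 12            ≤⟨ upper ⟩
    6 * (3 + m)          ≡⟨ solve 1 (λ m → con 6 :* (con 3 :+ m) := con 6 :+ m :* con 6 :+ con 12) refl m ⟩
    6 + m * 6 + 12       ∎))
    where open ≤-Reasoning

  -- Mader's argument: contracting an edge with at most two common neighbours, or
  -- deleting a vertex of degree at most three, loses at most three edges.
  reduce : ∀ n {A : Fin (suc n) → Fin (suc n) → Bool} (D : ParityDrawing A) →
           (∀ {B : Fin n → Fin n → Bool} → ParityDrawing B → total B + 12 ≤ 6 * n) →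
           ∀ y → degree A y ≤ 5 → total A + 12 ≤ 6 * suc n
  reduce n {A} D bound y δ≤5 with degree A y ≤? 3
  ... | yes δ≤3 = drop n (total-delete D y) δ≤3 (bound (deleteVertex D y))
  ... | no  δ≰3 with All.all? (λ u → 3 ≤? count (A u) (neighbours A y)) (neighbours A y)
  ...   | yes dense = ⊥-elim (no-dense-neighbourhood D y (neighbours A y)
            (≤-trans (≰⇒> δ≰3) (≤-reflexive (sym (length-neighbours A y))))
            (≤-trans (≤-reflexive (length-neighbours A y)) δ≤5)
            (filter⁺ (λ u → T? (A y u)) (allFin⁺ _))
            (All.map T⇒≡ (all-filter (λ u → T? (A y u)) (allFin _))) dense)
  ...   | no ¬dense with find (¬All⇒Any¬ (λ u → 3 ≤? count (A u) (neighbours A y)) (neighbours A y) ¬dense)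
  ...     | u , u∈N , ¬3≤ = drop n (total-contract D y x yx)
              (subst (_≤ 3) (cong suc (trans (sym (common-neighbours A y u)) (cong (common A y) (sym px)))) (≰⇒> ¬3≤))
              (bound (Contraction.contracted D y x yx))
    where
    yu : A y u ≡ true
    yu = All.lookup (All.map T⇒≡ (all-filter (λ u → T? (A y u)) (allFin _))) u∈N
    y≢u = adjacent⇒≢ D yu
    x = punchOut y≢u
    px : punchIn y x ≡ u
    px = punchIn-punchOut y≢u
    yx : A y (punchIn y x) ≡ true
    yx = trans (cong (A y) px) yu


  edge-bound₃ : {A : Fin 3 → Fin 3 → Bool} → ParityDrawing A → total A + 12 ≤ 18
  edge-bound₃ {A} D = +-monoˡ-≤ 12 total≤6
    where
    degree≤2 : ∀ y → degree A y ≤ 2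
    degree≤2 y = ≤-trans (≤-reflexive (degree-remove D y)) (sum-upper (λ j → ⟦ A y (punchIn y j) ⟧) 1 (λ j → ⟦⟧≤1 _))
    total≤6 : total A ≤ 6
    total≤6 = sum-upper (degree A) 2 degree≤2

  edge-step : ∀ m {A : Fin (4 + m) → Fin (4 + m) → Bool} → ParityDrawing A →
              (∀ {B : Fin (3 + m) → Fin (3 + m) → Bool} → ParityDrawing B → total B + 12 ≤ 6 * (3 + m)) →
              (∃ λ y → ∀ i → degree A y ≤ degree A i) → total A + 12 ≤ 6 * (4 + m)
  edge-step m {A} D bound (y , y-least) = reduce (3 + m) D bound y
    (low-degree m {degree A y} {total (λ i j → A (punchIn y i) (punchIn y j))} {total A}
      (sum-lower (degree A) (degree A y) y-least) (total-delete D y) (bound (deleteVertex D y)))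

  edge-bound : ∀ m {A : Fin (3 + m) → Fin (3 + m) → Bool} → ParityDrawing A → total A + 12 ≤ 6 * (3 + m)
  edge-bound zero        D = edge-bound₃ D
  edge-bound (suc m) {A} D = edge-step m D (edge-bound m) (least ≤-refl ≤-trans ≤-total (degree A))

-- The crossing parity of two disjoint segments in the rational plane.

module Segments where

  open import Defs
  open import Data.Bool using (Bool; true; false; _xor_; _∧_; not; if_then_else_)
  open import Data.Bool.Properties using (xor-comm; xor-same)
  open import Data.Bool.Solver using (module xor-∧-Solver)
  open import Data.Empty using (⊥)
  open import Data.Product using (∃; _×_; _,_; proj₁; proj₂)
  open import Data.Rational
  open import Data.Rational.Properties
  open import Data.Rational.Solver using (module +-*-Solver)
  open import Data.Sum using (_⊎_; inj₁; inj₂)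
  open import Function using (_$_)
  open import Relation.Binary.Definitions using (tri<; tri≈; tri>)
  open import Relation.Binary.PropositionalEquality
  open import Relation.Nullary using (¬_; contradiction; does; Dec)
  open import Relation.Nullary.Decidable using (dec-true; dec-false; _⊎-dec_; _×-dec_)
  open ParityDrawings
  open xor-∧-Solver using () renaming (solve to solveᵇ; _:=_ to _⊜_; _:+_ to _⊕_; con to conᵇ)
  open +-*-Solver using (Polynomial; solve; _:=_; con; _:+_; _:*_; _:-_; :-_)


  0≤* : ∀ {p q} → 0ℚ ≤ p → 0ℚ ≤ q → 0ℚ ≤ p * q
  0≤* {p} {q} 0≤p 0≤q = nonNegative⁻¹ (p * q) {{nonNeg*nonNeg⇒nonNeg p {{nonNegative 0≤p}} q {{nonNegative 0≤q}}}}

  0<* : ∀ {p q} → 0ℚ < p → 0ℚ < q → 0ℚ < p * q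
  0<* {p} {q} 0<p 0<q = positive⁻¹ (p * q) {{pos*pos⇒pos p {{positive 0<p}} q {{positive 0<q}}}}

  ≤⇒0≤- : ∀ {p q} → p ≤ q → 0ℚ ≤ q - p
  ≤⇒0≤- {p} {q} p≤q = subst (_≤ q - p) (+-inverseʳ p) (+-monoˡ-≤ (- p) p≤q)

  <⇒0<- : ∀ {p q} → p < q → 0ℚ < q - p
  <⇒0<- {p} {q} p<q = subst (_< q - p) (+-inverseʳ p) (+-monoˡ-< (- p) p<q)

  -‿injective : ∀ {p q} → p - q ≡ 0ℚ → p ≡ q
  -‿injective {p} {q} e = trans (solve 2 (λ p q → p := (p :- q) :+ q) refl p q) (trans (cong (_+ q) e) (+-identityˡ q))

  *-cancelˡ-pos : ∀ {w p q} → 0ℚ < w → w * p ≡ w * q → p ≡ q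
  *-cancelˡ-pos {w} 0<w e = ≤-antisym (*-cancelˡ-≤-pos w {{positive 0<w}} (≤-reflexive e))
                                     (*-cancelˡ-≤-pos w {{positive 0<w}} (≤-reflexive (sym e)))

  module Average {α β a b q : ℚ} (0≤α : 0ℚ ≤ α) (0≤β : 0ℚ ≤ β) (0<w : 0ℚ < α + β)
                 (avg : (α + β) * q ≡ α * a + β * b) where
    lower : a ⊓ b ≤ q
    lower = *-cancelˡ-≤-pos (α + β) {{positive 0<w}} $ subst₂ _≤_ (sym (*-distribʳ-+ (a ⊓ b) α β)) (sym avg)
      (+-mono-≤ (*-monoˡ-≤-nonNeg α {{nonNegative 0≤α}} (p⊓q≤p a b)) (*-monoˡ-≤-nonNeg β {{nonNegative 0≤β}} (p⊓q≤q a b)))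

    upper : q ≤ a ⊔ b
    upper = *-cancelˡ-≤-pos (α + β) {{positive 0<w}} $ subst₂ _≤_ (sym avg) (sym (*-distribʳ-+ (a ⊔ b) α β))
      (+-mono-≤ (*-monoˡ-≤-nonNeg α {{nonNegative 0≤α}} (p≤p⊔q a b)) (*-monoˡ-≤-nonNeg β {{nonNegative 0≤β}} (p≤q⊔p a b)))

    shift : (α + β) * (q - a) ≡ β * (b - a)
    shift = begin
      (α + β) * (q - a)              ≡⟨ solve 4 (λ α β q a → (α :+ β) :* (q :- a) := (α :+ β) :* q :- (α :+ β) :* a) refl α β q a ⟩
      (α + β) * q - (α + β) * a      ≡⟨ cong (_- (α + β) * a) avg ⟩
      α * a + β * b - (α + β) * a    ≡⟨ solve 4 (λ α β a b → α :* a :+ β :* b :- (α :+ β) :* a := β :* (b :- a)) refl α β a b ⟩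
      β * (b - a)                    ∎
      where open ≡-Reasoning

  -- The weights are not normalised, so that orientation determinants and coordinate differences can
  -- serve as weights without division.
  onSeg-average : ∀ {α β ax ay bx by qx qy} → 0ℚ ≤ α → 0ℚ ≤ β → 0ℚ < α + β →
    (α + β) * qx ≡ α * ax + β * bx → (α + β) * qy ≡ α * ay + β * by →
    OnSeg (qx , qy) ((ax , ay) , (bx , by))
  onSeg-average {α} {β} {ax} {ay} {bx} {by} {qx} {qy} 0≤α 0≤β 0<w ex ey =
    *-cancelˡ-pos 0<w collinear , X.lower , X.upper , Y.lower , Y.upper
    where
    module X = Average {α} {β} {ax} {bx} {qx} 0≤α 0≤β 0<w ex
    module Y = Average {α} {β} {ay} {by} {qy} 0≤α 0≤β 0<w ey
    open ≡-Reasoning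
    collinear : (α + β) * ((bx - ax) * (qy - ay)) ≡ (α + β) * ((by - ay) * (qx - ax))
    collinear = begin
      (α + β) * ((bx - ax) * (qy - ay))   ≡⟨ solve 3 (λ w u v → w :* (u :* v) := u :* (w :* v)) refl (α + β) (bx - ax) (qy - ay) ⟩
      (bx - ax) * ((α + β) * (qy - ay))   ≡⟨ cong ((bx - ax) *_) Y.shift ⟩
      (bx - ax) * (β * (by - ay))         ≡⟨ solve 3 (λ u β v → u :* (β :* v) := v :* (β :* u)) refl (bx - ax) β (by - ay) ⟩
      (by - ay) * (β * (bx - ax))         ≡⟨ cong ((by - ay) *_) X.shift ⟨
      (by - ay) * ((α + β) * (qx - ax))   ≡⟨ solve 3 (λ w u v → u :* (w :* v) := w :* (u :* v)) refl (α + β) (by - ay) (qx - ax) ⟩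
      (α + β) * ((by - ay) * (qx - ax))   ∎

  Meet : Segment → Segment → Set
  Meet s t = ∃ λ q → OnSeg q s × OnSeg q t

  -- The Radon point of four points: either side of the affine dependence, divided by the common
  -- weight, is the same point, and it is an average of the ends of each segment.
  radon : ∀ {α β γ δ ax ay bx by cx cy dx dy} → 0ℚ < α → 0ℚ < β → 0ℚ < γ → 0ℚ < δ →
    α + β ≡ γ + δ → α * ax + β * bx ≡ γ * cx + δ * dx → α * ay + β * by ≡ γ * cy + δ * dy →
    Meet ((ax , ay) , (bx , by)) ((cx , cy) , (dx , dy))
  radon {α} {β} {γ} {δ} {ax} {ay} {bx} {by} 0<α 0<β 0<γ 0<δ ew ex ey =
    (qx , qy) ,
    onSeg-average (<⇒≤ 0<α) (<⇒≤ 0<β) 0<w (scaled _) (scaled _) ,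
    onSeg-average (<⇒≤ 0<γ) (<⇒≤ 0<δ) (subst (0ℚ <_) ew 0<w)
      (trans (cong (_* qx) (sym ew)) (trans (scaled _) ex)) (trans (cong (_* qy) (sym ew)) (trans (scaled _) ey))
    where
    w = α + β
    0<w : 0ℚ < w
    0<w = +-mono-< 0<α 0<β
    instance
      w≢0 : NonZero w
      w≢0 = pos⇒nonZero w {{positive 0<w}}
    qx = (1/ w) * (α * ax + β * bx)
    qy = (1/ w) * (α * ay + β * by)
    scaled : ∀ r → w * ((1/ w) * r) ≡ r
    scaled r = trans (sym (*-assoc w (1/ w) r)) (trans (cong (_* r) (*-inverseʳ w)) (*-identityˡ r))


  -- Left-to-right order after an infinitesimal shear, so that distinct points are always
  -- comparable, also on a common vertical line.
  _≺_ : Point → Point → Set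
  (ax , ay) ≺ (bx , by) = ax < bx ⊎ (ax ≡ bx × ay < by)

  ≺-irrefl : ∀ {a} → ¬ a ≺ a
  ≺-irrefl (inj₁ lt)       = <-irrefl refl lt
  ≺-irrefl (inj₂ (_ , lt)) = <-irrefl refl lt

  ≺-trans : ∀ {a b c} → a ≺ b → b ≺ c → a ≺ c
  ≺-trans (inj₁ p)          (inj₁ q)          = inj₁ (<-trans p q)
  ≺-trans (inj₁ p)          (inj₂ (refl , _)) = inj₁ p
  ≺-trans (inj₂ (refl , _)) (inj₁ q)          = inj₁ q
  ≺-trans (inj₂ (refl , p)) (inj₂ (refl , q)) = inj₂ (refl , <-trans p q)

  ≺-asym : ∀ {a b} → a ≺ b → ¬ b ≺ a
  ≺-asym p q = ≺-irrefl (≺-trans p q)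

  data Compare (a b : Point) : Set where
    lt : a ≺ b → Compare a b
    eq : a ≡ b → Compare a b
    gt : b ≺ a → Compare a b

  compare : ∀ a b → Compare a b
  compare (ax , ay) (bx , by) with <-cmp ax bx
  ... | tri< p _ _ = lt (inj₁ p)
  ... | tri> _ _ p = gt (inj₁ p)
  ... | tri≈ _ refl _ with <-cmp ay by
  ...   | tri< p _ _    = lt (inj₂ (refl , p))
  ...   | tri≈ _ refl _ = eq refl
  ...   | tri> _ _ p    = gt (inj₂ (refl , p))

  -- The differences of lexicographically ordered points form the positive cone
  -- of an ordered vector space.
  Positiveᵛ NonNegativeᵛ : ℚ → ℚ → Set
  Positiveᵛ    x y = 0ℚ < x ⊎ (0ℚ ≡ x × 0ℚ < y)
  NonNegativeᵛ x y = 0ℚ < x ⊎ (0ℚ ≡ x × 0ℚ ≤ y)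

  ≺⇒positive : ∀ {ax ay bx by} → (ax , ay) ≺ (bx , by) → Positiveᵛ (bx - ax) (by - ay)
  ≺⇒positive (inj₁ p)               = inj₁ (<⇒0<- p)
  ≺⇒positive {ax} (inj₂ (refl , p)) = inj₂ (sym (+-inverseʳ ax) , <⇒0<- p)

  positive⇒nonNegative : ∀ {x y} → Positiveᵛ x y → NonNegativeᵛ x y
  positive⇒nonNegative (inj₁ p)       = inj₁ p
  positive⇒nonNegative (inj₂ (e , p)) = inj₂ (e , <⇒≤ p)

  scale-positive : ∀ {k x y} → 0ℚ < k → Positiveᵛ x y → Positiveᵛ (k * x) (k * y)
  scale-positive 0<k (inj₁ p) = inj₁ (0<* 0<k p)
  scale-positive {k} 0<k (inj₂ (refl , p)) = inj₂ (sym (*-zeroʳ k) , 0<* 0<k p)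

  scale-nonNegative : ∀ {k x y} → 0ℚ ≤ k → Positiveᵛ x y → NonNegativeᵛ (k * x) (k * y)
  scale-nonNegative {k} {x} {y} 0≤k p with <-cmp 0ℚ k
  ... | tri< 0<k _ _  = positive⇒nonNegative (scale-positive 0<k p)
  ... | tri≈ _ refl _ = inj₂ (sym (*-zeroˡ x) , ≤-reflexive (sym (*-zeroˡ y)))
  ... | tri> _ _ k<0  = contradiction (<-≤-trans k<0 0≤k) (<-irrefl refl)

  add-nonNegative : ∀ {x y x' y'} → Positiveᵛ x y → NonNegativeᵛ x' y' → Positiveᵛ (x + x') (y + y')
  add-nonNegative (inj₁ p)          (inj₁ q)          = inj₁ (+-mono-< p q)
  add-nonNegative (inj₁ p)          (inj₂ (refl , _)) = inj₁ (+-mono-<-≤ p ≤-refl)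
  add-nonNegative (inj₂ (refl , _)) (inj₁ q)          = inj₁ (+-mono-≤-< ≤-refl q)
  add-nonNegative (inj₂ (refl , p)) (inj₂ (refl , q)) = inj₂ (refl , +-mono-<-≤ p q)

  zero-not-positive : ¬ Positiveᵛ 0ℚ 0ℚ
  zero-not-positive (inj₁ p)       = <-irrefl refl p
  zero-not-positive (inj₂ (_ , p)) = <-irrefl refl p

  -- The missing signs in `Crossing` all come from this: a wrong sign would write 0 as such a
  -- combination of differences of ordered points.
  combination≢0 : ∀ {k l m x₁ y₁ x₂ y₂ x₃ y₃} → 0ℚ < k → 0ℚ ≤ l → 0ℚ ≤ m →
    Positiveᵛ x₁ y₁ → Positiveᵛ x₂ y₂ → Positiveᵛ x₃ y₃ →
    k * x₁ + l * x₂ + m * x₃ ≡ 0ℚ → k * y₁ + l * y₂ + m * y₃ ≡ 0ℚ → ⊥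
  combination≢0 0<k 0≤l 0≤m p q r ex ey = zero-not-positive (subst₂ Positiveᵛ ex ey
    (add-nonNegative (add-nonNegative (scale-positive 0<k p) (scale-nonNegative 0≤l q)) (scale-nonNegative 0≤m r)))

  0≤-neg : ∀ {p} → p ≤ 0ℚ → 0ℚ ≤ - p
  0≤-neg = neg-antimono-≤

  0<-neg : ∀ {p} → p < 0ℚ → 0ℚ < - p
  0<-neg = neg-antimono-<

  dependence : ℚ → ℚ → ℚ → ℚ → ℚ → ℚ → ℚ → ℚ → ℚ
  dependence α β γ δ a b c d = α * a + β * b + γ * c + δ * d

  module Crossing {α β γ δ ax ay bx by cx cy dx dy : ℚ}
    (Σw : α + β + γ + δ ≡ 0ℚ)
    (Σx : dependence α β γ δ ax bx cx dx ≡ 0ℚ) (Σy : dependence α β γ δ ay by cy dy ≡ 0ℚ) where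

    private
      a b c d : Point
      a = ax , ay
      b = bx , by
      c = cx , cy
      d = dx , dy

      vanish : ∀ {s t} o → t ≡ 0ℚ → s ≡ t - (α + β + γ + δ) * o → s ≡ 0ℚ
      vanish o refl e rewrite Σw = trans e (solve 1 (λ o → con 0ℚ :- con 0ℚ :* o := con 0ℚ) refl o)

      vanish⁻ : ∀ {s t} o → t ≡ 0ℚ → s ≡ (α + β + γ + δ) * o - t → s ≡ 0ℚ
      vanish⁻ o refl e rewrite Σw = trans e (solve 1 (λ o → con 0ℚ :* o :- con 0ℚ := con 0ℚ) refl o)

      balance : α + β ≡ - γ + - δ
      balance = trans (solve 4 (λ α β γ δ → α :+ β := (α :+ β :+ γ :+ δ) :+ (:- γ :+ :- δ)) refl α β γ δ)
                      (trans (cong (_+ (- γ + - δ)) Σw) (+-identityˡ _))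

      balanceᵛ : ∀ a b c d → dependence α β γ δ a b c d ≡ 0ℚ → α * a + β * b ≡ - γ * c + - δ * d
      balanceᵛ a b c d e = trans
        (solve 8 (λ α β γ δ a b c d → α :* a :+ β :* b :=
           (α :* a :+ β :* b :+ γ :* c :+ δ :* d) :+ ((:- γ) :* c :+ (:- δ) :* d)) refl α β γ δ a b c d)
        (trans (cong (_+ (- γ * c + - δ * d)) e) (+-identityˡ _))

      meet : 0ℚ < α → 0ℚ < β → γ < 0ℚ → δ < 0ℚ → Meet (a , b) (c , d)
      meet 0<α 0<β γ<0 δ<0 = radon 0<α 0<β (0<-neg γ<0) (0<-neg δ<0) balance
        (balanceᵛ ax bx cx dx Σx) (balanceᵛ ay by cy dy Σy)

    -- Eliminating `c`, respectively `b`, with the help of `Σw` leaves three ordered differences.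
    -- Their coefficients would all be nonnegative, and the first one positive, if β ≤ 0,
    -- respectively 0 ≤ γ. Hence the signs are + + - - and there is a Radon point.
    overlapping : a ≺ c → c ≺ b → b ≺ d → 0ℚ < α → δ < 0ℚ → Meet (a , b) (c , d)
    overlapping a≺c c≺b b≺d 0<α δ<0 = meet 0<α
      (≰⇒> λ β≤0 → combination≢0 0<α (0≤-neg β≤0) (<⇒≤ (0<-neg δ<0))
        (≺⇒positive a≺c) (≺⇒positive c≺b) (≺⇒positive (≺-trans c≺b b≺d))
        (vanish⁻ cx Σx (without-c ax bx cx dx)) (vanish⁻ cy Σy (without-c ay by cy dy)))
      (≰⇒> λ 0≤γ → combination≢0 0<α 0≤γ (<⇒≤ (0<-neg δ<0))
        (≺⇒positive (≺-trans a≺c c≺b)) (≺⇒positive c≺b) (≺⇒positive b≺d)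
        (vanish⁻ bx Σx (without-b ax bx cx dx)) (vanish⁻ by Σy (without-b ay by cy dy)))
      δ<0
      where
      without-c : ∀ a b c d → α * (c - a) + - β * (b - c) + - δ * (d - c)
                              ≡ (α + β + γ + δ) * c - dependence α β γ δ a b c d
      without-c = solve 8 (λ α β γ δ a b c d → α :* (c :- a) :+ (:- β) :* (b :- c) :+ (:- δ) :* (d :- c) :=
        (α :+ β :+ γ :+ δ) :* c :- (α :* a :+ β :* b :+ γ :* c :+ δ :* d)) refl α β γ δ
      without-b : ∀ a b c d → α * (b - a) + γ * (b - c) + - δ * (d - b)
                              ≡ (α + β + γ + δ) * b - dependence α β γ δ a b c d
      without-b = solve 8 (λ α β γ δ a b c d → α :* (b :- a) :+ γ :* (b :- c) :+ (:- δ) :* (d :- b) :=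
        (α :+ β :+ γ :+ δ) :* b :- (α :* a :+ β :* b :+ γ :* c :+ δ :* d)) refl α β γ δ

    -- Here the inner points have negative weights, and eliminating an outer point, `b` or `a`,
    -- makes the weight of the other one positive.
    nested : a ≺ c → c ≺ d → d ≺ b → γ < 0ℚ → δ < 0ℚ → Meet (a , b) (c , d)
    nested a≺c c≺d d≺b γ<0 δ<0 = meet
      (≰⇒> λ α≤0 → combination≢0 (0<-neg γ<0) (0≤-neg α≤0) (<⇒≤ (0<-neg δ<0))
        (≺⇒positive c≺b) (≺⇒positive (≺-trans a≺c c≺b)) (≺⇒positive d≺b)
        (vanish bx Σx (without-b ax bx cx dx)) (vanish by Σy (without-b ay by cy dy)))
      (≰⇒> λ β≤0 → combination≢0 (0<-neg γ<0) (0≤-neg β≤0) (<⇒≤ (0<-neg δ<0))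
        (≺⇒positive a≺c) (≺⇒positive (≺-trans a≺c c≺b)) (≺⇒positive (≺-trans a≺c c≺d))
        (vanish⁻ ax Σx (without-a ax bx cx dx)) (vanish⁻ ay Σy (without-a ay by cy dy)))
      γ<0 δ<0
      where
      c≺b = ≺-trans c≺d d≺b
      without-b : ∀ a b c d → - γ * (b - c) + - α * (b - a) + - δ * (b - d)
                              ≡ dependence α β γ δ a b c d - (α + β + γ + δ) * b
      without-b = solve 8 (λ α β γ δ a b c d → (:- γ) :* (b :- c) :+ (:- α) :* (b :- a) :+ (:- δ) :* (b :- d) :=
        (α :* a :+ β :* b :+ γ :* c :+ δ :* d) :- (α :+ β :+ γ :+ δ) :* b) refl α β γ δ
      without-a : ∀ a b c d → - γ * (c - a) + - β * (b - a) + - δ * (d - a)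
                              ≡ (α + β + γ + δ) * a - dependence α β γ δ a b c d
      without-a = solve 8 (λ α β γ δ a b c d → (:- γ) :* (c :- a) :+ (:- β) :* (b :- a) :+ (:- δ) :* (d :- a) :=
        (α :+ β :+ γ :+ δ) :* a :- (α :* a :+ β :* b :+ γ :* c :+ δ :* d)) refl α β γ δ

  orient : Point → Point → Point → ℚ
  orient (ax , ay) (bx , by) (cx , cy) = (bx - ax) * (cy - ay) - (by - ay) * (cx - ax)

  orient-zero⇒onSeg : ∀ {a b q} → a ≺ q → q ≺ b → orient a b q ≡ 0ℚ → OnSeg q (a , b)
  orient-zero⇒onSeg {ax , ay} {bx , by} {qx , qy} a≺q q≺b e with ≺-trans a≺q q≺b
  ... | inj₁ ax<bx = onSeg-average (nn q≺b) (nn a≺q) (subst (0ℚ <_) (w ax bx qx) (<⇒0<- ax<bx))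
      (solve 3 (λ a b q → ((b :- q) :+ (q :- a)) :* q := (b :- q) :* a :+ (q :- a) :* b) refl ax bx qx)
      (-‿injective (trans (solve 6 (λ ax ay bx by qx qy →
          ((bx :- qx) :+ (qx :- ax)) :* qy :- ((bx :- qx) :* ay :+ (qx :- ax) :* by) :=
          (bx :- ax) :* (qy :- ay) :- (by :- ay) :* (qx :- ax)) refl ax ay bx by qx qy) e))
    where
    w : ∀ a b q → b - a ≡ (b - q) + (q - a)
    w = solve 3 (λ a b q → b :- a := (b :- q) :+ (q :- a)) refl
    nn : ∀ {ax ay bx by} → (ax , ay) ≺ (bx , by) → 0ℚ ≤ bx - ax
    nn (inj₁ p)          = ≤⇒0≤- (<⇒≤ p)
    nn {ax} (inj₂ (refl , _)) = ≤⇒0≤- (≤-refl {ax})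
  -- On a vertical line the differences of x-coordinates vanish, so the weights are taken from the
  -- y-coordinates.
  ... | inj₂ (refl , ay<by) with a≺q | q≺b
  ...   | inj₁ p | inj₁ q          = contradiction (<-trans p q) (<-irrefl refl)
  ...   | inj₁ p | inj₂ (refl , _) = contradiction p (<-irrefl refl)
  ...   | inj₂ (refl , _) | inj₁ q = contradiction q (<-irrefl refl)
  ...   | inj₂ (refl , p) | inj₂ (_ , q) = onSeg-average (≤⇒0≤- (<⇒≤ q)) (≤⇒0≤- (<⇒≤ p))
      (subst (0ℚ <_) (solve 3 (λ a b q → b :- a := (b :- q) :+ (q :- a)) refl ay by qy) (<⇒0<- ay<by))
      (solve 3 (λ α β a → (α :+ β) :* a := α :* a :+ β :* a) refl (by - qy) (qy - ay) ax)
      (solve 3 (λ a b q → ((b :- q) :+ (q :- a)) :* q := (b :- q) :* a :+ (q :- a) :* b) refl ay by qy)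

  _≺?_ : ∀ a b → Dec (a ≺ b)
  (ax , ay) ≺? (bx , by) = (ax <? bx) ⊎-dec ((ax ≟ bx) ×-dec (ay <? by))

  before : Point → Point → Bool
  before a b = does (a ≺? b)

  before-true : ∀ {a b} → a ≺ b → before a b ≡ true
  before-true {a} {b} = dec-true (a ≺? b)

  before-false : ∀ {a b} → b ≺ a → before a b ≡ false
  before-false {a} {b} p = dec-false (a ≺? b) (≺-asym p)

  before-not : ∀ {a b} → a ≢ b → before a b ≡ not (before b a)
  before-not {a} {b} a≢b with compare a b
  ... | lt p rewrite before-true p | before-false p = refl
  ... | eq e = contradiction e a≢b
  ... | gt p rewrite before-true p | before-false p = refl

  positive? : ℚ → Bool
  positive? r = does (0ℚ <? r)

  -- Whether the downward ray from p meets the segment; the sheared direction of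
  -- the ray, encoded by ≺, avoids all points other than p itself.
  passesBelow : Point → Segment → Bool
  passesBelow p (a , b) =
    (before a p xor before b p) ∧ positive? (if before a b then orient a b p else orient b a p)

  passesBelow-right : ∀ {p a b} → p ≺ a → p ≺ b → passesBelow p (a , b) ≡ false
  passesBelow-right pa pb rewrite before-false pa | before-false pb = refl

  passesBelow-left : ∀ {p a b} → a ≺ p → b ≺ p → passesBelow p (a , b) ≡ false
  passesBelow-left ap bp rewrite before-true ap | before-true bp = refl

  passesBelow-between : ∀ {p a b} → a ≺ p → p ≺ b → passesBelow p (a , b) ≡ positive? (orient a b p)
  passesBelow-between ap pb rewrite before-true ap | before-false pb | before-true (≺-trans ap pb) = refl

  passesBelow-swap : ∀ p a b → passesBelow p (a , b) ≡ passesBelow p (b , a)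
  passesBelow-swap p a b with compare a b
  ... | lt a≺b rewrite before-true a≺b | before-false a≺b | xor-comm (before a p) (before b p) = refl
  ... | eq refl = refl
  ... | gt b≺a rewrite before-true b≺a | before-false b≺a | xor-comm (before a p) (before b p) = refl

  passesBelow-point : ∀ p a → passesBelow p (a , a) ≡ false
  passesBelow-point p a rewrite xor-same (before a p) = refl

  crossingParity linkParity : Segment → Segment → Bool
  crossingParity (a , b) (c , d) =
    (passesBelow a (c , d) xor passesBelow b (c , d)) xor (passesBelow c (a , b) xor passesBelow d (a , b))
  linkParity (a , b) (c , d) = (before c a xor before c b) xor (before d a xor before d b)

  Disjoint : Segment → Segment → Set
  Disjoint s t = ¬ Meet s t

  onSeg-start : ∀ a b → OnSeg a (a , b)
  onSeg-start (ax , ay) (bx , by) =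
    trans (solve 3 (λ u a v → u :* (a :- a) := con 0ℚ) refl (bx - ax) ay by)
          (solve 3 (λ u a v → con 0ℚ := u :* (a :- a)) refl (by - ay) ax bx)
    , p⊓q≤p ax bx , p≤p⊔q ax bx , p⊓q≤p ay by , p≤p⊔q ay by

  onSeg-swap : ∀ {q a b} → OnSeg q (a , b) → OnSeg q (b , a)
  onSeg-swap {qx , qy} {ax , ay} {bx , by} (e , x₁ , x₂ , y₁ , y₂) =
    -‿injective (trans (solve 6 (λ ax ay bx by qx qy →
        (ax :- bx) :* (qy :- by) :- (ay :- by) :* (qx :- bx) :=
        (by :- ay) :* (qx :- ax) :- (bx :- ax) :* (qy :- ay)) refl ax ay bx by qx qy)
      (trans (cong (λ r → (by - ay) * (qx - ax) - r) e) (+-inverseʳ ((by - ay) * (qx - ax)))))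
    , subst (_≤ qx) (⊓-comm ax bx) x₁ , subst (qx ≤_) (⊔-comm ax bx) x₂
    , subst (_≤ qy) (⊓-comm ay by) y₁ , subst (qy ≤_) (⊔-comm ay by) y₂

  onSeg-end : ∀ a b → OnSeg b (a , b)
  onSeg-end a b = onSeg-swap {b} {b} {a} (onSeg-start b a)

  disjoint-swap₁ : ∀ {a b t} → Disjoint (a , b) t → Disjoint (b , a) t
  disjoint-swap₁ {a} {b} dis (q , on , on') = dis (q , onSeg-swap {q} {b} {a} on , on')

  disjoint-swap₂ : ∀ {s c d} → Disjoint s (c , d) → Disjoint s (d , c)
  disjoint-swap₂ {s} {c} {d} dis (q , on , on') = dis (q , on , onSeg-swap {q} {d} {c} on')

  disjoint-sym : ∀ {s t} → Disjoint s t → Disjoint t s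
  disjoint-sym dis (q , on , on') = dis (q , on' , on)

  -- The affine dependence of four points in the plane.
  weights : ∀ (a b c d : Point) →
    let α = orient c d b ; β = - orient c d a ; γ = orient a b d ; δ = - orient a b c in
    (α + β + γ + δ ≡ 0ℚ)
    × (dependence α β γ δ (proj₁ a) (proj₁ b) (proj₁ c) (proj₁ d) ≡ 0ℚ)
    × (dependence α β γ δ (proj₂ a) (proj₂ b) (proj₂ c) (proj₂ d) ≡ 0ℚ)
  weights (ax , ay) (bx , by) (cx , cy) (dx , dy) =
    solve 8 (λ ax ay bx by cx cy dx dy →
      o cx cy dx dy bx by :+ (:- o cx cy dx dy ax ay) :+ o ax ay bx by dx dy :+ (:- o ax ay bx by cx cy) := con 0ℚ)
      refl ax ay bx by cx cy dx dy ,
    solve 8 (λ ax ay bx by cx cy dx dy →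
      o cx cy dx dy bx by :* ax :+ (:- o cx cy dx dy ax ay) :* bx :+ o ax ay bx by dx dy :* cx :+ (:- o ax ay bx by cx cy) :* dx := con 0ℚ)
      refl ax ay bx by cx cy dx dy ,
    solve 8 (λ ax ay bx by cx cy dx dy →
      o cx cy dx dy bx by :* ay :+ (:- o cx cy dx dy ax ay) :* by :+ o ax ay bx by dx dy :* cy :+ (:- o ax ay bx by cx cy) :* dy := con 0ℚ)
      refl ax ay bx by cx cy dx dy
    where
    o : ∀ {k} (ax ay bx by cx cy : Polynomial k) → Polynomial k
    o ax ay bx by cx cy = (bx :- ax) :* (cy :- ay) :- (by :- ay) :* (cx :- ax)

  negate-weights : ∀ {α β γ δ} → α + β + γ + δ ≡ 0ℚ → - α + - β + - γ + - δ ≡ 0ℚ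
  negate-weights {α} {β} {γ} {δ} e = trans
    (solve 4 (λ α β γ δ → :- α :+ :- β :+ :- γ :+ :- δ := :- (α :+ β :+ γ :+ δ)) refl α β γ δ) (cong -_ e)

  negate-dependence : ∀ {α β γ δ} a b c d → dependence α β γ δ a b c d ≡ 0ℚ →
                      dependence (- α) (- β) (- γ) (- δ) a b c d ≡ 0ℚ
  negate-dependence {α} {β} {γ} {δ} a b c d e = trans
    (solve 8 (λ α β γ δ a b c d → (:- α) :* a :+ (:- β) :* b :+ (:- γ) :* c :+ (:- δ) :* d :=
       :- (α :* a :+ β :* b :+ γ :* c :+ δ :* d)) refl α β γ δ a b c d) (cong -_ e)

  data Sign (r : ℚ) : Set where
    minus : r < 0ℚ → positive? r ≡ false → Sign r
    null : r ≡ 0ℚ → Sign r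
    plus : 0ℚ < r → positive? r ≡ true → Sign r

  sign : ∀ r → Sign r
  sign r with <-cmp r 0ℚ
  ... | tri< r<0 _ 0≮r = minus r<0 (dec-false (0ℚ <? r) 0≮r)
  ... | tri≈ _ e _     = null e
  ... | tri> _ _ 0<r   = plus 0<r (dec-true (0ℚ <? r) 0<r)

  module _ {a b c d : Point} (disjoint : Disjoint (a , b) (c , d)) where

    private
      Σw = proj₁ (weights a b c d)
      Σx = proj₁ (proj₂ (weights a b c d))
      Σy = proj₂ (proj₂ (weights a b c d))
      module C⁺ = Crossing {orient c d b} { - orient c d a} {orient a b d} { - orient a b c} Σw Σx Σy
      -- Negating the whole dependence covers the opposite choice of signs.
      module C⁻ = Crossing { - orient c d b} { - - orient c d a} { - orient a b d} { - - orient a b c}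
        (negate-weights {orient c d b} { - orient c d a} {orient a b d} { - orient a b c} Σw)
        (negate-dependence {orient c d b} { - orient c d a} {orient a b d} { - orient a b c}
          (proj₁ a) (proj₁ b) (proj₁ c) (proj₁ d) Σx)
        (negate-dependence {orient c d b} { - orient c d a} {orient a b d} { - orient a b c}
          (proj₂ a) (proj₂ b) (proj₂ c) (proj₂ d) Σy)

      neg-neg : ∀ {r} → r < 0ℚ → - - r < 0ℚ
      neg-neg r<0 = neg-antimono-< (neg-antimono-< r<0)

    -- With equal signs of the two determinants, the weights of `a` and `d` have opposite signs,
    -- since the latter is `- orient a b c`; then the segments meet. A zero determinant puts an end
    -- of one segment on the other.
    sides-overlapping : a ≺ c → c ≺ b → b ≺ d →
      positive? (orient c d b) ≡ not (positive? (orient a b c))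
    sides-overlapping ac cb bd with sign (orient c d b) | sign (orient a b c)
    ... | null e | _ = contradiction (b , onSeg-end a b , orient-zero⇒onSeg {c} {d} {b} cb bd e) disjoint
    ... | _ | null e = contradiction (c , orient-zero⇒onSeg {a} {b} {c} ac cb e , onSeg-start c d) disjoint
    ... | plus _ e | minus _ f = trans e (cong not (sym f))
    ... | minus _ e | plus _ f = trans e (cong not (sym f))
    ... | plus p _ | plus q _ = contradiction (C⁺.overlapping ac cb bd p (neg-antimono-< q)) disjoint
    ... | minus p _ | minus q _ = contradiction (C⁻.overlapping ac cb bd (neg-antimono-< p) (neg-neg q)) disjoint

    -- With different signs of the two determinants, the weights `orient a b d` of `c` and
    -- `- orient a b c` of `d` have the same sign, and the segments meet.
    sides-nested : a ≺ c → c ≺ d → d ≺ b →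
      positive? (orient a b c) ≡ positive? (orient a b d)
    sides-nested ac cd db with sign (orient a b c) | sign (orient a b d)
    ... | null e | _ = contradiction (c , orient-zero⇒onSeg {a} {b} {c} ac (≺-trans cd db) e , onSeg-start c d) disjoint
    ... | _ | null e = contradiction (d , orient-zero⇒onSeg {a} {b} {d} (≺-trans ac cd) db e , onSeg-end c d) disjoint
    ... | plus _ e | plus _ f = trans e (sym f)
    ... | minus _ e | minus _ f = trans e (sym f)
    ... | plus p _ | minus q _ = contradiction (C⁺.nested ac cd db q (neg-antimono-< p)) disjoint
    ... | minus p _ | plus q _ = contradiction (C⁻.nested ac cd db (neg-antimono-< q) (neg-neg p)) disjoint

    -- Three orders of the ends remain. For a b c d nothing lies above anything. For a c b d exactly
    -- one of `b` and `c` lies above the other segment. For a c d b either both or none of `c` and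
    -- `d` do. These parities are the ones prescribed by the order.
    parity-sorted : a ≺ b → c ≺ d → a ≺ c → crossingParity (a , b) (c , d) ≡ linkParity (a , b) (c , d)
    parity-sorted ab cd ac with compare b c
    ... | eq refl = contradiction (b , onSeg-end a b , onSeg-start b d) disjoint
    ... | lt bc
      rewrite passesBelow-right ac (≺-trans ac cd) | passesBelow-right bc (≺-trans bc cd)
            | passesBelow-left ac bc | passesBelow-left (≺-trans ac cd) (≺-trans bc cd)
            | before-false ac | before-false bc | before-false (≺-trans ac cd) | before-false (≺-trans bc cd) = refl
    ... | gt cb with compare b d
    ...   | eq refl = contradiction (b , onSeg-end a b , onSeg-end c b) disjoint
    ...   | lt bd
      rewrite passesBelow-right ac (≺-trans ac cd) | passesBelow-between cb bd
            | passesBelow-between ac cb | passesBelow-left (≺-trans ab bd) bd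
            | before-false ac | before-true cb | before-false (≺-trans ab bd) | before-false bd
            | sides-overlapping ac cb bd with positive? (orient a b c)
    ...     | true = refl
    ...     | false = refl
    parity-sorted ab cd ac | gt cb | gt db
      rewrite passesBelow-right ac (≺-trans ac cd) | passesBelow-left cb db
            | passesBelow-between ac cb | passesBelow-between (≺-trans ac cd) db
            | before-false ac | before-true cb | before-false (≺-trans ac cd) | before-true db
            | sides-nested ac cd db = xor-same (positive? (orient a b d))


  swap-left : ∀ {a b t} → crossingParity (b , a) t ≡ linkParity (b , a) t → crossingParity (a , b) t ≡ linkParity (a , b) t
  swap-left {a} {b} {c , d} e = trans
    (cong₂ _xor_ (xor-comm (passesBelow a (c , d)) _) (cong₂ _xor_ (passesBelow-swap c a b) (passesBelow-swap d a b)))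
    (trans e (cong₂ _xor_ (xor-comm (before c b) _) (xor-comm (before d b) _)))

  swap-right : ∀ {s c d} → crossingParity s (d , c) ≡ linkParity s (d , c) → crossingParity s (c , d) ≡ linkParity s (c , d)
  swap-right {a , b} {c} {d} e = trans
    (cong₂ _xor_ (cong₂ _xor_ (passesBelow-swap a c d) (passesBelow-swap b c d)) (xor-comm (passesBelow c (a , b)) _))
    (trans e (xor-comm (before d a xor before d b) _))

  -- Interchanging the segments reverses all four comparisons in `linkParity`, an even number of
  -- negations; disjointness ensures that the compared ends are distinct.
  swap-segments : ∀ {s t} → Disjoint s t → crossingParity t s ≡ linkParity t s → crossingParity s t ≡ linkParity s t
  swap-segments {a , b} {c , d} dis e = trans
    (xor-comm (passesBelow a (c , d) xor passesBelow b (c , d)) _)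
    (trans e (flip (before-not a≢c) (before-not a≢d) (before-not b≢c) (before-not b≢d)))
    where
    a≢c : a ≢ c
    a≢c refl = dis (a , onSeg-start a b , onSeg-start a d)
    a≢d : a ≢ d
    a≢d refl = dis (a , onSeg-start a b , onSeg-end c a)
    b≢c : b ≢ c
    b≢c refl = dis (b , onSeg-end a b , onSeg-start b d)
    b≢d : b ≢ d
    b≢d refl = dis (b , onSeg-end a b , onSeg-end c b)
    flip : ∀ {ac ca ad da bc cb bd db} → ac ≡ not ca → ad ≡ not da → bc ≡ not cb → bd ≡ not db →
           (ac xor ad) xor (bc xor bd) ≡ (ca xor cb) xor (da xor db)
    flip {_} {ca} {_} {da} {_} {cb} {_} {db} refl refl refl refl = solveᵇ 4 (λ ca da cb db →
      ((conᵇ true ⊕ ca) ⊕ (conᵇ true ⊕ da)) ⊕ ((conᵇ true ⊕ cb) ⊕ (conᵇ true ⊕ db)) ⊜ (ca ⊕ cb) ⊕ (da ⊕ db))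
      refl ca da cb db

  parity-oriented : ∀ {a b c d} → Disjoint (a , b) (c , d) → a ≺ b → c ≺ d →
                    crossingParity (a , b) (c , d) ≡ linkParity (a , b) (c , d)
  parity-oriented {a} {b} {c} {d} dis ab cd with compare a c
  ... | lt ac   = parity-sorted {a} {b} {c} {d} dis ab cd ac
  ... | eq refl = contradiction (a , onSeg-start a b , onSeg-start a d) dis
  ... | gt ca   = swap-segments {a , b} {c , d} dis (parity-sorted {c} {d} {a} {b} (disjoint-sym {a , b} {c , d} dis) cd ab ca)

  parity-disjoint : ∀ {s t} → Disjoint s t → crossingParity s t ≡ linkParity s t
  parity-disjoint {a , b} {c , d} dis with compare a b | compare c d
  -- A degenerate segment contributes every term twice, so both sides are `false`.
  ... | eq refl | _ rewrite passesBelow-point c a | passesBelow-point d a | xor-same (passesBelow a (c , d))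
                          | xor-same (before c a) | xor-same (before d a) = refl
  ... | _ | eq refl rewrite passesBelow-point a c | passesBelow-point b c | xor-same (passesBelow c (a , b))
                          | xor-same (before c a xor before c b) = refl
  ... | lt ab | lt cd = parity-oriented {a} {b} {c} {d} dis ab cd
  ... | lt ab | gt dc = swap-right {a , b} {c} {d} (parity-oriented {a} {b} {d} {c} (disjoint-swap₂ {a , b} {c} {d} dis) ab dc)
  ... | gt ba | lt cd = swap-left {a} {b} {c , d} (parity-oriented {b} {a} {c} {d} (disjoint-swap₁ {a} {b} {c , d} dis) ba cd)
  ... | gt ba | gt dc = swap-left {a} {b} {c , d} (swap-right {b , a} {c} {d} (parity-oriented {b} {a} {d} {c}
          (disjoint-swap₂ {b , a} {c} {d} (disjoint-swap₁ {a} {b} {c , d} dis)) ba dc))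

  horizontal-onSeg : ∀ {q a b} → proj₂ a ≡ proj₂ b → OnSeg q (a , b) → proj₂ q ≡ proj₂ a
  horizontal-onSeg {_ , qy} {_ , ay} refl (_ , _ , _ , lo , hi) =
    ≤-antisym (subst (qy ≤_) (⊔-idem ay) hi) (subst (_≤ qy) (⊓-idem ay) lo)

  vertical-onSeg : ∀ {q a b} → proj₁ a ≡ proj₁ b → OnSeg q (a , b) → proj₁ q ≡ proj₁ a
  vertical-onSeg {qx , _} {ax , _} refl (_ , lo , hi , _) =
    ≤-antisym (subst (qx ≤_) (⊔-idem ax) hi) (subst (_≤ qx) (⊓-idem ax) lo)

-- From polylines with disjoint independent edges to parity drawings.

module PlaneDrawings where

  open import Defs
  open import Data.Bool using (Bool; true; false; _xor_; _∨_; if_then_else_)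
  open import Data.Bool.Properties using (xor-comm; ∨-comm)
  open import Data.Fin using (Fin; suc) renaming (_<_ to _<ᶠ_)
  import Data.Fin.Properties as Finₚ
  open import Data.List using (List; []; _∷_; length)
  open import Data.List.Membership.Propositional using (_∈_)
  open import Data.List.Relation.Unary.All as All using (All; []; _∷_)
  open import Data.List.Relation.Unary.AllPairs using ([]; _∷_)
  open import Data.List.Relation.Unary.Any using (here; there)
  open import Data.List.Relation.Unary.Unique.Propositional using (Unique)
  open import Data.Maybe using (Maybe; just; nothing)
  open import Data.Nat using (ℕ; suc; _+_; _*_; _≤_)
  open import Data.Nat.Properties using (+-0-commutativeMonoid; +-identityʳ)
  open import Data.Product using (_×_; _,_; proj₁; proj₂)
  open import Data.Product.Properties using (≡-dec)
  open import Data.Sum using (inj₁; inj₂)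
  open import Function using (_∘_)
  open import Function.Definitions using (Injective)
  open import Relation.Binary.PropositionalEquality
  open import Relation.Nullary using (¬_; contradiction; does; yes; no; Dec)
  open import Relation.Nullary.Decidable using (dec-true; dec-false)
  open import Algebra.Properties.CommutativeMonoid.Sum +-0-commutativeMonoid using (sum; ∑-distrib-+; ∑-comm; sum-cong-≗)
  open ParityDrawings
  open Mader
  open Segments

  edgeBelow : Point → Point → Point → Maybe Point → Bool
  edgeBelow p r s nothing  = passesBelow p (r , s)
  edgeBelow p r s (just b) = passesBelow p (r , b) xor passesBelow p (b , s)

  AllDisjoint : List Segment → List Segment → Set
  AllDisjoint S T = ∀ s t → s ∈ S → t ∈ T → Disjoint s t

  segment-parity : ∀ a b r s m → AllDisjoint ((a , b) ∷ []) (segments r s m) →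
    (edgeBelow a r s m xor edgeBelow b r s m) xor (passesBelow r (a , b) xor passesBelow s (a , b))
    ≡ linkParity (a , b) (r , s)
  segment-parity a b r s nothing  dis = parity-disjoint {a , b} {r , s} (dis _ _ (here refl) (here refl))
  segment-parity a b r s (just c) dis = detour-right
    (passesBelow a (r , c)) (passesBelow a (c , s)) (passesBelow b (r , c)) (passesBelow b (c , s))
    (passesBelow r (a , b)) (passesBelow c (a , b)) (passesBelow s (a , b))
    (before r a xor before r b) (before c a xor before c b) (before s a xor before s b)
    (parity-disjoint {a , b} {r , c} (dis _ _ (here refl) (here refl)))
    (parity-disjoint {a , b} {c , s} (dis _ _ (here refl) (there (here refl))))

  -- A bend plays the role of a contracted vertex: its terms cancel, and only comparisons between
  -- the four end-vertices remain.
  edge-parity : ∀ p q m r s m' → AllDisjoint (segments p q m) (segments r s m') →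
    (edgeBelow p r s m' xor edgeBelow q r s m') xor (edgeBelow r p q m xor edgeBelow s p q m)
    ≡ linkParity (p , q) (r , s)
  edge-parity p q nothing  r s m' dis = segment-parity p q r s m' dis
  edge-parity p q (just c) r s m' dis = detour-left
    (edgeBelow p r s m') (edgeBelow q r s m') (edgeBelow c r s m')
    (passesBelow r (p , c)) (passesBelow r (c , q)) (passesBelow s (p , c)) (passesBelow s (c , q))
    (before r p) (before r q) (before r c) (before s p) (before s q) (before s c)
    (segment-parity p c r s m' λ where u v (here refl) v∈ → dis _ v (here refl) v∈)
    (segment-parity c q r s m' λ where u v (here refl) v∈ → dis _ v (there (here refl)) v∈)

  _≟ᵉ_ : ∀ {n} (e f : Fin n × Fin n) → Dec (e ≡ f)
  _≟ᵉ_ = ≡-dec Finₚ._≟_ Finₚ._≟_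

  module _ {n : ℕ} where
    open import Data.List.Membership.DecPropositional (_≟ᵉ_ {n}) public using (_∈?_)

  listed : ∀ {n} → List (Fin n × Fin n) → Fin n → Fin n → Bool
  listed L i j = does ((i , j) ∈? L)

  listed-sound : ∀ {n} (L : List (Fin n × Fin n)) i j → listed L i j ≡ true → (i , j) ∈ L
  listed-sound L i j e with (i , j) ∈? L
  ... | yes p = p
  listed-sound L i j () | no _

  sum-pair : ∀ {n} (a b : Fin n) → sum (λ i → sum (λ j → ⟦ does ((i , j) ≟ᵉ (a , b)) ⟧)) ≡ 1
  sum-pair {n} a b = trans (sum-cong-≗ (λ i → line i (i Finₚ.≟ a))) (sum-indicator a 1)
    where
    column : ∀ j → Dec (j ≡ b) → ⟦ does ((a , j) ≟ᵉ (a , b)) ⟧ ≡ (if does (j Finₚ.≟ b) then 1 else 0)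
    column j (yes refl) = trans (cong ⟦_⟧ (dec-true ((a , j) ≟ᵉ (a , j)) refl))
                                (sym (if-true (dec-true (j Finₚ.≟ j) refl)))
    column j (no j≢b)   = trans (cong ⟦_⟧ (dec-false ((a , j) ≟ᵉ (a , b)) (j≢b ∘ cong proj₂)))
                                (sym (if-false (dec-false (j Finₚ.≟ b) j≢b)))
    line : ∀ i → Dec (i ≡ a) → sum (λ j → ⟦ does ((i , j) ≟ᵉ (a , b)) ⟧) ≡ (if does (i Finₚ.≟ a) then 1 else 0)
    line i (yes refl) = trans (trans (sum-cong-≗ (λ j → column j (j Finₚ.≟ b))) (sum-indicator b 1))
                              (sym (if-true (dec-true (i Finₚ.≟ i) refl)))
    line i (no i≢a)   = trans (sum-zero _ λ j → cong ⟦_⟧ (dec-false ((i , j) ≟ᵉ (a , b)) (i≢a ∘ cong proj₁)))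
                              (sym (if-false (dec-false (i Finₚ.≟ a) i≢a)))

  sum-listed : ∀ {n} {L : List (Fin n × Fin n)} → Unique L → sum (λ i → sum (λ j → ⟦ listed L i j ⟧)) ≡ length L
  sum-listed {n} {[]} [] = sum-zero {n} _ λ i → sum-zero {n} _ λ j → refl
  sum-listed {n} {(a , b) ∷ L} (fresh ∷ u) = begin
    sum (λ i → sum (λ j → ⟦ listed ((a , b) ∷ L) i j ⟧))
      ≡⟨ sum-cong-≗ (λ i → trans (sum-cong-≗ (entry i)) (∑-distrib-+ (λ j → ⟦ does ((i , j) ≟ᵉ (a , b)) ⟧) _)) ⟩
    sum (λ i → sum (λ j → ⟦ does ((i , j) ≟ᵉ (a , b)) ⟧) + sum (λ j → ⟦ listed L i j ⟧))
      ≡⟨ ∑-distrib-+ (λ i → sum (λ j → ⟦ does ((i , j) ≟ᵉ (a , b)) ⟧)) _ ⟩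
    sum (λ i → sum (λ j → ⟦ does ((i , j) ≟ᵉ (a , b)) ⟧)) + sum (λ i → sum (λ j → ⟦ listed L i j ⟧))
      ≡⟨ cong₂ _+_ (sum-pair a b) (sum-listed u) ⟩
    suc (length L) ∎
    where
    open ≡-Reasoning
    entry : ∀ i j → ⟦ listed ((a , b) ∷ L) i j ⟧ ≡ ⟦ does ((i , j) ≟ᵉ (a , b)) ⟧ + ⟦ listed L i j ⟧
    entry i j with (i , j) ≟ᵉ (a , b)
    ... | no _     = refl
    ... | yes refl = cong (λ b → 1 + ⟦ b ⟧) (sym (dec-false ((a , b) ∈? L) λ ab∈L → All.lookup fresh ab∈L refl))

  module PlaneEdges {n : ℕ} (L : List (Fin n × Fin n)) (ordered : All (λ e → proj₁ e <ᶠ proj₂ e) L)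
    (pos : Fin n → Point) (pos-inj : Injective _≡_ _≡_ pos) (bend : Fin n × Fin n → Maybe Point)
    (disjoint : ∀ {a b c d} → (a , b) ∈ L → (c , d) ∈ L → a ≢ c → a ≢ d → b ≢ c → b ≢ d →
       AllDisjoint (segments (pos a) (pos b) (bend (a , b))) (segments (pos c) (pos d) (bend (c , d)))) where

    adjacent : Fin n → Fin n → Bool
    adjacent i j = listed L i j ∨ listed L j i

    -- Edges are stored in one direction only; tracing an edge in its stored direction, whichever
    -- orientation is asked for, evaluates `bend` at the listed pair. The value at nonadjacent pairs
    -- is arbitrary.
    below : Fin n → Fin n → Fin n → Bool
    below p i j = if listed L i j then edgeBelow (pos p) (pos i) (pos j) (bend (i , j))
                  else edgeBelow (pos p) (pos j) (pos i) (bend (j , i))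

    Even : Fin n → Fin n → Fin n → Fin n → Set
    Even u v w x = (below u w x xor below v w x) xor (below w u v xor below x u v)
                   ≡ linkParity (pos u , pos v) (pos w , pos x)

    below-listed : ∀ {i j} → (i , j) ∈ L → ∀ p → below p i j ≡ edgeBelow (pos p) (pos i) (pos j) (bend (i , j))
    below-listed {i} {j} ij∈L p = if-true (dec-true ((i , j) ∈? L) ij∈L)

    antisymmetric : ∀ {i j} → (i , j) ∈ L → ¬ (j , i) ∈ L
    antisymmetric ij ji = Finₚ.<-asym (All.lookup ordered ij) (All.lookup ordered ji)

    below-swap : ∀ {i j} → (i , j) ∈ L → ∀ p → below p j i ≡ below p i j
    below-swap {i} {j} ij∈L p = trans (if-false (dec-false ((j , i) ∈? L) (antisymmetric ij∈L))) (sym (below-listed ij∈L p))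

    even-listed : ∀ {u v w x} → (u , v) ∈ L → (w , x) ∈ L → u ≢ w → u ≢ x → v ≢ w → v ≢ x → Even u v w x
    even-listed {u} {v} {w} {x} uv wx uw ux vw vx = trans
      (cong₂ _xor_ (cong₂ _xor_ (below-listed wx u) (below-listed wx v))
                   (cong₂ _xor_ (below-listed uv w) (below-listed uv x)))
      (edge-parity (pos u) (pos v) (bend (u , v)) (pos w) (pos x) (bend (w , x)) (disjoint uv wx uw ux vw vx))

    even-swap-left : ∀ {u v w x} → (v , u) ∈ L → Even v u w x → Even u v w x
    even-swap-left {u} {v} {w} {x} vu e = trans
      (cong₂ _xor_ (xor-comm (below u w x) _) (cong₂ _xor_ (below-swap vu w) (below-swap vu x)))
      (trans e (cong₂ _xor_ (xor-comm (before (pos w) (pos v)) _) (xor-comm (before (pos x) (pos v)) _)))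

    even-swap-right : ∀ {u v w x} → (x , w) ∈ L → Even u v x w → Even u v w x
    even-swap-right {u} {v} {w} {x} xw e = trans
      (cong₂ _xor_ (cong₂ _xor_ (below-swap xw u) (below-swap xw v)) (xor-comm (below w u v) _))
      (trans e (xor-comm (before (pos x) (pos u) xor before (pos x) (pos v)) _))

    even : ∀ {u v w x} → adjacent u v ≡ true → adjacent w x ≡ true →
           u ≢ w → u ≢ x → v ≢ w → v ≢ x → Even u v w x
    even {u} {v} {w} {x} uv wx uw ux vw vx with ∨-split (listed L u v) uv | ∨-split (listed L w x) wx
    ... | inj₁ e | inj₁ f = even-listed (listed-sound L u v e) (listed-sound L w x f) uw ux vw vx
    ... | inj₁ e | inj₂ f = even-swap-right f' (even-listed (listed-sound L u v e) f' ux uw vx vw)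
      where f' = listed-sound L x w f
    ... | inj₂ e | inj₁ f = even-swap-left e' (even-listed e' (listed-sound L w x f) vw vx uw ux)
      where e' = listed-sound L v u e
    ... | inj₂ e | inj₂ f = even-swap-left e' (even-swap-right f' (even-listed e' f' vx vw ux uw))
      where e' = listed-sound L v u e
            f' = listed-sound L x w f

    parityDrawing : ParityDrawing adjacent
    parityDrawing = record
      { symm    = λ i j → ∨-comm (listed L i j) _
      ; irrefl  = λ i → cong (λ b → b ∨ b) (dec-false ((i , i) ∈? L) λ ii → antisymmetric ii ii)
      ; left    = λ i j → before (pos i) (pos j)
      ; left-tournament = λ i≢j → before-not (i≢j ∘ pos-inj)
      ; below   = below
      ; even    = even
      }

    total-edges : Unique L → total adjacent ≡ 2 * length L
    total-edges unique = begin
      total adjacent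
        ≡⟨ sum-cong-≗ (λ i → trans (sum-cong-≗ (entry i)) (∑-distrib-+ (λ j → ⟦ listed L i j ⟧) _)) ⟩
      sum (λ i → sum (λ j → ⟦ listed L i j ⟧) + sum (λ j → ⟦ listed L j i ⟧))
        ≡⟨ ∑-distrib-+ (λ i → sum (λ j → ⟦ listed L i j ⟧)) _ ⟩
      sum (λ i → sum (λ j → ⟦ listed L i j ⟧)) + sum (λ i → sum (λ j → ⟦ listed L j i ⟧))
        ≡⟨ cong₂ _+_ (sum-listed unique) (trans (∑-comm (λ i j → ⟦ listed L j i ⟧)) (sum-listed unique)) ⟩
      length L + length L
        ≡⟨ cong (length L +_) (+-identityʳ (length L)) ⟨
      2 * length L ∎
      where
      open ≡-Reasoning
      entry : ∀ i j → ⟦ adjacent i j ⟧ ≡ ⟦ listed L i j ⟧ + ⟦ listed L j i ⟧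
      entry i j with listed L i j in ij | listed L j i in ji
      ... | true  | true  = contradiction (listed-sound L j i ji) (antisymmetric (listed-sound L i j ij))
      ... | true  | false = refl
      ... | false | _     = refl

  plane-edge-bound : ∀ m (L : List (Fin (3 + m) × Fin (3 + m))) → All (λ e → proj₁ e <ᶠ proj₂ e) L → Unique L →
    (pos : Fin (3 + m) → Point) → Injective _≡_ _≡_ pos → (bend : Fin (3 + m) × Fin (3 + m) → Maybe Point) →
    (∀ {a b c d} → (a , b) ∈ L → (c , d) ∈ L → a ≢ c → a ≢ d → b ≢ c → b ≢ d →
       AllDisjoint (segments (pos a) (pos b) (bend (a , b))) (segments (pos c) (pos d) (bend (c , d)))) →
    2 * length L + 12 ≤ 6 * (3 + m)
  plane-edge-bound m L ordered unique pos pos-inj bend disjoint =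
    subst (λ k → k + 12 ≤ 6 * (3 + m)) (total-edges unique) (edge-bound m parityDrawing)
    where open PlaneEdges L ordered pos pos-inj bend disjoint

-- Vertical ports and the upper bound 5n - 8.

module UpperBound where

  open import Defs
  open import Data.Bool using (Bool; true; false)
  open import Data.Empty using (⊥; ⊥-elim)
  open import Data.Fin using (Fin; zero; suc; combine) renaming (_<_ to _<ᶠ_)
  import Data.Fin.Properties as Finₚ
  open import Data.List using (List; []; _∷_; length; filter; lookup)
  open import Data.List.Membership.Propositional using (_∈_; find)
  open import Data.List.Membership.Propositional.Properties using (∈-filter⁻; ∈-lookup)
  open import Data.List.Relation.Unary.All as All using (All; []; _∷_)
  import Data.List.Relation.Unary.All.Properties as Allₚ
  open import Data.List.Relation.Unary.AllPairs using ([]; _∷_)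
  open import Data.List.Relation.Unary.Any as Any using (Any; here; there; any?)
  open import Data.List.Relation.Unary.Unique.Propositional using (Unique)
  import Data.List.Relation.Unary.Unique.Propositional.Properties as Uniqueₚ
  open import Data.Maybe using (just; nothing; fromMaybe)
  open import Data.Nat as ℕ using (ℕ; zero; suc; z≤n; s≤s)
  import Data.Nat.Properties as ℕₚ
  open import Data.Nat.Solver using (module +-*-Solver)
  open import Data.Product using (∃; _×_; _,_; proj₁; proj₂)
  open import Data.Rational using (ℚ; _≤_; _<_; _<?_; _⊓_; _⊔_; _*_; _-_)
  open import Data.Rational.Properties
  open import Data.Sum using (_⊎_; inj₁; inj₂)
  open import Function using (_∘_)
  open import Function.Definitions using (Injective)
  open import Relation.Binary.Definitions using (tri<; tri≈; tri>)
  open import Relation.Binary.PropositionalEquality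
  open import Relation.Nullary using (¬_; contradiction; does; yes; no; ¬?)
  open import Relation.Nullary.Decidable using (_×-dec_; _⊎-dec_)
  open import Relation.Unary using (Decidable)
  open Mader using (least)
  open Segments
  open PlaneDrawings
  open +-*-Solver using (solve; _:=_; con; _:+_; _:*_)

  highest : ∀ {n} (f : Fin (suc n) → ℚ) → ∃ λ i → ∀ j → f j ≤ f i
  highest = least {_⊑_ = λ x y → y ≤ x} ≤-refl (λ p q → ≤-trans q p) (λ x y → ≤-total y x)

  lowest : ∀ {n} (f : Fin (suc n) → ℚ) → ∃ λ i → ∀ j → f i ≤ f j
  lowest = least ≤-refl ≤-trans ≤-total

  lookup-injective : ∀ {X : Set} {L : List X} → Unique L → ∀ i j → lookup L i ≡ lookup L j → i ≡ j
  lookup-injective (fresh ∷ u) zero    zero    e = refl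
  lookup-injective (fresh ∷ u) zero    (suc j) e = contradiction e (All.lookup fresh (∈-lookup j))
  lookup-injective (fresh ∷ u) (suc i) zero    e = contradiction (sym e) (All.lookup fresh (∈-lookup i))
  lookup-injective (fresh ∷ u) (suc i) (suc j) e = cong suc (lookup-injective u i j e)

  length-filter-¬ : ∀ {X : Set} {P : X → Set} (P? : Decidable P) L →
    length L ≡ length (filter P? L) ℕ.+ length (filter (¬? ∘ P?) L)
  length-filter-¬ P? [] = refl
  length-filter-¬ P? (x ∷ L) with does (P? x)
  ... | true  = cong suc (length-filter-¬ P? L)
  ... | false = trans (cong suc (length-filter-¬ P? L)) (sym (ℕₚ.+-suc _ _))

  onSeg-above : ∀ {q a b} → proj₂ a ≤ proj₂ b → OnSeg q (a , b) → proj₂ a ≤ proj₂ q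
  onSeg-above {q} a≤b (_ , _ , _ , lo , _) = subst (_≤ proj₂ q) (p≤q⇒p⊓q≡p a≤b) lo

  onSeg-below : ∀ {q a b} → proj₂ b ≤ proj₂ a → OnSeg q (a , b) → proj₂ q ≤ proj₂ a
  onSeg-below {q} b≤a (_ , _ , _ , _ , hi) = subst (proj₂ q ≤_) (p≥q⇒p⊔q≡p b≤a) hi

  onSeg-vertical : ∀ {x qy ay by} → ay ⊓ by ≤ qy → qy ≤ ay ⊔ by → OnSeg (x , qy) ((x , ay) , (x , by))
  onSeg-vertical {x} {qy} {ay} {by} lo hi =
    trans (cong (_* (qy - ay)) (+-inverseʳ x))
      (trans (*-zeroˡ (qy - ay)) (trans (sym (*-zeroʳ (by - ay)))
        (cong ((by - ay) *_) (sym (+-inverseʳ x)))))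
    , ≤-reflexive (⊓-idem x) , ≤-reflexive (sym (⊔-idem x)) , lo , hi

  module Ports {k : ℕ} (G : Graph (suc k)) (drawing : OneBendApRAC G) where
    open OneBendApRAC drawing

    private
      n : ℕ
      n = suc k
      Edge : Set
      Edge = Fin n × Fin n

      xᵥ yᵥ : Fin n → ℚ
      xᵥ w = proj₁ (pos w)
      yᵥ w = proj₂ (pos w)

      top bottom : Fin n
      top    = proj₁ (highest yᵥ)
      bottom = proj₁ (lowest yᵥ)

    -- Each segment of a 1-bend drawing has a vertex at one end; an arm lists
    -- that vertex and the opposite end of the segment.
    arms : Edge → List (Fin n × Point)
    arms e@(u , v) = (u , fromMaybe (pos v) (bend e)) ∷ (v , fromMaybe (pos u) (bend e)) ∷ []

    -- Segments are stored out of the first vertex of an edge and into the second; this view lets an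
    -- arm be used without regard to that direction.
    data Spans (w : Fin n) (z : Point) : Segment → Set where
      outward : Spans w z (pos w , z)
      inward  : Spans w z (z , pos w)

    spans-onSeg : ∀ {w z s q} → Spans w z s → OnSeg q s → OnSeg q (pos w , z)
    spans-onSeg outward on = on
    spans-onSeg {w} {z} {q = q} inward on = onSeg-swap {q} {z} {pos w} on

    onSeg-spans : ∀ {w z s q} → Spans w z s → OnSeg q (pos w , z) → OnSeg q s
    onSeg-spans outward on = on
    onSeg-spans {w} {z} {q = q} inward on = onSeg-swap {q} {pos w} {z} on

    spans-horizontal : ∀ {w z s} → Spans w z s → Horizontal s → yᵥ w ≡ proj₂ z
    spans-horizontal outward h = h
    spans-horizontal inward  h = sym h

    spans-vertical : ∀ {w z s} → Spans w z s → Vertical s → xᵥ w ≡ proj₁ z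
    spans-vertical outward h = h
    spans-vertical inward  h = sym h

    arm-segment : ∀ {e w z} → (w , z) ∈ arms e → IsEnd w e × ∃ λ s → s ∈ segs e × Spans w z s
    arm-segment {e} (here refl) with bend e
    ... | nothing = inj₁ refl , _ , here refl , outward
    ... | just b  = inj₁ refl , _ , here refl , outward
    arm-segment {e} (there (here refl)) with bend e
    ... | nothing = inj₂ refl , _ , here refl , inward
    ... | just b  = inj₂ refl , _ , there (here refl) , inward

    segment-arm : ∀ {e s} → e ∈ edges G → s ∈ segs e →
      ∃ λ w → ∃ λ z → (w , z) ∈ arms e × IsEnd w e × Spans w z s × z ≢ pos w
    segment-arm {e} e∈ s∈ with bend e in eq
    segment-arm {u , v} e∈ (here refl) | nothing = u , _ , here refl , inj₁ refl , outward ,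
      λ pv≡pu → Finₚ.<-irrefl (sym (pos-inj pv≡pu)) (All.lookup (ordered G) e∈)
    segment-arm {u , v} e∈ (here refl) | just b = u , b , here refl , inj₁ refl , outward ,
      proj₁ (bend-ok _ e∈ b eq)
    segment-arm {u , v} e∈ (there (here refl)) | just b = v , b , there (here refl) , inj₂ refl , inward ,
      proj₂ (bend-ok _ e∈ b eq)

    two-ends : ∀ {e f u w} → e ∈ edges G → f ∈ edges G → u ≢ w →
               IsEnd u e → IsEnd w e → IsEnd u f → IsEnd w f → e ≡ f
    two-ends e∈ f∈ u≢w (inj₁ refl) (inj₁ refl) _ _ = contradiction refl u≢w
    two-ends e∈ f∈ u≢w (inj₂ refl) (inj₂ refl) _ _ = contradiction refl u≢w
    two-ends e∈ f∈ u≢w _ _ (inj₁ refl) (inj₁ refl) = contradiction refl u≢w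
    two-ends e∈ f∈ u≢w _ _ (inj₂ refl) (inj₂ refl) = contradiction refl u≢w
    two-ends e∈ f∈ u≢w (inj₁ refl) (inj₂ refl) (inj₁ refl) (inj₂ refl) = refl
    two-ends e∈ f∈ u≢w (inj₂ refl) (inj₁ refl) (inj₂ refl) (inj₁ refl) = refl
    two-ends e∈ f∈ u≢w (inj₁ refl) (inj₂ refl) (inj₂ refl) (inj₁ refl) =
      contradiction (All.lookup (ordered G) f∈) (Finₚ.<-asym (All.lookup (ordered G) e∈))
    two-ends e∈ f∈ u≢w (inj₂ refl) (inj₁ refl) (inj₁ refl) (inj₂ refl) =
      contradiction (All.lookup (ordered G) f∈) (Finₚ.<-asym (All.lookup (ordered G) e∈))

    -- The point `z` belongs to segments of both edges, neither of which is horizontal, so `apRAC`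
    -- excludes it unless it is a common end-vertex. That vertex would differ from `w` by its
    -- height, and two edges with two common ends are equal.
    no-shared-arm-end : ∀ {e f w z z'} → e ∈ edges G → f ∈ edges G → e ≢ f →
      (w , z) ∈ arms e → (w , z') ∈ arms f → yᵥ w ≢ proj₂ z → yᵥ w ≢ proj₂ z' →
      OnSeg z (pos w , z') → ⊥
    no-shared-arm-end {e} {f} {w} {z} {z'} e∈ f∈ e≢f a b y≢z y≢z' on =
      conclude (apRAC e f e∈ f∈ e≢f s t s∈ t∈ z
        (onSeg-spans {w} {z} {s} {z} sp (onSeg-end (pos w) z)) (onSeg-spans {w} {z'} {t} {z} tp on) not-shared)
      where
      we = proj₁ (arm-segment {e} a)
      wf = proj₁ (arm-segment {f} b)
      s  = proj₁ (proj₂ (arm-segment {e} a))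
      t  = proj₁ (proj₂ (arm-segment {f} b))
      s∈ = proj₁ (proj₂ (proj₂ (arm-segment {e} a)))
      t∈ = proj₁ (proj₂ (proj₂ (arm-segment {f} b)))
      sp = proj₂ (proj₂ (proj₂ (arm-segment {e} a)))
      tp = proj₂ (proj₂ (proj₂ (arm-segment {f} b)))
      not-shared : ∀ u → IsEnd u e → IsEnd u f → z ≢ pos u
      not-shared u ue uf z≡u = e≢f (two-ends e∈ f∈ u≢w ue we uf wf)
        where
        u≢w : u ≢ w
        u≢w refl = y≢z (cong proj₂ (sym z≡u))
      conclude : (Horizontal s × Vertical t) ⊎ (Vertical s × Horizontal t) → ⊥
      conclude (inj₁ (h , _)) = y≢z (spans-horizontal sp h)
      conclude (inj₂ (_ , h)) = y≢z' (spans-horizontal tp h)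

    -- true is upwards, false is downwards.
    Heading : Bool → ℚ → ℚ → Set
    Heading true  y y' = y < y'
    Heading false y y' = y' < y

    heading⇒≢ : ∀ h {y y'} → Heading h y y' → y ≢ y'
    heading⇒≢ true  p refl = <-irrefl refl p
    heading⇒≢ false p refl = <-irrefl refl p

    nearer : ∀ h {x y z z'} → Heading h y z → Heading h y z' →
             OnSeg (x , z) ((x , y) , (x , z')) ⊎ OnSeg (x , z') ((x , y) , (x , z))
    nearer h {x} {y} {z} {z'} p p' with ≤-total z z'
    nearer true  {x} {y} {z} {z'} p p' | inj₁ le = inj₁ (onSeg-vertical (≤-trans (p⊓q≤p y z') (<⇒≤ p)) (≤-trans le (p≤q⊔p y z')))
    nearer true  {x} {y} {z} {z'} p p' | inj₂ ge = inj₂ (onSeg-vertical (≤-trans (p⊓q≤p y z) (<⇒≤ p')) (≤-trans ge (p≤q⊔p y z)))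
    nearer false {x} {y} {z} {z'} p p' | inj₁ le = inj₂ (onSeg-vertical (≤-trans (p⊓q≤q y z) le) (≤-trans (<⇒≤ p') (p≤p⊔q y z)))
    nearer false {x} {y} {z} {z'} p p' | inj₂ ge = inj₁ (onSeg-vertical (≤-trans (p⊓q≤q y z') ge) (≤-trans (<⇒≤ p) (p≤p⊔q y z')))

    -- Of two vertical segments with the same heading at `w`, the shorter would end on the longer
    -- one, away from `w`.
    unique-port : ∀ h {e f w z z'} → e ∈ edges G → f ∈ edges G → (w , z) ∈ arms e → (w , z') ∈ arms f →
      xᵥ w ≡ proj₁ z → xᵥ w ≡ proj₁ z' → Heading h (yᵥ w) (proj₂ z) → Heading h (yᵥ w) (proj₂ z') → e ≡ f
    unique-port h {e} {f} {w} {x , z} {x' , z'} e∈ f∈ a b refl refl p p' with e ≟ᵉ f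
    ... | yes e≡f = e≡f
    ... | no e≢f with nearer h p p'
    ...   | inj₁ on = ⊥-elim (no-shared-arm-end e∈ f∈ e≢f a b (heading⇒≢ h p) (heading⇒≢ h p') on)
    ...   | inj₂ on = ⊥-elim (no-shared-arm-end f∈ e∈ (e≢f ∘ sym) b a (heading⇒≢ h p') (heading⇒≢ h p) on)

    extreme : Bool → Fin n
    extreme true  = top
    extreme false = bottom

    PortAt : Fin n × Point → Bool → Set
    PortAt (w , z) h = Heading h (yᵥ w) (proj₂ z) × w ≢ extreme h

    -- An over-approximation: it holds for any properly vertical arm outside the two excepted ports,
    -- crossed or not, so that removed edges can be counted by ports alone.
    Crossable : Fin n × Point → Set
    Crossable (w , z) = xᵥ w ≡ proj₁ z × (PortAt (w , z) true ⊎ PortAt (w , z) false)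

    crossable? : Decidable Crossable
    crossable? (w , z) = (xᵥ w ≟ proj₁ z) ×-dec
      (((yᵥ w <? proj₂ z) ×-dec ¬? (w Finₚ.≟ top)) ⊎-dec ((proj₂ z <? yᵥ w) ×-dec ¬? (w Finₚ.≟ bottom)))

    Removed : Edge → Set
    Removed e = Any Crossable (arms e)

    removed? : Decidable Removed
    removed? e = any? crossable? (arms e)

    removed kept : List Edge
    removed = filter removed? (edges G)
    kept    = filter (¬? ∘ removed?) (edges G)

    Port : Edge → Fin n → Bool → Set
    Port e w h = ∃ λ z → (w , z) ∈ arms e × xᵥ w ≡ proj₁ z × PortAt (w , z) h

    port : ∀ {e} → Removed e → ∃ λ w → ∃ λ h → Port e w h
    port r with find r
    ... | (w , z) , a , x , inj₁ p = w , true  , z , a , x , p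
    ... | (w , z) , a , x , inj₂ p = w , false , z , a , x , p

    code : Fin n → Bool → Fin (n ℕ.* 2)
    code w true  = combine w zero
    code w false = combine w (suc zero)

    code-injective : ∀ {w h w' h'} → code w h ≡ code w' h' → w ≡ w' × h ≡ h'
    code-injective {w} {true}  {w'} {true}  e = Finₚ.combine-injectiveˡ w zero w' zero e , refl
    code-injective {w} {false} {w'} {false} e = Finₚ.combine-injectiveˡ w (suc zero) w' (suc zero) e , refl
    code-injective {w} {true}  {w'} {false} e = contradiction (Finₚ.combine-injectiveʳ w zero w' (suc zero) e) λ ()
    code-injective {w} {false} {w'} {true}  e = contradiction (Finₚ.combine-injectiveʳ w (suc zero) w' zero e) λ ()

    port-determines : ∀ {e f w h w' h'} → e ∈ edges G → f ∈ edges G → Port e w h → Port f w' h' →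
                      w ≡ w' → h ≡ h' → e ≡ f
    port-determines {h = h} e∈ f∈ (z , a , x , p , _) (z' , a' , x' , p' , _) refl refl =
      unique-port h e∈ f∈ a a' x x' p p'

    port-not-extreme : ∀ {e w h h'} → Port e w h → w ≡ extreme h' → ¬ h ≡ h'
    port-not-extreme (_ , _ , _ , _ , w≢) w≡ refl = w≢ w≡

    -- Every removed edge selects one of its ports, and a port determines its edge. The two excepted
    -- ports are prepended to the list of removed edges, so that the count becomes an injection into
    -- the 2n pairs of a vertex and a heading.
    removed-bound : 2 ℕ.+ length removed ℕ.≤ n ℕ.* 2
    removed-bound = Finₚ.injective⇒≤ {f = f} f-injective
      where
      isRemoved : ∀ i → Removed (lookup removed i)
      isRemoved i = proj₂ (∈-filter⁻ removed? {xs = edges G} (∈-lookup i))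
      isEdge : ∀ i → lookup removed i ∈ edges G
      isEdge i = proj₁ (∈-filter⁻ removed? {xs = edges G} (∈-lookup i))
      vertex : Fin (length removed) → Fin n
      vertex i = proj₁ (port (isRemoved i))
      heading : Fin (length removed) → Bool
      heading i = proj₁ (proj₂ (port (isRemoved i)))
      isPort : ∀ i → Port (lookup removed i) (vertex i) (heading i)
      isPort i = proj₂ (proj₂ (port (isRemoved i)))

      f : Fin (2 ℕ.+ length removed) → Fin (n ℕ.* 2)
      f zero          = code top true
      f (suc zero)    = code bottom false
      f (suc (suc i)) = code (vertex i) (heading i)

      not-extreme : ∀ i h → f (suc (suc i)) ≢ code (extreme h) h
      not-extreme i h e = port-not-extreme (isPort i) (proj₁ same) (proj₂ same)
        where same = code-injective {vertex i} {heading i} {extreme h} {h} e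

      same-port : ∀ i j → f (suc (suc i)) ≡ f (suc (suc j)) → i ≡ j
      same-port i j e = lookup-injective (Uniqueₚ.filter⁺ removed? (unique G)) i j
        (port-determines (isEdge i) (isEdge j) (isPort i) (isPort j) (proj₁ same) (proj₂ same))
        where same = code-injective {vertex i} {heading i} {vertex j} {heading j} e

      f-injective : Injective _≡_ _≡_ f
      f-injective {zero}          {zero}          e = refl
      f-injective {zero}          {suc zero}      e = contradiction (proj₂ (code-injective {top} {true} {bottom} {false} e)) λ ()
      f-injective {suc zero}      {zero}          e = contradiction (proj₂ (code-injective {bottom} {false} {top} {true} e)) λ ()
      f-injective {suc zero}      {suc zero}      e = refl
      f-injective {zero}          {suc (suc j)}   e = contradiction (sym e) (not-extreme j true)
      f-injective {suc zero}      {suc (suc j)}   e = contradiction (sym e) (not-extreme j false)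
      f-injective {suc (suc i)}   {zero}          e = contradiction e (not-extreme i true)
      f-injective {suc (suc i)}   {suc zero}      e = contradiction e (not-extreme i false)
      f-injective {suc (suc i)}   {suc (suc j)}   e = cong (λ k → suc (suc k)) (same-port i j e)

    kept-edge : ∀ {e} → e ∈ kept → e ∈ edges G
    kept-edge e∈ = proj₁ (∈-filter⁻ (¬? ∘ removed?) {xs = edges G} e∈)

    kept-not-removed : ∀ {e} → e ∈ kept → ¬ Removed e
    kept-not-removed e∈ = proj₂ (∈-filter⁻ (¬? ∘ removed?) {xs = edges G} e∈)

    -- A kept vertical segment leaves an extreme vertex away from the drawing, so
    -- a horizontal segment could only meet it in that vertex.
    kept-uncrossed : ∀ {e f s t q} → e ∈ edges G → f ∈ kept → (∀ u → IsEnd u e → ¬ IsEnd u f) →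
      s ∈ segs e → t ∈ segs f → OnSeg q s → OnSeg q t → Horizontal s → Vertical t → ⊥
    kept-uncrossed {e} {f} {s} {t} {q} e∈ f∈ apart s∈ t∈ on on' hs vt
      with segment-arm {e} e∈ s∈ | segment-arm {f} (kept-edge f∈) t∈
    ... | v , z' , _ , _ , sp , _ | w , z , arm , wf , tp , z≢w = by-heading (<-cmp (yᵥ w) (proj₂ z))
      where
      wx≡zx : xᵥ w ≡ proj₁ z
      wx≡zx = spans-vertical tp vt
      onArm : OnSeg q (pos w , z)
      onArm = spans-onSeg {q = q} tp on'
      qy≡vy : proj₂ q ≡ yᵥ v
      qy≡vy = horizontal-onSeg {q} {pos v} {z'} (spans-horizontal sp hs) (spans-onSeg {q = q} sp on)
      at-vertex : proj₂ q ≡ yᵥ w → ⊥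
      at-vertex qy≡wy = avoid e e∈ w (λ we → apart w we wf) s s∈
        (subst (λ p → OnSeg p s) (cong₂ _,_ (vertical-onSeg {q} {pos w} {z} wx≡zx onArm) qy≡wy) on)
      by-heading : _ → ⊥
      by-heading (tri< wy<zy _ _) with w Finₚ.≟ top
      ... | no w≢top = kept-not-removed f∈ (Any.map (λ where refl → wx≡zx , inj₁ (wy<zy , w≢top)) arm)
      ... | yes w≡top = at-vertex (≤-antisym
              (subst₂ _≤_ (sym qy≡vy) (cong yᵥ (sym w≡top)) (proj₂ (highest yᵥ) v))
              (onSeg-above {q} {pos w} {z} (<⇒≤ wy<zy) onArm))
      by-heading (tri> _ _ zy<wy) with w Finₚ.≟ bottom
      ... | no w≢bot = kept-not-removed f∈ (Any.map (λ where refl → wx≡zx , inj₂ (zy<wy , w≢bot)) arm)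
      ... | yes w≡bot = at-vertex (≤-antisym
              (onSeg-below {q} {pos w} {z} (<⇒≤ zy<wy) onArm)
              (subst₂ _≤_ (cong yᵥ (sym w≡bot)) (sym qy≡vy) (proj₂ (lowest yᵥ) v)))
      by-heading (tri≈ _ wy≡zy _) = z≢w (sym (cong₂ _,_ wx≡zx wy≡zy))

    kept-disjoint : ∀ {a b c d} → (a , b) ∈ kept → (c , d) ∈ kept → a ≢ c → a ≢ d → b ≢ c → b ≢ d →
      AllDisjoint (segs (a , b)) (segs (c , d))
    kept-disjoint {a} {b} {c} {d} e∈ f∈ a≢c a≢d b≢c b≢d s t s∈ t∈ (q , on , on') =
      conclude (apRAC (a , b) (c , d) (kept-edge e∈) (kept-edge f∈) (λ e≡f → a≢c (cong proj₁ e≡f))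
        s t s∈ t∈ q on on' (λ u ue uf → contradiction uf (apart u ue)))
      where
      apart : ∀ u → IsEnd u (a , b) → ¬ IsEnd u (c , d)
      apart u (inj₁ refl) (inj₁ e) = a≢c e
      apart u (inj₁ refl) (inj₂ e) = a≢d e
      apart u (inj₂ refl) (inj₁ e) = b≢c e
      apart u (inj₂ refl) (inj₂ e) = b≢d e
      conclude : (Horizontal s × Vertical t) ⊎ (Vertical s × Horizontal t) → ⊥
      conclude (inj₁ (h , v)) = kept-uncrossed {s = s} {t} {q} (kept-edge e∈) f∈ apart s∈ t∈ on on' h v
      conclude (inj₂ (v , h)) = kept-uncrossed {s = t} {s} {q} (kept-edge f∈) e∈ (λ u uf ue → apart u ue uf) t∈ s∈ on' on h v

  upper-bound : ∀ n (G : Graph n) → Is1BendApRAC G → length (edges G) ℕ.≤ 5 ℕ.* n ℕ.∸ 8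
  -- Below three vertices 3n - 6 is no bound and the cases are direct: the truncated difference is 0
  -- for n < 2, where there is no edge, and 2 for n = 2, where there is at most one.
  upper-bound zero G _ with edges G
  ... | []           = z≤n
  ... | (() , _) ∷ _
  upper-bound (suc zero) G _ with edges G | ordered G
  ... | []                | _       = z≤n
  ... | (zero , zero) ∷ _ | () ∷ _
  upper-bound (suc (suc zero)) G _ = at-most-one (edges G) (ordered G) (unique G)
    where
    only : ∀ (e : Fin 2 × Fin 2) → proj₁ e <ᶠ proj₂ e → e ≡ (zero , suc zero)
    only (zero , suc zero)     _ = refl
    only (suc zero , suc zero) (s≤s ())
    at-most-one : ∀ (L : List (Fin 2 × Fin 2)) → All (λ e → proj₁ e <ᶠ proj₂ e) L → Unique L → length L ℕ.≤ 2
    at-most-one []          _             _                 = z≤n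
    at-most-one (_ ∷ [])    _             _                 = s≤s z≤n
    at-most-one (e ∷ f ∷ _) (p ∷ q ∷ _) ((e≢f ∷ _) ∷ _) = contradiction (trans (only e p) (sym (only f q))) e≢f
  upper-bound (suc (suc (suc m))) G drawing = ℕₚ.m+n≤o⇒m≤o∸n (length (edges G)) (begin
    length (edges G) ℕ.+ 8              ≡⟨ cong (ℕ._+ 8) (length-filter-¬ removed? (edges G)) ⟩
    -- 8 = 2 + 6, from the two excepted ports and from 3n - 6.
    r ℕ.+ k ℕ.+ 8                       ≡⟨ solve 2 (λ r k → r :+ k :+ con 8 := (con 2 :+ r) :+ (k :+ con 6)) refl r k ⟩
    (2 ℕ.+ r) ℕ.+ (k ℕ.+ 6)             ≤⟨ ℕₚ.+-mono-≤ removed-bound kept-bound ⟩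
    n ℕ.* 2 ℕ.+ 3 ℕ.* n                 ≡⟨ solve 1 (λ n → n :* con 2 :+ con 3 :* n := con 5 :* n) refl n ⟩
    5 ℕ.* n                             ∎)
    where
    open Ports G drawing
    open OneBendApRAC drawing using (pos; pos-inj; bend)
    open ℕₚ.≤-Reasoning
    n = suc (suc (suc m))
    r = length removed
    k = length kept
    kept-ordered : All (λ e → proj₁ e <ᶠ proj₂ e) kept
    kept-ordered = Allₚ.filter⁺ (λ e → ¬? (removed? e)) (ordered G)
    kept-unique : Unique kept
    kept-unique = Uniqueₚ.filter⁺ (λ e → ¬? (removed? e)) (unique G)
    kept-bound : k ℕ.+ 6 ℕ.≤ 3 ℕ.* n
    kept-bound = ℕₚ.*-cancelˡ-≤ 2 (begin
      2 ℕ.* (k ℕ.+ 6)   ≡⟨ solve 1 (λ k → con 2 :* (k :+ con 6) := con 2 :* k :+ con 12) refl k ⟩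
      2 ℕ.* k ℕ.+ 12    ≤⟨ plane-edge-bound m kept kept-ordered kept-unique pos pos-inj bend kept-disjoint ⟩
      6 ℕ.* n           ≡⟨ solve 1 (λ n → con 6 :* n := con 2 :* (con 3 :* n)) refl n ⟩
      2 ℕ.* (3 ℕ.* n)   ∎)

-- The pieces of the lower bound drawing and their intersections.

module Pieces where

  open import Defs
  open import Data.Bool using (Bool; true; false; _∧_; _∨_)
  open import Data.Bool.ListAction using (all)
  open import Data.Empty using (⊥; ⊥-elim)
  open import Data.Integer using (+_; -[1+_])
  open import Data.List using (List; []; _∷_; cartesianProduct)
  open import Data.List.Membership.Propositional using (_∈_)
  open import Data.List.Membership.Propositional.Properties using (∈-cartesianProduct⁺)
  open import Data.List.Relation.Unary.Any using (here; there)
  open import Data.Maybe using (Maybe; just; nothing; is-just)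
  open import Data.Nat as ℕ using (ℕ; zero; suc)
  import Data.Nat.Properties as ℕₚ
  open import Data.Product using (_×_; _,_; proj₁; proj₂)
  open import Data.Rational
  open import Data.Rational.Properties
  open import Data.Rational.Solver using (module +-*-Solver)
  open import Data.Sum using (_⊎_; inj₁; inj₂)
  open import Function using (_∘_)
  open import Relation.Binary.Definitions using (tri<; tri≈; tri>)
  open import Relation.Binary.PropositionalEquality
  open import Relation.Nullary using (¬_; contradiction; does; yes; Dec)
  open import Relation.Nullary.Decidable using (from-yes)
  open import Algebra.Properties.Group +-0-group using (∙-cancelʳ)
  open ParityDrawings
  open Segments
  open +-*-Solver using (Polynomial; solve; _:=_; con; _:+_; _:*_; _:-_; :-_)


  -- What matters is strict decrease within (0, 1]: it orders the path along the diagonal and bounds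
  -- the coordinates of every kind of piece independently of the index.
  x : ℕ → ℚ
  x zero    = 1ℚ
  x (suc i) = ½ * x i

  0<x : ∀ i → 0ℚ < x i
  0<x zero    = from-yes (0ℚ <? 1ℚ)
  0<x (suc i) = 0<* (from-yes (0ℚ <? ½)) (0<x i)

  x-suc : ∀ i → x (suc i) < x i
  x-suc i = subst (½ * x i <_) (*-identityˡ (x i)) (*-monoˡ-<-pos (x i) {{positive (0<x i)}} (from-yes (½ <? 1ℚ)))

  x-decreasing : ∀ {i j} → i ℕ.< j → x j < x i
  x-decreasing {i} {suc j} (ℕ.s≤s i≤j) with ℕₚ.m≤n⇒m<n∨m≡n i≤j
  ... | inj₁ i<j  = <-trans (x-suc j) (x-decreasing i<j)
  ... | inj₂ refl = x-suc i

  x-antitone : ∀ {i j} → i ℕ.< j → x j ≤ x (suc i)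
  x-antitone {i} {j} i<j with ℕₚ.m≤n⇒m<n∨m≡n i<j
  ... | inj₁ si<j = <⇒≤ (x-decreasing si<j)
  ... | inj₂ refl = ≤-refl

  x≤1 : ∀ i → x i ≤ 1ℚ
  x≤1 zero    = ≤-refl
  x≤1 (suc i) = <⇒≤ (x-decreasing {0} {suc i} (ℕ.s≤s ℕ.z≤n))

  x-injective : ∀ {i j} → x i ≡ x j → i ≡ j
  x-injective {i} {j} e with ℕₚ.<-cmp i j
  ... | tri< i<j _ _ = contradiction (x-decreasing i<j) (<-irrefl (sym e))
  ... | tri≈ _ i≡j _ = i≡j
  ... | tri> _ _ j<i = contradiction (x-decreasing j<i) (<-irrefl e)

  x-consecutive : ∀ {i j} → x (suc j) ≤ x i → x i ≤ x j → i ≡ j ⊎ i ≡ suc j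
  x-consecutive {i} {j} lo hi with ℕₚ.<-cmp i j
  ... | tri< i<j _ _ = contradiction (<-≤-trans (x-decreasing i<j) hi) (<-irrefl refl)
  ... | tri≈ _ i≡j _ = inj₁ i≡j
  ... | tri> _ _ j<i with ℕₚ.m≤n⇒m<n∨m≡n j<i
  ...   | inj₁ sj<i = contradiction (<-≤-trans (x-decreasing sj<i) lo) (<-irrefl refl)
  ...   | inj₂ e    = inj₂ (sym e)

  intervals-touch : ∀ {i j q} → i ℕ.< j → x (suc i) ≤ q → q ≤ x j → q ≡ x (suc i) × suc i ≡ j
  intervals-touch {i} {j} i<j lo hi =
    ≤-antisym (≤-trans hi (x-antitone {i} {j} i<j)) lo ,
    x-injective {suc i} {j} (≤-antisym (≤-trans lo hi) (x-antitone {i} {j} i<j))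

  data Side : Set where
    N W S E : Side

  data Vertex : Set where
    apex : Side → Vertex
    inner    : ℕ → Vertex

  -- The coordinates of a piece with index i are constants, x i, or x (suc i).
  data Coord : Set where
    at    : ℚ → Coord
    𝑥 𝑥⁺ : Coord

  value : ℕ → Coord → ℚ
  value i (at r) = r
  value i 𝑥      = x i
  value i 𝑥⁺     = x (suc i)

  CPoint : Set
  CPoint = Coord × Coord

  valueₚ : ℕ → CPoint → Point
  valueₚ i (a , b) = value i a , value i b

  -3ℚ -2ℚ -1ℚ 2ℚ 3ℚ 4ℚ : ℚ
  -3ℚ = -[1+ 2 ] / 1
  -2ℚ = -[1+ 1 ] / 1
  -1ℚ = -[1+ 0 ] / 1
  2ℚ  = + 2 / 1
  3ℚ  = + 3 / 1
  4ℚ  = + 4 / 1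

  -- `N` and `S` lie to the left of `W`, so the three edges among them are straight and stay left of
  -- everything else; the edges from `N` and `S` to `E` turn at corners to the right of `E`. The
  -- bends lie outside the unit square of the inner vertices, such that the four fans have pairwise
  -- disjoint bounding boxes.
  apexₚ : Side → CPoint
  apexₚ N = at -3ℚ , at 3ℚ
  apexₚ W = at -2ℚ , at 0ℚ
  apexₚ S = at -3ℚ , at -2ℚ
  apexₚ E = at 3ℚ  , at 0ℚ

  bendₚ : Side → CPoint
  bendₚ N = 𝑥 , at 2ℚ
  bendₚ W = at -1ℚ , 𝑥
  bendₚ S = 𝑥 , at -1ℚ
  bendₚ E = at 2ℚ , 𝑥

  data Piece : Set where
    fan stem : Side → Piece
    path nw ns ws ne₁ ne₂ se₁ se₂ : Piece

  cornerN cornerS : CPoint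
  cornerN = at 4ℚ , at 3ℚ
  cornerS = at 4ℚ , at -2ℚ

  frame : Piece → CPoint × CPoint
  frame (fan D)  = apexₚ D , bendₚ D
  frame (stem D) = bendₚ D , (𝑥 , 𝑥)
  frame path     = (𝑥 , 𝑥) , (𝑥⁺ , 𝑥⁺)
  frame nw       = apexₚ N , apexₚ W
  frame ns       = apexₚ N , apexₚ S
  frame ws       = apexₚ W , apexₚ S
  frame ne₁      = apexₚ N , cornerN
  frame ne₂      = cornerN , apexₚ E
  frame se₁      = apexₚ S , cornerS
  frame se₂      = cornerS , apexₚ E

  segment : Piece → ℕ → Segment
  segment c i = valueₚ i (proj₁ (frame c)) , valueₚ i (proj₂ (frame c))

  ends : Piece → ℕ → Vertex × Vertex
  ends (fan D)  i = apex D , inner i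
  ends (stem D) i = apex D , inner i
  ends path     i = inner i , inner (suc i)
  ends nw       i = apex N , apex W
  ends ns       i = apex N , apex S
  ends ws       i = apex W , apex S
  ends ne₁      i = apex N , apex E
  ends ne₂      i = apex N , apex E
  ends se₁      i = apex S , apex E
  ends se₂      i = apex S , apex E

  minᶜ maxᶜ : Coord → ℚ
  minᶜ (at r) = r
  minᶜ _      = 0ℚ
  maxᶜ (at r) = r
  maxᶜ _      = 1ℚ

  minᶜ≤value : ∀ i a → minᶜ a ≤ value i a
  minᶜ≤value i (at r) = ≤-refl
  minᶜ≤value i 𝑥      = <⇒≤ (0<x i)
  minᶜ≤value i 𝑥⁺     = <⇒≤ (0<x (suc i))

  value≤maxᶜ : ∀ i a → value i a ≤ maxᶜ a
  value≤maxᶜ i (at r) = ≤-refl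
  value≤maxᶜ i 𝑥      = x≤1 i
  value≤maxᶜ i 𝑥⁺     = x≤1 (suc i)

  apart : Coord × Coord → Coord × Coord → Bool
  apart (a , b) (c , d) = does (maxᶜ a ⊔ maxᶜ b <? minᶜ c ⊓ minᶜ d) ∨ does (maxᶜ c ⊔ maxᶜ d <? minᶜ a ⊓ minᶜ b)

  does-sound : ∀ {X : Set} (X? : Dec X) → does X? ≡ true → X
  does-sound (yes p) _ = p

  ≤maxᶜ : ∀ a b i {q} → q ≤ value i a ⊔ value i b → q ≤ maxᶜ a ⊔ maxᶜ b
  ≤maxᶜ a b i hi = ≤-trans hi (⊔-mono-≤ (value≤maxᶜ i a) (value≤maxᶜ i b))

  minᶜ≤ : ∀ a b i {q} → value i a ⊓ value i b ≤ q → minᶜ a ⊓ minᶜ b ≤ q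
  minᶜ≤ a b i lo = ≤-trans (⊓-mono-≤ (minᶜ≤value i a) (minᶜ≤value i b)) lo

  apart-sound : ∀ s t {i j q} → apart s t ≡ true →
    value i (proj₁ s) ⊓ value i (proj₂ s) ≤ q → q ≤ value i (proj₁ s) ⊔ value i (proj₂ s) →
    value j (proj₁ t) ⊓ value j (proj₂ t) ≤ q → q ≤ value j (proj₁ t) ⊔ value j (proj₂ t) → ⊥
  apart-sound (a , b) (c , d) {i} {j} {q} e lo hi lo' hi' with ∨-split (does (maxᶜ a ⊔ maxᶜ b <? minᶜ c ⊓ minᶜ d)) e
  ... | inj₁ f = <-irrefl refl (≤-<-trans (≤maxᶜ a b i hi) (<-≤-trans (does-sound (_ <? _) f) (minᶜ≤ c d j lo')))
  ... | inj₂ f = <-irrefl refl (≤-<-trans (≤maxᶜ c d j hi') (<-≤-trans (does-sound (_ <? _) f) (minᶜ≤ a b i lo)))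

  xs ys : CPoint × CPoint → Coord × Coord
  xs ((a , _) , (b , _)) = a , b
  ys ((_ , a) , (_ , b)) = a , b

  separated : CPoint × CPoint → CPoint × CPoint → Bool
  separated s t = apart (xs s) (xs t) ∨ apart (ys s) (ys t)

  valueₛ : ℕ → CPoint × CPoint → Segment
  valueₛ i (a , b) = valueₚ i a , valueₚ i b

  separated-sound : ∀ s t {i j q} → separated s t ≡ true → OnSeg q (valueₛ i s) → OnSeg q (valueₛ j t) → ⊥
  separated-sound s t {i} {j} e (_ , x₁ , x₂ , y₁ , y₂) (_ , x₁' , x₂' , y₁' , y₂') with ∨-split (apart (xs s) (xs t)) e
  ... | inj₁ f = apart-sound (xs s) (xs t) {i} {j} f x₁ x₂ x₁' x₂'
  ... | inj₂ f = apart-sound (ys s) (ys t) {i} {j} f y₁ y₂ y₁' y₂'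

  pieces : List Piece
  pieces = fan N ∷ fan W ∷ fan S ∷ fan E ∷ stem N ∷ stem W ∷ stem S ∷ stem E ∷
           path ∷ nw ∷ ns ∷ ws ∷ ne₁ ∷ ne₂ ∷ se₁ ∷ se₂ ∷ []

  *-cancelˡ-≢0 : ∀ {k u v} → k ≢ 0ℚ → k * u ≡ k * v → u ≡ v
  *-cancelˡ-≢0 {k} {u} {v} k≢0 e = trans (sym (undo u)) (trans (cong ((1/ k) *_) e) (undo v))
    where
    instance
      k-nonZero : NonZero k
      k-nonZero = ≢-nonZero k≢0
    undo : ∀ w → (1/ k) * (k * w) ≡ w
    undo w = trans (sym (*-assoc (1/ k) k w)) (trans (cong (_* w) (*-inverseˡ k)) (*-identityˡ w))

  -- The two collinearity conditions are linear equations for `q - a` with determinant `κ`;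
  -- eliminating either unknown gives `κ` times a coordinate equal to 0.
  apex-only : ∀ {q a b c} → orient a b c ≢ 0ℚ → OnSeg q (a , b) → OnSeg q (a , c) → q ≡ a
  apex-only {qx , qy} {ax , ay} {bx , by} {cx , cy} κ≢0 (e , _) (f , _) =
    cong₂ _,_ (-‿injective (*-cancelˡ-≢0 κ≢0 (trans vanish-x (sym (*-zeroʳ κ)))))
              (-‿injective (*-cancelˡ-≢0 κ≢0 (trans vanish-y (sym (*-zeroʳ κ)))))
    where
    open ≡-Reasoning
    κ  = orient (ax , ay) (bx , by) (cx , cy)
    bu = bx - ax
    bv = by - ay
    cu = cx - ax
    cv = cy - ay
    u  = qx - ax
    v  = qy - ay
    vanish-x : (bu * cv - bv * cu) * u ≡ 0ℚ
    vanish-x = begin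
      (bu * cv - bv * cu) * u      ≡⟨ solve 5 (λ bu bv cu cv u → (bu :* cv :- bv :* cu) :* u := bu :* (cv :* u) :- cu :* (bv :* u)) refl bu bv cu cv u ⟩
      bu * (cv * u) - cu * (bv * u) ≡⟨ cong₂ (λ s t → bu * s - cu * t) f e ⟨
      bu * (cu * v) - cu * (bu * v) ≡⟨ solve 3 (λ bu cu v → bu :* (cu :* v) :- cu :* (bu :* v) := con 0ℚ) refl bu cu v ⟩
      0ℚ ∎
    vanish-y : (bu * cv - bv * cu) * v ≡ 0ℚ
    vanish-y = begin
      (bu * cv - bv * cu) * v       ≡⟨ solve 5 (λ bu bv cu cv v → (bu :* cv :- bv :* cu) :* v := cv :* (bu :* v) :- bv :* (cu :* v)) refl bu bv cu cv v ⟩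
      cv * (bu * v) - bv * (cu * v) ≡⟨ cong₂ (λ s t → cv * s - bv * t) e f ⟩
      cv * (bv * u) - bv * (cv * u) ≡⟨ solve 3 (λ cv bv u → cv :* (bv :* u) :- bv :* (cv :* u) := con 0ℚ) refl cv bv u ⟩
      0ℚ ∎

  end-at-level-y : ∀ {qx qy ax ay bx by} → by - ay ≢ 0ℚ → qy ≡ by →
                   OnSeg (qx , qy) ((ax , ay) , (bx , by)) → qx ≡ bx
  end-at-level-y {qx} {qy} {ax} {ay} {bx} {by} ne refl (e , _) =
    ∙-cancelʳ (- ax) qx bx (*-cancelˡ-≢0 ne (trans (sym e) (*-comm (bx - ax) (by - ay))))

  end-at-level-x : ∀ {qx qy ax ay bx by} → bx - ax ≢ 0ℚ → qx ≡ bx →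
                   OnSeg (qx , qy) ((ax , ay) , (bx , by)) → qy ≡ by
  end-at-level-x {qx} {qy} {ax} {ay} {bx} {by} ne refl (e , _) =
    ∙-cancelʳ (- ay) qy by (*-cancelˡ-≢0 ne (trans e (*-comm (by - ay) (bx - ax))))

  point : Vertex → Point
  point (apex D)  = valueₚ 0 (apexₚ D)
  point (inner i) = x i , x i

  EndOf : Vertex → Vertex × Vertex → Set
  EndOf v e = v ≡ proj₁ e ⊎ v ≡ proj₂ e

  -- The segments other than fans at an apex, listed once for each apex, so that contacts at an apex
  -- reduce to two non-parallel directions and `apex-only`.
  data Ray : Side → Piece → Set where
    ns-N : Ray N ns
    nw-N : Ray N nw
    ne-N : Ray N ne₁
    ns-S : Ray S ns
    ws-S : Ray S ws
    se-S : Ray S se₁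
    nw-W : Ray W nw
    ws-W : Ray W ws
    ne-E : Ray E ne₂
    se-E : Ray E se₂

  far : ∀ {D c} → Ray D c → Point
  far ns-N = valueₚ 0 (apexₚ S)
  far nw-N = valueₚ 0 (apexₚ W)
  far ne-N = valueₚ 0 cornerN
  far ns-S = valueₚ 0 (apexₚ N)
  far ws-S = valueₚ 0 (apexₚ W)
  far se-S = valueₚ 0 cornerS
  far nw-W = valueₚ 0 (apexₚ N)
  far ws-W = valueₚ 0 (apexₚ S)
  far ne-E = valueₚ 0 cornerN
  far se-E = valueₚ 0 cornerS

  ray-onSeg : ∀ {D c i q} (r : Ray D c) → OnSeg q (segment c i) → OnSeg q (point (apex D) , far r)
  ray-onSeg ns-N on = on
  ray-onSeg nw-N on = on
  ray-onSeg ne-N on = on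
  ray-onSeg {q = q} ns-S on = onSeg-swap {q} {point (apex N)} {point (apex S)} on
  ray-onSeg {q = q} ws-S on = onSeg-swap {q} {point (apex W)} {point (apex S)} on
  ray-onSeg se-S on = on
  ray-onSeg {q = q} nw-W on = onSeg-swap {q} {point (apex N)} {point (apex W)} on
  ray-onSeg ws-W on = on
  ray-onSeg {q = q} ne-E on = onSeg-swap {q} {valueₚ 0 cornerN} {point (apex E)} on
  ray-onSeg {q = q} se-E on = onSeg-swap {q} {valueₚ 0 cornerS} {point (apex E)} on

  ray-end : ∀ {D c} i → Ray D c → EndOf (apex D) (ends c i)
  ray-end i ns-N = inj₁ refl
  ray-end i nw-N = inj₁ refl
  ray-end i ne-N = inj₁ refl
  ray-end i ns-S = inj₂ refl
  ray-end i ws-S = inj₂ refl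
  ray-end i se-S = inj₁ refl
  ray-end i nw-W = inj₂ refl
  ray-end i ws-W = inj₁ refl
  ray-end i ne-E = inj₂ refl
  ray-end i se-E = inj₂ refl

  -- The pairs of pieces that are neither perpendicular nor have disjoint bounding boxes.
  data Residual : Piece → Piece → Set where
    same-ends : ∀ {c d} → (∀ i j → ends c i ≡ ends d j) → Residual c d
    stem-stem : ∀ D → Residual (stem D) (stem D)
    stem-NS   : Residual (stem N) (stem S)
    stem-WE   : Residual (stem W) (stem E)
    stem-fan  : ∀ D → Residual (stem D) (fan D)
    stem-path : ∀ D → Residual (stem D) path
    path-path : Residual path path
    fan-fan   : ∀ D → Residual (fan D) (fan D)
    fan-ray   : ∀ {D c} → Ray D c → Residual (fan D) c
    ray-ray   : ∀ {D c d} (r : Ray D c) (r' : Ray D d) → orient (point (apex D)) (far r) (far r') ≢ 0ℚ → Residual c d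

  -- Every unordered pair is listed in one order only, as `settled` asks for both. In the `ray-ray`
  -- entries the absurd pattern evaluates a constant nonzero determinant.
  residual? : ∀ c d → Maybe (Residual c d)
  residual? (stem N) (stem N) = just (stem-stem N)
  residual? (stem W) (stem W) = just (stem-stem W)
  residual? (stem S) (stem S) = just (stem-stem S)
  residual? (stem E) (stem E) = just (stem-stem E)
  residual? (stem N) (stem S) = just stem-NS
  residual? (stem W) (stem E) = just stem-WE
  residual? (stem N) (fan N)  = just (stem-fan N)
  residual? (stem W) (fan W)  = just (stem-fan W)
  residual? (stem S) (fan S)  = just (stem-fan S)
  residual? (stem E) (fan E)  = just (stem-fan E)
  residual? (stem D) path     = just (stem-path D)
  residual? path     path     = just path-path
  residual? (fan N)  (fan N)  = just (fan-fan N)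
  residual? (fan W)  (fan W)  = just (fan-fan W)
  residual? (fan S)  (fan S)  = just (fan-fan S)
  residual? (fan E)  (fan E)  = just (fan-fan E)
  residual? (fan N)  ns       = just (fan-ray ns-N)
  residual? (fan N)  nw       = just (fan-ray nw-N)
  residual? (fan N)  ne₁      = just (fan-ray ne-N)
  residual? (fan S)  ns       = just (fan-ray ns-S)
  residual? (fan S)  ws       = just (fan-ray ws-S)
  residual? (fan S)  se₁      = just (fan-ray se-S)
  residual? (fan W)  nw       = just (fan-ray nw-W)
  residual? (fan W)  ws       = just (fan-ray ws-W)
  residual? (fan E)  ne₂      = just (fan-ray ne-E)
  residual? (fan E)  se₂      = just (fan-ray se-E)
  residual? ns       nw       = just (ray-ray ns-N nw-N λ ())
  residual? nw       ne₁      = just (ray-ray nw-N ne-N λ ())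
  residual? ns       ws       = just (ray-ray ns-S ws-S λ ())
  residual? ws       se₁      = just (ray-ray ws-S se-S λ ())
  residual? nw       ws       = just (ray-ray nw-W ws-W λ ())
  residual? ne₂      se₂      = just (ray-ray ne-E se-E λ ())
  residual? nw       nw       = just (same-ends λ _ _ → refl)
  residual? ns       ns       = just (same-ends λ _ _ → refl)
  residual? ws       ws       = just (same-ends λ _ _ → refl)
  residual? ne₁      ne₁      = just (same-ends λ _ _ → refl)
  residual? ne₁      ne₂      = just (same-ends λ _ _ → refl)
  residual? ne₂      ne₂      = just (same-ends λ _ _ → refl)
  residual? se₁      se₁      = just (same-ends λ _ _ → refl)
  residual? se₁      se₂      = just (same-ends λ _ _ → refl)
  residual? se₂      se₂      = just (same-ends λ _ _ → refl)
  residual? _        _        = nothing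

  isH isV : Piece → Bool
  isH (stem W) = true
  isH (stem E) = true
  isH ne₁      = true
  isH se₁      = true
  isH _        = false
  isV (stem N) = true
  isV (stem S) = true
  isV ns       = true
  isV _        = false

  isH-sound : ∀ c i → isH c ≡ true → Horizontal (segment c i)
  isH-sound (stem W) i _ = refl
  isH-sound (stem E) i _ = refl
  isH-sound ne₁      i _ = refl
  isH-sound se₁      i _ = refl

  isV-sound : ∀ c i → isV c ≡ true → Vertical (segment c i)
  isV-sound (stem N) i _ = refl
  isV-sound (stem S) i _ = refl
  isV-sound ns       i _ = refl

  settled : Piece × Piece → Bool
  settled (c , d) = separated (frame c) (frame d) ∨ ((isH c ∧ isV d) ∨ ((isV c ∧ isH d) ∨
                    (is-just (residual? c d) ∨ is-just (residual? d c))))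

  all-sound : ∀ {X : Set} (f : X → Bool) {L y} → all f L ≡ true → y ∈ L → f y ≡ true
  all-sound f {y ∷ L} e (here refl) = ∧-left (f y) e
  all-sound f {y ∷ L} e (there y∈)  = all-sound f (∧-right (f y) e) y∈

  piece∈pieces : ∀ c → c ∈ pieces
  piece∈pieces (fan N)  = here refl
  piece∈pieces (fan W)  = there (here refl)
  piece∈pieces (fan S)  = there (there (here refl))
  piece∈pieces (fan E)  = there (there (there (here refl)))
  piece∈pieces (stem N) = there (there (there (there (here refl))))
  piece∈pieces (stem W) = there (there (there (there (there (here refl)))))
  piece∈pieces (stem S) = there (there (there (there (there (there (here refl))))))
  piece∈pieces (stem E) = there (there (there (there (there (there (there (here refl)))))))
  piece∈pieces path     = there (there (there (there (there (there (there (there (here refl))))))))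
  piece∈pieces nw       = there (there (there (there (there (there (there (there (there (here refl)))))))))
  piece∈pieces ns       = there (there (there (there (there (there (there (there (there (there (here refl))))))))))
  piece∈pieces ws       = there (there (there (there (there (there (there (there (there (there (there (here refl)))))))))))
  piece∈pieces ne₁      = there (there (there (there (there (there (there (there (there (there (there (there (here refl))))))))))))
  piece∈pieces ne₂      = there (there (there (there (there (there (there (there (there (there (there (there (there (here refl)))))))))))))
  piece∈pieces se₁      = there (there (there (there (there (there (there (there (there (there (there (there (there (there (here refl))))))))))))))
  piece∈pieces se₂      = there (there (there (there (there (there (there (there (there (there (there (there (there (there (there (here refl)))))))))))))))

  abstract
    -- `refl` evaluates the table of 16 · 16 pairs of kinds; `abstract` prevents it from being
    -- unfolded again.
    all-settled : ∀ c d → settled (c , d) ≡ true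
    all-settled c d = all-sound settled {cartesianProduct pieces pieces} refl
      (∈-cartesianProduct⁺ (piece∈pieces c) (piece∈pieces d))

  x≤2 : ∀ i → x i ≤ 2ℚ
  x≤2 i = ≤-trans (x≤1 i) (from-yes (1ℚ ≤? 2ℚ))

  -1≤x : ∀ i → -1ℚ ≤ x i
  -1≤x i = ≤-trans (from-yes (-1ℚ ≤? 0ℚ)) (<⇒≤ (0<x i))

  axis : Side → Point → ℚ
  axis N = proj₁
  axis S = proj₁
  axis W = proj₂
  axis E = proj₂

  stem-axis : ∀ D {i q} → OnSeg q (segment (stem D) i) → axis D q ≡ x i
  stem-axis N {i} {q} = vertical-onSeg {q} {valueₚ i (bendₚ N)} {x i , x i} refl
  stem-axis S {i} {q} = vertical-onSeg {q} {valueₚ i (bendₚ S)} {x i , x i} refl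
  stem-axis W {i} {q} = horizontal-onSeg {q} {valueₚ i (bendₚ W)} {x i , x i} refl
  stem-axis E {i} {q} = horizontal-onSeg {q} {valueₚ i (bendₚ E)} {x i , x i} refl

  -- The line through the bends at `D` separates stems from fans, so a common point lies on it,
  -- where a fan segment has only its bend.
  fan-axis : ∀ D {i j q} → OnSeg q (segment (stem D) i) → OnSeg q (segment (fan D) j) → axis D q ≡ x j
  fan-axis N {i} {j} {qx , qy} (_ , _ , _ , _ , hi) on@(_ , _ , _ , lo , _) =
    end-at-level-y {qx} {qy} { -3ℚ} {3ℚ} {x j} {2ℚ} (λ ()) (≤-antisym (subst (qy ≤_) (p≥q⇒p⊔q≡p (x≤2 i)) hi) lo) on
  fan-axis S {i} {j} {qx , qy} (_ , _ , _ , lo , _) on@(_ , _ , _ , _ , hi) =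
    end-at-level-y {qx} {qy} { -3ℚ} { -2ℚ} {x j} { -1ℚ} (λ ()) (≤-antisym hi (subst (_≤ qy) (p≤q⇒p⊓q≡p (-1≤x i)) lo)) on
  fan-axis W {i} {j} {qx , qy} (_ , lo , _) on@(_ , _ , hi , _) =
    end-at-level-x {qx} {qy} { -2ℚ} {0ℚ} { -1ℚ} {x j} (λ ()) (≤-antisym hi (subst (_≤ qx) (p≤q⇒p⊓q≡p (-1≤x i)) lo)) on
  fan-axis E {i} {j} {qx , qy} (_ , _ , hi , _) on@(_ , lo , _) =
    end-at-level-x {qx} {qy} {3ℚ} {0ℚ} {2ℚ} {x j} (λ ()) (≤-antisym (subst (qx ≤_) (p≥q⇒p⊔q≡p (x≤2 i)) hi) lo) on

  path-diagonal : ∀ {i qx qy} → OnSeg (qx , qy) (segment path i) → qy ≡ qx × x (suc i) ≤ qx × qx ≤ x i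
  path-diagonal {i} {qx} {qy} (e , lo , hi , _) =
    ∙-cancelʳ (- x i) qy qx (*-cancelˡ-≢0 distinct e) ,
    subst (_≤ qx) (p≥q⇒p⊓q≡q (<⇒≤ (x-suc i))) lo , subst (qx ≤_) (p≥q⇒p⊔q≡p (<⇒≤ (x-suc i))) hi
    where
    distinct : x (suc i) - x i ≢ 0ℚ
    distinct e = <-irrefl (-‿injective {x (suc i)} {x i} e) (x-suc i)

  on-diagonal : ∀ D {r q} → axis D q ≡ r → proj₂ q ≡ proj₁ q → q ≡ (r , r)
  on-diagonal N refl e = cong (_ ,_) e
  on-diagonal S refl e = cong (_ ,_) e
  on-diagonal W refl e = cong (_, _) (sym e)
  on-diagonal E refl e = cong (_, _) (sym e)

  positive-affine≢0 : ∀ {a b t} → 0ℚ < a → 0ℚ ≤ b → 0ℚ ≤ t → a + b * t ≢ 0ℚ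
  positive-affine≢0 0<a 0≤b 0≤t e = <-irrefl (sym e) (+-mono-<-≤ 0<a (0≤* 0≤b 0≤t))

  negative-affine≢0 : ∀ {a b t} → 0ℚ < a → 0ℚ ≤ b → 0ℚ ≤ t → - (a + b * t) ≢ 0ℚ
  negative-affine≢0 {a} {b} {t} p q r e = positive-affine≢0 p q r (trans (sym (neg-involutive (a + b * t))) (cong -_ e))
    where neg-involutive : ∀ r → - - r ≡ r
          neg-involutive = solve 1 (λ r → :- (:- r) := r) refl

  fan-onSeg : ∀ D i q → OnSeg q (segment (fan D) i) → OnSeg q (point (apex D) , valueₚ i (bendₚ D))
  fan-onSeg N i q on = on
  fan-onSeg W i q on = on
  fan-onSeg S i q on = on
  fan-onSeg E i q on = on

  ≡-≢0 : ∀ {p q} → p ≡ q → q ≢ 0ℚ → p ≢ 0ℚ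
  ≡-≢0 refl q≢0 = q≢0

  0≤1-x : ∀ i → 0ℚ ≤ 1ℚ - x i
  0≤1-x i = ≤⇒0≤- (x≤1 i)

  orientᵖ : ∀ {k} (ax ay bx by cx cy : Polynomial k) → Polynomial k
  orientᵖ ax ay bx by cx cy = (bx :- ax) :* (cy :- ay) :- (by :- ay) :* (cx :- ax)

  -- Every determinant is affine in `x i` with constant sign on [0, 1]. It is written so that the
  -- sign is visible, for `ws-W` and `se-E` in terms of `1 - x i`.
  fan-ray-skew : ∀ {D c} (r : Ray D c) i → orient (point (apex D)) (valueₚ i (bendₚ D)) (far r) ≢ 0ℚ
  fan-ray-skew ns-N i = ≡-≢0 (solve 1 (λ t → orientᵖ (con -3ℚ) (con 3ℚ) t (con 2ℚ) (con -3ℚ) (con -2ℚ) := :- (con (+ 15 / 1) :+ con (+ 5 / 1) :* t)) refl (x i))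
    (negative-affine≢0 (from-yes (0ℚ <? (+ 15 / 1))) (from-yes (0ℚ ≤? (+ 5 / 1))) (<⇒≤ (0<x i)))
  fan-ray-skew nw-N i = ≡-≢0 (solve 1 (λ t → orientᵖ (con -3ℚ) (con 3ℚ) t (con 2ℚ) (con -2ℚ) (con 0ℚ) := :- (con (+ 8 / 1) :+ con (+ 3 / 1) :* t)) refl (x i))
    (negative-affine≢0 (from-yes (0ℚ <? (+ 8 / 1))) (from-yes (0ℚ ≤? (+ 3 / 1))) (<⇒≤ (0<x i)))
  fan-ray-skew ne-N i = ≡-≢0 (solve 1 (λ t → orientᵖ (con -3ℚ) (con 3ℚ) t (con 2ℚ) (con 4ℚ) (con 3ℚ) := con (+ 7 / 1) :+ con 0ℚ :* t) refl (x i))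
    (positive-affine≢0 (from-yes (0ℚ <? (+ 7 / 1))) (from-yes (0ℚ ≤? 0ℚ)) (<⇒≤ (0<x i)))
  fan-ray-skew ns-S i = ≡-≢0 (solve 1 (λ t → orientᵖ (con -3ℚ) (con -2ℚ) t (con -1ℚ) (con -3ℚ) (con 3ℚ) := con (+ 15 / 1) :+ con (+ 5 / 1) :* t) refl (x i))
    (positive-affine≢0 (from-yes (0ℚ <? (+ 15 / 1))) (from-yes (0ℚ ≤? (+ 5 / 1))) (<⇒≤ (0<x i)))
  fan-ray-skew ws-S i = ≡-≢0 (solve 1 (λ t → orientᵖ (con -3ℚ) (con -2ℚ) t (con -1ℚ) (con -2ℚ) (con 0ℚ) := con (+ 5 / 1) :+ con (+ 2 / 1) :* t) refl (x i))
    (positive-affine≢0 (from-yes (0ℚ <? (+ 5 / 1))) (from-yes (0ℚ ≤? (+ 2 / 1))) (<⇒≤ (0<x i)))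
  fan-ray-skew se-S i = ≡-≢0 (solve 1 (λ t → orientᵖ (con -3ℚ) (con -2ℚ) t (con -1ℚ) (con 4ℚ) (con -2ℚ) := :- (con (+ 7 / 1) :+ con 0ℚ :* t)) refl (x i))
    (negative-affine≢0 (from-yes (0ℚ <? (+ 7 / 1))) (from-yes (0ℚ ≤? 0ℚ)) (<⇒≤ (0<x i)))
  fan-ray-skew nw-W i = ≡-≢0 (solve 1 (λ t → orientᵖ (con -2ℚ) (con 0ℚ) (con -1ℚ) t (con -3ℚ) (con 3ℚ) := con (+ 3 / 1) :+ con (+ 1 / 1) :* t) refl (x i))
    (positive-affine≢0 (from-yes (0ℚ <? (+ 3 / 1))) (from-yes (0ℚ ≤? (+ 1 / 1))) (<⇒≤ (0<x i)))
  fan-ray-skew ws-W i = ≡-≢0 (solve 1 (λ t → orientᵖ (con -2ℚ) (con 0ℚ) (con -1ℚ) t (con -3ℚ) (con -2ℚ) := :- (con (+ 1 / 1) :+ con (+ 1 / 1) :* (con 1ℚ :- t))) refl (x i))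
    (negative-affine≢0 (from-yes (0ℚ <? (+ 1 / 1))) (from-yes (0ℚ ≤? (+ 1 / 1))) (0≤1-x i))
  fan-ray-skew ne-E i = ≡-≢0 (solve 1 (λ t → orientᵖ (con 3ℚ) (con 0ℚ) (con 2ℚ) t (con 4ℚ) (con 3ℚ) := :- (con (+ 3 / 1) :+ con (+ 1 / 1) :* t)) refl (x i))
    (negative-affine≢0 (from-yes (0ℚ <? (+ 3 / 1))) (from-yes (0ℚ ≤? (+ 1 / 1))) (<⇒≤ (0<x i)))
  fan-ray-skew se-E i = ≡-≢0 (solve 1 (λ t → orientᵖ (con 3ℚ) (con 0ℚ) (con 2ℚ) t (con 4ℚ) (con -2ℚ) := con (+ 1 / 1) :+ con (+ 1 / 1) :* (con 1ℚ :- t)) refl (x i))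
    (positive-affine≢0 (from-yes (0ℚ <? (+ 1 / 1))) (from-yes (0ℚ ≤? (+ 1 / 1))) (0≤1-x i))

  fan-fan-skew : ∀ D {i j} → i ≢ j → orient (point (apex D)) (valueₚ i (bendₚ D)) (valueₚ j (bendₚ D)) ≢ 0ℚ
  fan-fan-skew N {i} {j} i≢j = ≡-≢0 (solve 2 (λ t s → orientᵖ (con -3ℚ) (con 3ℚ) t (con 2ℚ) s (con 2ℚ) := s :- t) refl (x i) (x j))
    (i≢j ∘ sym ∘ x-injective {j} {i} ∘ -‿injective)
  fan-fan-skew W {i} {j} i≢j = ≡-≢0 (solve 2 (λ t s → orientᵖ (con -2ℚ) (con 0ℚ) (con -1ℚ) t (con -1ℚ) s := s :- t) refl (x i) (x j))
    (i≢j ∘ sym ∘ x-injective {j} {i} ∘ -‿injective)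
  fan-fan-skew S {i} {j} i≢j = ≡-≢0 (solve 2 (λ t s → orientᵖ (con -3ℚ) (con -2ℚ) t (con -1ℚ) s (con -1ℚ) := t :- s) refl (x i) (x j))
    (i≢j ∘ x-injective {i} {j} ∘ -‿injective)
  fan-fan-skew E {i} {j} i≢j = ≡-≢0 (solve 2 (λ t s → orientᵖ (con 3ℚ) (con 0ℚ) (con 2ℚ) t (con 2ℚ) s := t :- s) refl (x i) (x j))
    (i≢j ∘ x-injective {i} {j} ∘ -‿injective)

  SharedAvoided : Point → Vertex × Vertex → Vertex × Vertex → Set
  SharedAvoided q e f = ∀ v → EndOf v e → EndOf v f → q ≢ point v

  -- A contact of such pieces forces their ends to agree, or else happens at a common end-vertex,
  -- which `SharedAvoided` excludes.
  residual-disjoint : ∀ {c d} → Residual c d → ∀ i j q → ends c i ≢ ends d j →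
    OnSeg q (segment c i) → OnSeg q (segment d j) → ¬ SharedAvoided q (ends c i) (ends d j)
  residual-disjoint (same-ends same) i j q ne on on' _ = ne (same i j)
  residual-disjoint (stem-stem D) i j q ne on on' _ =
    ne (cong (λ k → apex D , inner k) (x-injective {i} {j} (trans (sym (stem-axis D {i} {q} on)) (stem-axis D {j} {q} on'))))
  residual-disjoint (stem-fan D) i j q ne on on' _ =
    ne (cong (λ k → apex D , inner k) (x-injective {i} {j} (trans (sym (stem-axis D {i} {q} on)) (fan-axis D {i} {j} {q} on on'))))
  -- Equal abscissas give `i ≡ j`; one stem stays above the inner vertex and the other below, so
  -- they meet only there. `stem-WE` is the same sideways.
  residual-disjoint stem-NS i j (qx , qy) ne on@(_ , _ , _ , lo , _) on'@(_ , _ , _ , _ , hi) avoided =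
    avoided (inner i) (inj₂ refl) (inj₂ (cong inner i≡j)) (cong₂ _,_ (stem-axis N {i} {qx , qy} on)
      (≤-antisym (subst (λ k → qy ≤ x k) (sym i≡j) (subst (qy ≤_) (p≤q⇒p⊔q≡q (-1≤x j)) hi))
                 (subst (_≤ qy) (p≥q⇒p⊓q≡q (x≤2 i)) lo)))
    where
    i≡j : i ≡ j
    i≡j = x-injective {i} {j} (trans (sym (stem-axis N {i} {qx , qy} on)) (stem-axis S {j} {qx , qy} on'))
  residual-disjoint stem-WE i j (qx , qy) ne on@(_ , _ , hi , _) on'@(_ , lo , _) avoided =
    avoided (inner i) (inj₂ refl) (inj₂ (cong inner i≡j)) (cong₂ _,_
      (≤-antisym (subst (qx ≤_) (p≤q⇒p⊔q≡q (-1≤x i)) hi)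
                 (subst (λ k → x k ≤ qx) (sym i≡j) (subst (_≤ qx) (p≥q⇒p⊓q≡q (x≤2 j)) lo)))
      (stem-axis W {i} {qx , qy} on))
    where
    i≡j : i ≡ j
    i≡j = x-injective {i} {j} (trans (sym (stem-axis W {i} {qx , qy} on)) (stem-axis E {j} {qx , qy} on'))
  residual-disjoint (stem-path D) i j q ne on on' avoided =
    avoided (inner i) (inj₂ refl) (end (x-consecutive {i} {j}
      (subst (x (suc j) ≤_) (cong proj₁ q≡) (proj₁ (proj₂ diagonal))) (subst (_≤ x j) (cong proj₁ q≡) (proj₂ (proj₂ diagonal))))) q≡
    where
    diagonal : proj₂ q ≡ proj₁ q × x (suc j) ≤ proj₁ q × proj₁ q ≤ x j
    diagonal = path-diagonal {j} {proj₁ q} {proj₂ q} on'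
    q≡ : q ≡ (x i , x i)
    q≡ = on-diagonal D {x i} {q} (stem-axis D {i} {q} on) (proj₁ diagonal)
    end : i ≡ j ⊎ i ≡ suc j → EndOf (inner i) (ends path j)
    end (inj₁ e) = inj₁ (cong inner e)
    end (inj₂ e) = inj₂ (cong inner e)
  residual-disjoint path-path i j (qx , qy) ne on on' avoided = by-order (ℕₚ.<-cmp i j)
    where
    diagonal  = path-diagonal {i} {qx} {qy} on
    diagonal' = path-diagonal {j} {qx} {qy} on'
    by-order : _ → ⊥
    by-order (tri≈ _ i≡j _) = ne (cong (ends path) i≡j)
    by-order (tri< i<j _ _) = avoided (inner (suc i)) (inj₂ refl) (inj₁ (cong inner (proj₂ touch)))
        (cong₂ _,_ (proj₁ touch) (trans (proj₁ diagonal) (proj₁ touch)))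
      where touch = intervals-touch {i} {j} i<j (proj₁ (proj₂ diagonal)) (proj₂ (proj₂ diagonal'))
    by-order (tri> _ _ j<i) = avoided (inner (suc j)) (inj₁ (cong inner (proj₂ touch))) (inj₂ refl)
        (cong₂ _,_ (proj₁ touch) (trans (proj₁ diagonal) (proj₁ touch)))
      where touch = intervals-touch {j} {i} j<i (proj₁ (proj₂ diagonal')) (proj₂ (proj₂ diagonal))
  residual-disjoint (fan-fan D) i j q ne on on' avoided = avoided (apex D) (inj₁ refl) (inj₁ refl)
    (apex-only {q} {point (apex D)} {valueₚ i (bendₚ D)} {valueₚ j (bendₚ D)}
      (fan-fan-skew D (ne ∘ cong (λ k → apex D , inner k))) (fan-onSeg D i q on) (fan-onSeg D j q on'))
  residual-disjoint (fan-ray {D} r) i j q ne on on' avoided = avoided (apex D) (inj₁ refl) (ray-end j r)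
    (apex-only {q} {point (apex D)} {valueₚ i (bendₚ D)} {far r}
      (fan-ray-skew r i) (fan-onSeg D i q on) (ray-onSeg {i = j} {q} r on'))
  residual-disjoint (ray-ray {D} r r' skew) i j q ne on on' avoided = avoided (apex D) (ray-end i r) (ray-end j r')
    (apex-only {q} {point (apex D)} {far r} {far r'} skew (ray-onSeg {i = i} {q} r on) (ray-onSeg {i = j} {q} r' on'))

  Perpendicular : Segment → Segment → Set
  Perpendicular s t = (Horizontal s × Vertical t) ⊎ (Vertical s × Horizontal t)

  is-just-sound : ∀ {X : Set} (m : Maybe X) → is-just m ≡ true → X
  is-just-sound (just p) _ = p

  pieces-cross : ∀ c d i j q → ends c i ≢ ends d j → OnSeg q (segment c i) → OnSeg q (segment d j) →
    SharedAvoided q (ends c i) (ends d j) → Perpendicular (segment c i) (segment d j)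
  pieces-cross c d i j q ne on on' avoided = step₁ (∨-split (separated (frame c) (frame d)) (all-settled c d))
    where
    Goal = Perpendicular (segment c i) (segment d j)
    step₄ : is-just (residual? c d) ≡ true ⊎ is-just (residual? d c) ≡ true → Goal
    step₄ (inj₁ r) = ⊥-elim (residual-disjoint (is-just-sound (residual? c d) r) i j q ne on on' avoided)
    step₄ (inj₂ r) = ⊥-elim (residual-disjoint (is-just-sound (residual? d c) r) j i q (ne ∘ sym) on' on
                       (λ v v∈ v∈' → avoided v v∈' v∈))
    step₃ : isV c ∧ isH d ≡ true ⊎ is-just (residual? c d) ∨ is-just (residual? d c) ≡ true → Goal
    step₃ (inj₁ vh) = inj₂ (isV-sound c i (∧-left (isV c) vh) , isH-sound d j (∧-right (isV c) vh))
    step₃ (inj₂ e)  = step₄ (∨-split (is-just (residual? c d)) e)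
    step₂ : isH c ∧ isV d ≡ true ⊎
            (isV c ∧ isH d) ∨ (is-just (residual? c d) ∨ is-just (residual? d c)) ≡ true → Goal
    step₂ (inj₁ hv) = inj₁ (isH-sound c i (∧-left (isH c) hv) , isV-sound d j (∧-right (isH c) hv))
    step₂ (inj₂ e)  = step₃ (∨-split (isV c ∧ isH d) e)
    step₁ : separated (frame c) (frame d) ≡ true ⊎
            (isH c ∧ isV d) ∨ ((isV c ∧ isH d) ∨ (is-just (residual? c d) ∨ is-just (residual? d c))) ≡ true → Goal
    step₁ (inj₁ sep) = ⊥-elim (separated-sound (frame c) (frame d) {i} {j} {q} sep on on')
    step₁ (inj₂ e)   = step₂ (∨-split (isH c ∧ isV d) e)

-- The graphs with 5n - 16 edges and their drawings.

module Family where

  open import Defs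
  open import Data.Bool using (Bool; true; _∨_; if_then_else_)
  open import Data.Empty using (⊥-elim)
  open import Data.Fin using (Fin; suc; toℕ; inject₁) renaming (_<_ to _<ᶠ_)
  open import Data.Fin.Patterns using (0F; 1F; 2F; 3F)
  import Data.Fin.Properties as Finₚ
  open import Data.List using (List; []; _∷_; _++_; length; tabulate; map; cartesianProduct)
  open import Data.List.Membership.Propositional using (_∈_)
  open import Data.List.Membership.Propositional.Properties using (∈-cartesianProduct⁺; ∈-cartesianProduct⁻; ∈-tabulate⁻; ∈-++⁻)
  open import Data.List.Properties using (length-++; length-map; length-tabulate)
  open import Data.List.Relation.Binary.Disjoint.Propositional using (Disjoint)
  open import Data.List.Relation.Unary.All as All using (All; []; _∷_)
  open import Data.List.Relation.Unary.AllPairs using ([]; _∷_)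
  open import Data.List.Relation.Unary.Any using (here; there)
  open import Data.List.Relation.Unary.Unique.Propositional using (Unique)
  import Data.List.Relation.Unary.Unique.Propositional.Properties as Uniqueₚ
  open import Data.Maybe using (Maybe; just; nothing; is-just)
  open import Data.Nat as ℕ using (ℕ; zero; suc; z≤n; s≤s)
  import Data.Nat.Properties as ℕₚ
  open import Data.Nat.Solver using (module +-*-Solver)
  open import Data.Product using (∃; _×_; _,_; proj₁; proj₂)
  open import Data.Rational using (0ℚ; 1ℚ; _≤_; _<_; _<?_; _≤?_)
  open import Data.Rational.Properties
  open import Data.Sum using (_⊎_; inj₁; inj₂)
  open import Function using (_∘_)
  open import Relation.Binary.PropositionalEquality
  open import Relation.Nullary using (¬_; contradiction; does)
  open import Relation.Nullary.Decidable using (from-no)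
  open ParityDrawings
  open Segments using (onSeg-start)
  open Pieces
  open +-*-Solver using (solve; _:=_; con; _:+_; _:*_)

  apex-touches : ∀ D c → Maybe (∀ i → EndOf (apex D) (ends c i))
  apex-touches N (fan N) = just λ _ → inj₁ refl
  apex-touches W (fan W) = just λ _ → inj₁ refl
  apex-touches S (fan S) = just λ _ → inj₁ refl
  apex-touches E (fan E) = just λ _ → inj₁ refl
  apex-touches N ns      = just λ i → ray-end i ns-N
  apex-touches N nw      = just λ i → ray-end i nw-N
  apex-touches N ne₁     = just λ i → ray-end i ne-N
  apex-touches S ns      = just λ i → ray-end i ns-S
  apex-touches S ws      = just λ i → ray-end i ws-S
  apex-touches S se₁     = just λ i → ray-end i se-S
  apex-touches W nw      = just λ i → ray-end i nw-W
  apex-touches W ws      = just λ i → ray-end i ws-W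
  apex-touches E ne₂     = just λ i → ray-end i ne-E
  apex-touches E se₂     = just λ i → ray-end i se-E
  apex-touches _ _       = nothing

  -- The apex enters as a degenerate segment, which makes the bounding box test for pieces
  -- applicable to vertices.
  apex-settled : Side × Piece → Bool
  apex-settled (D , c) = separated (apexₚ D , apexₚ D) (frame c) ∨ is-just (apex-touches D c)

  sides : List Side
  sides = N ∷ W ∷ S ∷ E ∷ []

  side∈sides : ∀ D → D ∈ sides
  side∈sides N = here refl
  side∈sides W = there (here refl)
  side∈sides S = there (there (here refl))
  side∈sides E = there (there (there (here refl)))

  abstract
    all-apex-settled : ∀ D c → apex-settled (D , c) ≡ true
    all-apex-settled D c = all-sound apex-settled {cartesianProduct sides pieces} refl
      (∈-cartesianProduct⁺ (side∈sides D) (piece∈pieces c))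

  apex-clear : ∀ D c i → OnSeg (point (apex D)) (segment c i) → EndOf (apex D) (ends c i)
  apex-clear D c i on = by-table (∨-split (separated (apexₚ D , apexₚ D) (frame c)) (all-apex-settled D c))
    where
    by-table : separated (apexₚ D , apexₚ D) (frame c) ≡ true ⊎ is-just (apex-touches D c) ≡ true →
               EndOf (apex D) (ends c i)
    by-table (inj₁ sep) = ⊥-elim (separated-sound (apexₚ D , apexₚ D) (frame c) {0} {i} {point (apex D)}
                            sep (onSeg-start (point (apex D)) (point (apex D))) on)
    by-table (inj₂ t)   = is-just-sound (apex-touches D c) t i

  inner-separated : ∀ c {w i} → separated ((𝑥 , 𝑥) , (𝑥 , 𝑥)) (frame c) ≡ true → ¬ OnSeg (x w , x w) (segment c i)
  inner-separated c {w} {i} sep on =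
    separated-sound ((𝑥 , 𝑥) , (𝑥 , 𝑥)) (frame c) {w} {i} {x w , x w} sep (onSeg-start (x w , x w) (x w , x w)) on

  axis-diagonal : ∀ D r → axis D (r , r) ≡ r
  axis-diagonal N r = refl
  axis-diagonal W r = refl
  axis-diagonal S r = refl
  axis-diagonal E r = refl

  inner-clear : ∀ w c i → OnSeg (x w , x w) (segment c i) → EndOf (inner w) (ends c i)
  inner-clear w (stem D) i on = inj₂ (cong inner (x-injective {w} {i}
    (trans (sym (axis-diagonal D (x w))) (stem-axis D {i} {x w , x w} on))))
  inner-clear w path i on = end (x-consecutive {w} {i} (proj₁ (proj₂ diagonal)) (proj₂ (proj₂ diagonal)))
    where
    diagonal = path-diagonal {i} {x w} {x w} on
    end : w ≡ i ⊎ w ≡ suc i → EndOf (inner w) (ends path i)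
    end (inj₁ e) = inj₁ (cong inner e)
    end (inj₂ e) = inj₂ (cong inner e)
  inner-clear w (fan N) i on = ⊥-elim (inner-separated (fan N) {w} {i} refl on)
  inner-clear w (fan W) i on = ⊥-elim (inner-separated (fan W) {w} {i} refl on)
  inner-clear w (fan S) i on = ⊥-elim (inner-separated (fan S) {w} {i} refl on)
  inner-clear w (fan E) i on = ⊥-elim (inner-separated (fan E) {w} {i} refl on)
  inner-clear w nw  i on = ⊥-elim (inner-separated nw  {w} {i} refl on)
  inner-clear w ns  i on = ⊥-elim (inner-separated ns  {w} {i} refl on)
  inner-clear w ws  i on = ⊥-elim (inner-separated ws  {w} {i} refl on)
  inner-clear w ne₁ i on = ⊥-elim (inner-separated ne₁ {w} {i} refl on)
  inner-clear w ne₂ i on = ⊥-elim (inner-separated ne₂ {w} {i} refl on)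
  inner-clear w se₁ i on = ⊥-elim (inner-separated se₁ {w} {i} refl on)
  inner-clear w se₂ i on = ⊥-elim (inner-separated se₂ {w} {i} refl on)

  vertex-clear : ∀ v c i → OnSeg (point v) (segment c i) → EndOf v (ends c i)
  vertex-clear (apex D)  = apex-clear D
  vertex-clear (inner w) = inner-clear w

  x-range : ∀ {r} i → r ≡ x i → 0ℚ < r × r ≤ 1ℚ
  x-range i refl = 0<x i , x≤1 i

  apex≢inner : ∀ D i → point (apex D) ≢ point (inner i)
  apex≢inner N i e = from-no (0ℚ <? -3ℚ) (proj₁ (x-range i (cong proj₁ e)))
  apex≢inner W i e = from-no (0ℚ <? -2ℚ) (proj₁ (x-range i (cong proj₁ e)))
  apex≢inner S i e = from-no (0ℚ <? -3ℚ) (proj₁ (x-range i (cong proj₁ e)))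
  apex≢inner E i e = from-no (3ℚ ≤? 1ℚ) (proj₂ (x-range i (cong proj₁ e)))

  -- A left inverse of `point` on the apices, so that their distinctness takes four evaluations
  -- instead of a comparison of all pairs.
  sideOf : Point → Side
  sideOf (a , b) = if does (a ≟ -2ℚ) then W else if does (a ≟ 3ℚ) then E else if does (b ≟ 3ℚ) then N else S

  sideOf-apex : ∀ D → sideOf (point (apex D)) ≡ D
  sideOf-apex N = refl
  sideOf-apex W = refl
  sideOf-apex S = refl
  sideOf-apex E = refl

  point-injective : ∀ v w → point v ≡ point w → v ≡ w
  point-injective (apex D)  (apex D')  e = cong apex (trans (sym (sideOf-apex D)) (trans (cong sideOf e) (sideOf-apex D')))
  point-injective (apex D)  (inner j)  e = contradiction e (apex≢inner D j)
  point-injective (inner i) (apex D')  e = contradiction (sym e) (apex≢inner D' i)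
  point-injective (inner i) (inner j)  e = cong inner (x-injective {i} {j} (cong proj₁ e))

  bendOf : Vertex → Vertex → Maybe Point
  bendOf (apex N) (apex E)  = just (valueₚ 0 cornerN)
  bendOf (apex S) (apex E)  = just (valueₚ 0 cornerS)
  bendOf (apex D) (inner i) = just (valueₚ i (bendₚ D))
  bendOf _        _         = nothing

  data IsEdge : Vertex × Vertex → Set where
    nw    : IsEdge (apex N , apex W)
    ns    : IsEdge (apex N , apex S)
    ne    : IsEdge (apex N , apex E)
    ws    : IsEdge (apex W , apex S)
    se    : IsEdge (apex S , apex E)
    spoke : ∀ D i → IsEdge (apex D , inner i)
    link  : ∀ i → IsEdge (inner i , inner (suc i))

  bend≢apex : ∀ D i → valueₚ i (bendₚ D) ≢ point (apex D)
  bend≢apex N i e = contradiction (cong proj₂ e) λ ()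
  bend≢apex W i e = contradiction (cong proj₁ e) λ ()
  bend≢apex S i e = contradiction (cong proj₂ e) λ ()
  bend≢apex E i e = contradiction (cong proj₁ e) λ ()

  bend≢inner : ∀ D i → valueₚ i (bendₚ D) ≢ point (inner i)
  bend≢inner N i e = from-no (2ℚ ≤? 1ℚ) (proj₂ (x-range i (cong proj₂ e)))
  bend≢inner W i e = from-no (0ℚ <? -1ℚ) (proj₁ (x-range i (cong proj₁ e)))
  bend≢inner S i e = from-no (0ℚ <? -1ℚ) (proj₁ (x-range i (cong proj₂ e)))
  bend≢inner E i e = from-no (2ℚ ≤? 1ℚ) (proj₂ (x-range i (cong proj₁ e)))

  bend-proper : ∀ {u v b} → IsEdge (u , v) → bendOf u v ≡ just b → b ≢ point u × b ≢ point v
  bend-proper ne refl = (λ ()) , (λ ())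
  bend-proper se refl = (λ ()) , (λ ())
  bend-proper (spoke N i) refl = bend≢apex N i , bend≢inner N i
  bend-proper (spoke W i) refl = bend≢apex W i , bend≢inner W i
  bend-proper (spoke S i) refl = bend≢apex S i , bend≢inner S i
  bend-proper (spoke E i) refl = bend≢apex E i , bend≢inner E i

  PieceOf : Vertex × Vertex → Segment → Set
  PieceOf e s = ∃ λ c → ∃ λ i → s ≡ segment c i × ends c i ≡ e

  segment-piece : ∀ {u v s} → IsEdge (u , v) → s ∈ segments (point u) (point v) (bendOf u v) → PieceOf (u , v) s
  -- Pieces between apices do not depend on the index, and 0 serves as a dummy.
  segment-piece nw (here refl) = nw , 0 , refl , refl
  segment-piece ns (here refl) = ns , 0 , refl , refl
  segment-piece ws (here refl) = ws , 0 , refl , refl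
  segment-piece ne (here refl)         = ne₁ , 0 , refl , refl
  segment-piece ne (there (here refl)) = ne₂ , 0 , refl , refl
  segment-piece se (here refl)         = se₁ , 0 , refl , refl
  segment-piece se (there (here refl)) = se₂ , 0 , refl , refl
  segment-piece (link i) (here refl)   = path , i , refl , refl
  segment-piece (spoke N i) (here refl)         = fan N , i , refl , refl
  segment-piece (spoke N i) (there (here refl)) = stem N , i , refl , refl
  segment-piece (spoke W i) (here refl)         = fan W , i , refl , refl
  segment-piece (spoke W i) (there (here refl)) = stem W , i , refl , refl
  segment-piece (spoke S i) (here refl)         = fan S , i , refl , refl
  segment-piece (spoke S i) (there (here refl)) = stem S , i , refl , refl
  segment-piece (spoke E i) (here refl)         = fan E , i , refl , refl
  segment-piece (spoke E i) (there (here refl)) = stem E , i , refl , refl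

  length-cartesianProduct : ∀ {X Y : Set} (l : List X) (m : List Y) →
                            length (cartesianProduct l m) ≡ length l ℕ.* length m
  length-cartesianProduct []      m = refl
  length-cartesianProduct (a ∷ l) m = trans (length-++ (map (a ,_) m))
    (cong₂ ℕ._+_ (length-map (a ,_) m) (length-cartesianProduct l m))

  module Member (k : ℕ) where

    -- Four apices and `k + 1` inner vertices, which leaves exactly `k` links between consecutive
    -- inner vertices.
    Vtx : Set
    Vtx = Fin (5 ℕ.+ k)

    vertex : Vtx → Vertex
    vertex 0F = apex N
    vertex 1F = apex W
    vertex 2F = apex S
    vertex 3F = apex E
    vertex (suc (suc (suc (suc i)))) = inner (toℕ i)

    number : Vertex → ℕ
    number (apex N)  = 0
    number (apex W)  = 1
    number (apex S)  = 2
    number (apex E)  = 3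
    number (inner i) = 4 ℕ.+ i

    number-vertex : ∀ v → number (vertex v) ≡ toℕ v
    number-vertex 0F = refl
    number-vertex 1F = refl
    number-vertex 2F = refl
    number-vertex 3F = refl
    number-vertex (suc (suc (suc (suc i)))) = refl

    vertex-injective : ∀ {v w} → vertex v ≡ vertex w → v ≡ w
    vertex-injective {v} {w} e = Finₚ.toℕ-injective
      (trans (sym (number-vertex v)) (trans (cong number e) (number-vertex w)))

    innerᶠ : Fin (suc k) → Vtx
    innerᶠ i = suc (suc (suc (suc i)))

    innerᶠ-injective : ∀ {i j} → innerᶠ i ≡ innerᶠ j → i ≡ j
    innerᶠ-injective refl = refl

    linkᶠ : Fin k → Vtx × Vtx
    linkᶠ i = innerᶠ (inject₁ i) , innerᶠ (suc i)

    -- All pairs of apices except `W` and `E`.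
    outer : List (Vtx × Vtx)
    outer = (0F , 1F) ∷ (0F , 2F) ∷ (0F , 3F) ∷ (1F , 2F) ∷ (2F , 3F) ∷ []

    apices : List Vtx
    apices = 0F ∷ 1F ∷ 2F ∷ 3F ∷ []

    inners : List Vtx
    inners = tabulate innerᶠ

    spokes links : List (Vtx × Vtx)
    spokes = cartesianProduct apices inners
    links  = tabulate linkᶠ

    data Origin : Vtx × Vtx → Set where
      outerᵉ : ∀ {e} → e ∈ outer → Origin e
      spokeᵉ : ∀ {u} → u ∈ apices → ∀ i → Origin (u , innerᶠ i)
      linkᵉ  : ∀ i → Origin (innerᶠ (inject₁ i) , innerᶠ (suc i))

    spoke-origin : ∀ {e} → e ∈ spokes → ∃ λ u → ∃ λ i → u ∈ apices × e ≡ (u , innerᶠ i)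
    spoke-origin {u , v} e∈ with ∈-cartesianProduct⁻ apices inners e∈
    ... | u∈ , v∈ with ∈-tabulate⁻ {f = innerᶠ} v∈
    ...   | i , refl = u , i , u∈ , refl

    origin : ∀ {e} → e ∈ outer ++ (spokes ++ links) → Origin e
    origin e∈ with ∈-++⁻ outer e∈
    ... | inj₁ o = outerᵉ o
    ... | inj₂ r with ∈-++⁻ spokes r
    ...   | inj₁ s with spoke-origin s
    ...     | u , i , u∈ , refl = spokeᵉ u∈ i
    origin e∈ | inj₂ r | inj₂ l with ∈-tabulate⁻ {f = linkᶠ} l
    ... | i , refl = linkᵉ i

    origin-ordered : ∀ {e} → Origin e → proj₁ e <ᶠ proj₂ e
    origin-ordered (outerᵉ (here refl)) = s≤s z≤n
    origin-ordered (outerᵉ (there (here refl))) = s≤s z≤n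
    origin-ordered (outerᵉ (there (there (here refl)))) = s≤s z≤n
    origin-ordered (outerᵉ (there (there (there (here refl))))) = s≤s (s≤s z≤n)
    origin-ordered (outerᵉ (there (there (there (there (here refl)))))) = s≤s (s≤s (s≤s z≤n))
    origin-ordered (spokeᵉ (here refl) i) = s≤s z≤n
    origin-ordered (spokeᵉ (there (here refl)) i) = s≤s (s≤s z≤n)
    origin-ordered (spokeᵉ (there (there (here refl))) i) = s≤s (s≤s (s≤s z≤n))
    origin-ordered (spokeᵉ (there (there (there (here refl)))) i) = s≤s (s≤s (s≤s (s≤s z≤n)))
    origin-ordered (linkᵉ i) = s≤s (s≤s (s≤s (s≤s (s≤s (ℕₚ.≤-reflexive (Finₚ.toℕ-inject₁ i))))))

    origin-edge : ∀ {e} → Origin e → IsEdge (vertex (proj₁ e) , vertex (proj₂ e))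
    origin-edge (outerᵉ (here refl)) = nw
    origin-edge (outerᵉ (there (here refl))) = ns
    origin-edge (outerᵉ (there (there (here refl)))) = ne
    origin-edge (outerᵉ (there (there (there (here refl))))) = ws
    origin-edge (outerᵉ (there (there (there (there (here refl)))))) = se
    origin-edge (spokeᵉ (here refl) i) = spoke N (toℕ i)
    origin-edge (spokeᵉ (there (here refl)) i) = spoke W (toℕ i)
    origin-edge (spokeᵉ (there (there (here refl))) i) = spoke S (toℕ i)
    origin-edge (spokeᵉ (there (there (there (here refl)))) i) = spoke E (toℕ i)
    origin-edge (linkᵉ i) = subst (λ m → IsEdge (inner m , inner (suc (toℕ i)))) (sym (Finₚ.toℕ-inject₁ i)) (link (toℕ i))

    outer-target : ∀ {e} → e ∈ outer → ∀ i → proj₂ e ≢ innerᶠ i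
    outer-target (here refl) i ()
    outer-target (there (here refl)) i ()
    outer-target (there (there (here refl))) i ()
    outer-target (there (there (there (here refl)))) i ()
    outer-target (there (there (there (there (here refl))))) i ()

    apices-inner : ∀ {u} → u ∈ apices → ∀ i → u ≢ innerᶠ i
    apices-inner (here refl) i ()
    apices-inner (there (here refl)) i ()
    apices-inner (there (there (here refl))) i ()
    apices-inner (there (there (there (here refl)))) i ()

    outer-disjoint : Disjoint outer (spokes ++ links)
    outer-disjoint (o , r) with ∈-++⁻ spokes r
    ... | inj₂ l with ∈-tabulate⁻ {f = linkᶠ} l
    ...   | i , refl = outer-target o (suc i) refl
    outer-disjoint (o , r) | inj₁ s with spoke-origin s
    ... | u , i , _ , refl = outer-target o i refl

    spokes-disjoint : Disjoint spokes links
    spokes-disjoint (s , l) with spoke-origin s | ∈-tabulate⁻ {f = linkᶠ} l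
    ... | u , i , u∈ , refl | j , e = apices-inner u∈ (inject₁ j) (cong proj₁ e)

    graph : Graph (5 ℕ.+ k)
    graph = record
      { edges   = outer ++ (spokes ++ links)
      ; ordered = All.tabulate (origin-ordered ∘ origin)
      ; unique  = Uniqueₚ.++⁺ outer-unique (Uniqueₚ.++⁺
          (Uniqueₚ.cartesianProduct⁺ apices-unique (Uniqueₚ.tabulate⁺ innerᶠ-injective))
          (Uniqueₚ.tabulate⁺ (λ e → Finₚ.suc-injective (innerᶠ-injective (cong proj₂ e)))) spokes-disjoint) outer-disjoint
      }
      where
      apices-unique : Unique apices
      apices-unique = ((λ ()) ∷ (λ ()) ∷ (λ ()) ∷ []) ∷ ((λ ()) ∷ (λ ()) ∷ []) ∷ ((λ ()) ∷ []) ∷ [] ∷ []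
      outer-unique : Unique outer
      outer-unique = ((λ ()) ∷ (λ ()) ∷ (λ ()) ∷ (λ ()) ∷ []) ∷ ((λ ()) ∷ (λ ()) ∷ (λ ()) ∷ []) ∷
                     ((λ ()) ∷ (λ ()) ∷ []) ∷ ((λ ()) ∷ []) ∷ [] ∷ []

    edge-count : length (edges graph) ≡ 5 ℕ.* (5 ℕ.+ k) ℕ.∸ 16
    edge-count = begin
      5 ℕ.+ length (spokes ++ links)            ≡⟨ cong (5 ℕ.+_) (length-++ spokes) ⟩
      5 ℕ.+ (length spokes ℕ.+ length links)    ≡⟨ cong₂ (λ s l → 5 ℕ.+ (s ℕ.+ l))
                                                     (trans (length-cartesianProduct apices inners) (cong (4 ℕ.*_) (length-tabulate innerᶠ)))
                                                     (length-tabulate linkᶠ) ⟩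
      -- Adding 16 before subtracting it reduces truncated subtraction to a polynomial identity.
      5 ℕ.+ (4 ℕ.* suc k ℕ.+ k)                 ≡⟨ ℕₚ.m+n∸m≡n 16 (5 ℕ.+ (4 ℕ.* suc k ℕ.+ k)) ⟨
      16 ℕ.+ (5 ℕ.+ (4 ℕ.* suc k ℕ.+ k)) ℕ.∸ 16 ≡⟨ cong (ℕ._∸ 16) (solve 1 (λ k →
          con 16 :+ (con 5 :+ (con 4 :* (con 1 :+ k) :+ k)) := con 5 :* (con 5 :+ k)) refl k) ⟩
      5 ℕ.* (5 ℕ.+ k) ℕ.∸ 16                    ∎
      where
      open ≡-Reasoning

    vertices : Vtx × Vtx → Vertex × Vertex
    vertices (u , v) = vertex u , vertex v

    endOf⇒isEnd : ∀ {w e} → EndOf (vertex w) (vertices e) → IsEnd w e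
    endOf⇒isEnd (inj₁ p) = inj₁ (vertex-injective p)
    endOf⇒isEnd (inj₂ p) = inj₂ (vertex-injective p)

    vertices-injective : ∀ {e f} → vertices e ≡ vertices f → e ≡ f
    vertices-injective p = cong₂ _,_ (vertex-injective (cong proj₁ p)) (vertex-injective (cong proj₂ p))

    shared : ∀ {e f q} → (∀ u → IsEnd u e → IsEnd u f → q ≢ point (vertex u)) → SharedAvoided q (vertices e) (vertices f)
    shared {u , v} avoided _ (inj₁ refl) w∈f = avoided u (inj₁ refl) (endOf⇒isEnd w∈f)
    shared {u , v} avoided _ (inj₂ refl) w∈f = avoided v (inj₂ refl) (endOf⇒isEnd w∈f)

    drawing : Is1BendApRAC graph
    drawing = record
      { pos     = point ∘ vertex
      ; pos-inj = vertex-injective ∘ point-injective _ _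
      ; bend    = λ e → bendOf (vertex (proj₁ e)) (vertex (proj₂ e))
      ; bend-ok = λ e e∈ b → bend-proper (origin-edge (origin e∈))
      ; avoid   = λ e e∈ w w∉e s s∈ on → w∉e (avoid (vertex w) (segment-piece (origin-edge (origin e∈)) s∈) on refl)
      ; apRAC   = λ e f e∈ f∈ e≢f s t s∈ t∈ q on on' avoided →
          cross (e≢f ∘ vertices-injective) (segment-piece (origin-edge (origin e∈)) s∈)
            (segment-piece (origin-edge (origin f∈)) t∈) q on on' (shared avoided)
      }
      where
      avoid : ∀ {w e s} v → PieceOf (vertices e) s → OnSeg (point v) s → v ≡ vertex w → IsEnd w e
      avoid v (c , i , refl , eq) on refl = endOf⇒isEnd (subst (EndOf v) eq (vertex-clear v c i on))
      cross : ∀ {e f s t} → e ≢ f → PieceOf e s → PieceOf f t → ∀ q → OnSeg q s → OnSeg q t →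
              SharedAvoided q e f → Perpendicular s t
      cross e≢f (c , i , refl , refl) (d , j , refl , refl) q = pieces-cross c d i j q e≢f

open import Defs
open import Data.Nat using (ℕ; _*_; _∸_; _≤_; _+_)
open import Data.Nat.Properties using (m≤n+m)
open import Data.List using (length)
open import Data.Product using (_×_; _,_; Σ; ∃)
open import Relation.Binary.PropositionalEquality using (_≡_)
open UpperBound using (upper-bound)
open Family using (module Member)

theorem4 : ((n : ℕ) (G : Graph n) → Is1BendApRAC G → length (edges G) ≤ 5 * n ∸ 8)
    × ((N : ℕ) → Σ ℕ (λ n → N ≤ n × Σ (Graph n) (λ G →
    (length (edges G) ≡ 5 * n ∸ 16) × Is1BendApRAC G)))
theorem4 = upper-bound ,
  -- The index `N` itself can be used as the number of links, since the graph then has `5 + N`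
  -- vertices.
  λ N → 5 + N , m≤n+m N 5 , Member.graph N , Member.edge-count N , Member.drawing N
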